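{- Let $A\subset\mathbb{Z}^m$ be finite, and suppose $D\subseteq A$ is Freiman $2$-isomorphic to $S\subset\mathbb{Z}^d$. Let $S=\bigsqcup_{\theta\in\Theta}S_\theta$ be a partition with $S_\theta\neq\varnothing$ for all $\theta\in\Theta$, and suppose that it has $L^4$ decoupling constant $K$, i.e. for all $(a_x)_{x\in S}\in\mathbb{C}^S$, $$\Big\|\sum_{x\in S}a_xe(x\cdot\xi)\Big\|_{L^4(\mathbb{T}^d,\xi)}\le K\Big(\sum_{\theta\in\Theta}\Big\|\sum_{x\in S_\theta}a_xe(x\cdot\xi)\Big\|_{L^4(\mathbb{T}^d,\xi)}^2\Big)^{1/2}.$$ Then $$\sum_{\theta\in\Theta}\mathrm{Cap}_2(S_\theta)^{1/2}\le K^2|A|^{1/2}\|A\|.$$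
   Context: $e(x)=e^{2\pi i x}$, $\mathbb{T}=\mathbb{R}/\mathbb{Z}$. For a finite set $A\subset\mathbb{Z}^m$, $\|A\|:=\int_{\mathbb{T}^m}\big|\sum_{a\in A}e(a\cdot t)\big|\,dt$. Freiman $2$-isomorphic: there is a bijection $\phi:D\to S$ such that for all $d_1,\dots,d_4\in D$, $d_1+d_2=d_3+d_4$ if and only if $\phi(d_1)+\phi(d_2)=\phi(d_3)+\phi(d_4)$. For a nonempty finite set $X\subset\mathbb{Z}^d$, let $\mathcal{P}(X)$ be the set of probability measures supported on $X$; for $\mu\in\mathcal{P}(X)$ let $E_2(\mu):=\sum_{z}(\mu*\mu)(z)^2$, and define the additive capacity $\mathrm{Cap}_2(X):=\big(\inf_{\mu\in\mathcal{P}(X)}E_2(\mu)\big)^{ -1}$. -}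

module Defs where

open import Algebra.Apartness.Bundles using (HeytingField)
open import Algebra.Bundles using (CommutativeRing; Semiring)
import Algebra.Apartness.Properties.HeytingCommutativeRing as HeytingProperties
import Algebra.Definitions.RawSemiring as RawSemiringDefinitions
import Algebra.Properties.Ring as RingProperties
open import Data.Fin.Base using (Fin; toℕ)
open import Data.Integer.Base as ℤ using (ℤ; -[1+_]) renaming (+_ to pos)
import Data.Integer.Properties as ℤ
open import Data.List.Base as List using (List; length; cartesianProductWith; deduplicate)
import Data.List.Membership.Propositional as List
open import Data.List.Relation.Unary.Unique.Propositional using (Unique)
open import Data.Nat.Base as ℕ using (ℕ; zero; suc; NonZero; _!)
open import Data.Nat.Properties using (_!≢0)
open import Data.Product.Base using (∃; _×_; _,_; proj₁)
open import Data.Sum.Base using (_⊎_; inj₁; inj₂)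
open import Data.Vec.Base as Vec using (Vec; []; _∷_; lookup; zipWith)
open import Data.Vec.Functional using (Vector)
open import Data.Vec.Properties using (≡-dec)
open import Function.Bundles using (_⇔_; Equivalence)
open import Level using (Level; _⊔_) renaming (suc to lsuc)
open import Relation.Binary.Core using (Rel)
open import Relation.Binary.Definitions using (DecidableEquality)
open import Relation.Binary.PropositionalEquality using (_≡_)
open import Relation.Binary.Structures using (IsStrictPartialOrder)
open import Relation.Nullary using (¬_)

infix 8 ℤ^_
ℤ^_ : ℕ → Set
ℤ^ n = Vec ℤ n

infixl 6 _+ᵥ_ _-ᵥ_
_+ᵥ_ _-ᵥ_ : ∀ {n} → ℤ^ n → ℤ^ n → ℤ^ n
_+ᵥ_ = zipWith ℤ._+_
_-ᵥ_ = zipWith ℤ._-_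

_≟ᵥ_ : ∀ {n} → DecidableEquality (ℤ^ n)
_≟ᵥ_ = ≡-dec ℤ._≟_

record FiniteSet (A : Set) : Set where
  field
    elements : List A
    unique   : Unique elements

  card : ℕ
  card = length elements

open FiniteSet public

infix 4 _∈_ _∉_ _⊆_
_∈_ _∉_ : {A : Set} → A → FiniteSet A → Set
x ∈ X = x List.∈ elements X
x ∉ X = ¬ (x ∈ X)

_⊆_ : {A : Set} → FiniteSet A → FiniteSet A → Set
X ⊆ Y = ∀ {x} → x ∈ X → x ∈ Y

-- The map φ is given on all of ℤᵐ; only its restriction to D matters.
record FreimanIsomorphism₂ {m d} (D : FiniteSet (ℤ^ m)) (S : FiniteSet (ℤ^ d)) : Set where
  field
    φ          : ℤ^ m → ℤ^ d
    maps-to    : ∀ {x} → x ∈ D → φ x ∈ S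
    injective  : ∀ {x y} → x ∈ D → y ∈ D → φ x ≡ φ y → x ≡ y
    surjective : ∀ {y} → y ∈ S → ∃ λ x → x ∈ D × φ x ≡ y
    additive   : ∀ {d₁ d₂ d₃ d₄} → d₁ ∈ D → d₂ ∈ D → d₃ ∈ D → d₄ ∈ D →
                 (d₁ +ᵥ d₂ ≡ d₃ +ᵥ d₄) ⇔ (φ d₁ +ᵥ φ d₂ ≡ φ d₃ +ᵥ φ d₄)

record IsPartition {A : Set} {k} (S : FiniteSet A) (part : Fin k → FiniteSet A) : Set where
  field
    nonempty : ∀ θ → ∃ λ x → x ∈ part θ
    union    : ∀ {x} → x ∈ S ⇔ ∃ λ θ → x ∈ part θ
    disjoint : ∀ {x θ θ′} → x ∈ part θ → x ∈ part θ′ → θ ≡ θ′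

-- The real numbers, as a complete Archimedean ordered field.
-- The axioms are the constructive ones: x ≤ y is ¬ (y < x), and the
-- order need not be decidable.  Under excluded middle they characterise
-- ℝ up to unique isomorphism.

record CompleteOrderedField c ℓ₁ ℓ₂ : Set (lsuc (c ⊔ ℓ₁ ⊔ ℓ₂)) where
  field
    heytingField : HeytingField c ℓ₁ ℓ₂

  open HeytingField heytingField public

  commutativeRing : CommutativeRing c ℓ₁
  commutativeRing = record { isCommutativeRing = isCommutativeRing }

  open CommutativeRing commutativeRing public using (ring; semiring)
  open RawSemiringDefinitions (Semiring.rawSemiring semiring) public
    using (_^_; sum) renaming (_×_ to _×ᴿ_)

  infix 4 _<_
  field
    _<_                  : Rel Carrier ℓ₂
    isStrictPartialOrder : IsStrictPartialOrder _≈_ _<_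
    #⇔<⊎>                : ∀ {x y} → x # y ⇔ (x < y ⊎ y < x)
    +-monoˡ-<            : ∀ {x y} z → x < y → x + z < y + z
    *-positive           : ∀ {x y} → 0# < x → 0# < y → 0# < x * y

  infix 4 _≤_
  _≤_ : Rel Carrier ℓ₂
  x ≤ y = ¬ (y < x)

  -- ∣ x - y ∣ < ε
  infix 4 _∼[_]_
  _∼[_]_ : Carrier → Carrier → Carrier → Set ℓ₂
  x ∼[ ε ] y = (x < y + ε) × (y < x + ε)

  Cauchy : (ℕ → Carrier) → Set (c ⊔ ℓ₂)
  Cauchy s = ∀ ε → 0# < ε → ∃ λ N → ∀ {i j} → N ℕ.≤ i → N ℕ.≤ j → s i ∼[ ε ] s j

  infix 4 _⟶_
  _⟶_ : (ℕ → Carrier) → Carrier → Set (c ⊔ ℓ₂)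
  s ⟶ l = ∀ ε → 0# < ε → ∃ λ N → ∀ {i} → N ℕ.≤ i → s i ∼[ ε ] l

  field
    archimedean : ∀ x → ∃ λ n → x < n ×ᴿ 1#
    complete    : ∀ {s} → Cauchy s → ∃ λ l → s ⟶ l

module Reals {c ℓ₁ ℓ₂ : Level} (R : CompleteOrderedField c ℓ₁ ℓ₂) where

  open CompleteOrderedField R public renaming (Carrier to ℝ)
  private
    module < = IsStrictPartialOrder isStrictPartialOrder
    open HeytingProperties (HeytingField.heytingCommutativeRing heytingField) using (1#0; x-0≈x)
    open RingProperties ring using (-1*x≈-x; -‿involutive)

  fromℕ : ℕ → ℝ
  fromℕ n = n ×ᴿ 1#

  fromℤ : ℤ → ℝ
  fromℤ (pos n)  = fromℕ n
  fromℤ -[1+ n ] = - fromℕ (suc n)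

  0<1 : 0# < 1#
  0<1 with Equivalence.to #⇔<⊎> 1#0
  ... | inj₂ 0<1 = 0<1
  ... | inj₁ 1<0 = <.<-respʳ-≈ -1*-1≈1 (*-positive 0<-1 0<-1)
    where
    0<-1 : 0# < - 1#
    0<-1 = <.<-respˡ-≈ (-‿inverseʳ 1#) (<.<-respʳ-≈ (+-identityˡ (- 1#)) (+-monoˡ-< (- 1#) 1<0))

    -1*-1≈1 : - 1# * - 1# ≈ 1#
    -1*-1≈1 = trans (-1*x≈-x (- 1#)) (-‿involutive 1#)

  0<fromℕ : ∀ n → .{{NonZero n}} → 0# < fromℕ n
  0<fromℕ (suc zero)    = <.<-respʳ-≈ (sym (+-identityʳ 1#)) 0<1
  0<fromℕ (suc (suc n)) = <.trans (0<fromℕ (suc n))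
    (<.<-respˡ-≈ (+-identityˡ _) (+-monoˡ-< (fromℕ (suc n)) 0<1))

  infix 9 1/_
  1/_ : ∀ n → .{{NonZero n}} → ℝ
  1/ n = proj₁ (#⇒invertible (Equivalence.from #⇔<⊎> (inj₂ (0<fromℕ n))))

  *-inverseˡ : ∀ n → .{{_ : NonZero n}} → 1/ n * fromℕ n ≈ 1#
  *-inverseˡ n with #⇒invertible (Equivalence.from #⇔<⊎> (inj₂ (0<fromℕ n)))
  ... | (_ , inverseˡ , _) = trans (*-congˡ (sym (x-0≈x (fromℕ n)))) inverseˡ

  IsGreatestLowerBound : ∀ {p} → (ℝ → Set p) → ℝ → Set (c ⊔ ℓ₂ ⊔ p)
  IsGreatestLowerBound P i =
    (∀ {x} → P x → i ≤ x) × (∀ {b} → (∀ {x} → P x → b ≤ x) → b ≤ i)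

  ∑ : {A : Set} → FiniteSet A → (A → ℝ) → ℝ
  ∑ X f = List.foldr (λ x s → f x + s) 0# (elements X)

  infix 5 _+i_
  record ℂ : Set c where
    constructor _+i_
    field
      re im : ℝ
  open ℂ public

  0ᶜ 1ᶜ : ℂ
  0ᶜ = 0# +i 0#
  1ᶜ = 1# +i 0#

  infixl 6 _+ᶜ_
  infixl 7 _*ᶜ_
  infixr 8 _^ᶜ_
  _+ᶜ_ _*ᶜ_ : ℂ → ℂ → ℂ
  z +ᶜ w = re z + re w +i im z + im w
  z *ᶜ w = (re z * re w - im z * im w) +i (re z * im w + im z * re w)

  _^ᶜ_ : ℂ → ℕ → ℂ
  z ^ᶜ zero  = 1ᶜ
  z ^ᶜ suc n = z *ᶜ z ^ᶜ n

  ∑ᶜ : {A : Set} → FiniteSet A → (A → ℂ) → ℂ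
  ∑ᶜ X f = List.foldr (λ x s → f x +ᶜ s) 0ᶜ (elements X)

  infix 4 _⟶ᶜ_
  _⟶ᶜ_ : (ℕ → ℂ) → ℂ → Set (c ⊔ ℓ₂)
  s ⟶ᶜ z = (λ n → re (s n)) ⟶ re z × (λ n → im (s n)) ⟶ im z

  -- Σ_{k<n} zᵏ/k!
  expPartialSum : ℂ → ℕ → ℂ
  expPartialSum z zero    = 0ᶜ
  expPartialSum z (suc n) = expPartialSum z n +ᶜ z ^ᶜ n *ᶜ ((1/ (n !)) {{n !≢0}} +i 0#)

  -- Each component is uniquely determined by its specification (√ on
  -- nonnegative arguments), and π is the least positive zero of the sine.
  record ElementaryFunctions : Set (c ⊔ ℓ₁ ⊔ ℓ₂) where
    infix 9 √_
    field
      √_         : ℝ → ℝ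
      √-nonneg   : ∀ {x} → 0# ≤ x → 0# ≤ √ x
      √-square   : ∀ {x} → 0# ≤ x → √ x * √ x ≈ x
      exp        : ℂ → ℂ
      exp-series : ∀ z → expPartialSum z ⟶ᶜ exp z

    sin : ℝ → ℝ
    sin y = im (exp (0# +i y))

    field
      π           : ℝ
      π-positive  : 0# < π
      sin-π       : sin π ≈ 0#
      sin-below-π : ∀ {y} → 0# < y → y < π → 0# < sin y

  -- Cell k is the product of the intervals [ kᵢ/N , (kᵢ+1)/N ].
  InCell : ∀ {n N} → .{{NonZero N}} → Vec (Fin N) n → Vector ℝ n → Set ℓ₂
  InCell {N = N} k t = ∀ i →
    (fromℕ (toℕ (lookup k i)) * 1/ N ≤ t i) × (t i ≤ fromℕ (suc (toℕ (lookup k i))) * 1/ N)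

  sumCells : ∀ {N} n → (Vec (Fin N) n → ℝ) → ℝ
  sumCells zero    f = f []
  sumCells (suc n) f = sum (λ i → sumCells n (λ k → f (i ∷ k)))

  -- Functions on 𝕋ⁿ are given as functions on ℝⁿ and integrated over the
  -- unit cube.  I is the Riemann integral of f: the Riemann sums of the equal
  -- subdivisions, with arbitrary tags, converge to I.  For bounded f
  -- this agrees with the definition by partitions of mesh tending to 0, and
  -- for continuous f with the Lebesgue integral.
  HasIntegral : ∀ {n} → (Vector ℝ n → ℝ) → ℝ → Set (c ⊔ ℓ₂)
  HasIntegral {n} f I = ∀ ε → 0# < ε → ∃ λ N₀ → ∀ N → .{{_ : NonZero N}} → N₀ ℕ.≤ N →
    (tag : Vec (Fin N) n → Vector ℝ n) → (∀ k → InCell k (tag k)) →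
    (1/ N ^ n * sumCells n (λ k → f (tag k))) ∼[ ε ] I

  record IsProbabilityMeasure {d} (X : FiniteSet (ℤ^ d)) (μ : ℤ^ d → ℝ) : Set (ℓ₁ ⊔ ℓ₂) where
    field
      nonneg    : ∀ x → 0# ≤ μ x
      supported : ∀ {x} → x ∉ X → μ x ≈ 0#
      total     : ∑ X μ ≈ 1#

  -- For μ supported on X, the sum over x ∈ ℤᵈ of μ(x) μ(z − x) reduces to
  -- x ∈ X, and μ * μ is supported on X + X.
  E₂ : ∀ {d} → FiniteSet (ℤ^ d) → (ℤ^ d → ℝ) → ℝ
  E₂ X μ = List.foldr (λ z s → ∑ X (λ x → μ x * μ (z -ᵥ x)) ^ 2 + s) 0#
    (deduplicate _≟ᵥ_ (cartesianProductWith _+ᵥ_ (elements X) (elements X)))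

  IsCap₂ : ∀ {d} → FiniteSet (ℤ^ d) → ℝ → Set (c ⊔ ℓ₁ ⊔ ℓ₂)
  IsCap₂ X κ = ∃ λ i →
    IsGreatestLowerBound (λ E → ∃ λ μ → IsProbabilityMeasure X μ × E ≈ E₂ X μ) i × κ * i ≈ 1#

  module ExponentialSums (F : ElementaryFunctions) where

    open ElementaryFunctions F public

    ∣_∣ : ℂ → ℝ
    ∣ z ∣ = √ (re z ^ 2 + im z ^ 2)

    e : ℝ → ℂ
    e x = exp (0# +i fromℕ 2 * π * x)

    infixl 7 _·_
    _·_ : ∀ {n} → ℤ^ n → Vector ℝ n → ℝ
    a · t = sum (λ i → fromℤ (lookup a i) * t i)

    expSum : ∀ {n} → FiniteSet (ℤ^ n) → (ℤ^ n → ℂ) → Vector ℝ n → ℂ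
    expSum X a ξ = ∑ᶜ X (λ x → a x *ᶜ e (x · ξ))

    Is‖_‖ : ∀ {m} → FiniteSet (ℤ^ m) → ℝ → Set (c ⊔ ℓ₂)
    Is‖ A ‖ = HasIntegral (λ t → ∣ ∑ᶜ A (λ a → e (a · t)) ∣)

    IsL⁴Norm : ∀ {n} → (Vector ℝ n → ℂ) → ℝ → Set (c ⊔ ℓ₂)
    IsL⁴Norm f L = (0# ≤ L) × HasIntegral (λ ξ → ∣ f ξ ∣ ^ 4) (L ^ 4)

    -- Only the values of the coefficients on S matter.
    IsDecouplingConstant : ∀ {d k} → FiniteSet (ℤ^ d) → (Fin k → FiniteSet (ℤ^ d)) → ℝ → Set (c ⊔ ℓ₂)
    IsDecouplingConstant {d} {k} S part K =
      (a : ℤ^ d → ℂ) → ∀ {L : ℝ} {Lθ : Fin k → ℝ} →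
      IsL⁴Norm (expSum S a) L → (∀ θ → IsL⁴Norm (expSum (part θ) a) (Lθ θ)) →
      L ≤ K * √ (sum (λ θ → Lθ θ ^ 2))

{-# OPTIONS --safe #-}
module Submission where

-- Write F for the exponential sum of A.  If a ≥ 0 is carried by S and moved to
-- D by the Freiman isomorphism, giving g = Σ a e(d·t), then Σ a = ∫ g F̄, and
-- Hölder's inequality between L⁴ and L^{4/3} followed by interpolation of F
-- between L¹ and L² gives (Σ a)⁴ ≤ ‖g‖₄⁴ |A| ‖A‖².  The fourth power ‖g‖₄⁴
-- counts additive quadruples, so it is the same for a on S, where decoupling
-- bounds it by K⁴ (Σ_θ c_θ² E₂(μ_θ)^½)² for a = Σ_θ c_θ μ_θ.  Near-minimisers
-- μ_θ and c_θ = Cap₂(S_θ)^½ make both sides powers of Σ_θ c_θ.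
--
-- The integrals are evaluated on grids, where characters average exactly to 0
-- or 1.  This needs e(x + y) = e(x) e(y), which is proved by the Cauchy product
-- of the exponential series, and re e(x) = 1 − 2 sin²(πx) < 1 for 0 < x < 1.

open import Algebra.Apartness.Bundles using (HeytingField)
import Algebra.Apartness.Properties.HeytingCommutativeRing as HeytingProperties
open import Algebra.Bundles using (CommutativeRing)
import Algebra.Properties.AbelianGroup as AbelianGroupProperties
import Algebra.Properties.Ring as RingProperties
import Algebra.Properties.Semiring.Mult as UnoptimisedMultiples
import Algebra.Properties.Semiring.Mult.TCOptimised as Multiples
import Algebra.Properties.Semiring.Sum as VectorSums
import Algebra.Solver.Ring as RingSolver
open import Algebra.Solver.Ring.AlmostCommutativeRing using (fromCommutativeRing; _-Raw-AlmostCommutative⟶_)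
open import Data.Empty using (⊥-elim)
open import Data.Fin.Base as Fin using (Fin; toℕ)
import Data.Fin.Properties as Fin
open import Data.Integer.Base as ℤ using (ℤ; -[1+_]) renaming (+_ to pos)
import Data.Integer.Properties as ℤ
open import Data.List.Base as List using (List; []; _∷_; _++_; length; map; cartesianProductWith)
import Data.List.Membership.DecPropositional as DecMembership
import Data.List.Membership.Propositional as List
open import Data.List.Membership.Propositional.Properties
  using (∈-allFin; ∈-cartesianProductWith⁺; ∈-cartesianProduct⁻; ∈-deduplicate⁺)
open import Data.List.Properties using (length-tabulate)
open import Data.List.Relation.Unary.All as All using (_∷_)
open import Data.List.Relation.Unary.AllPairs using (_∷_)
open import Data.List.Relation.Unary.Any using (here; there)
open import Data.List.Relation.Unary.Unique.DecPropositional.Properties using (deduplicate-!)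
open import Data.List.Relation.Unary.Unique.Propositional using (Unique)
open import Data.List.Relation.Unary.Unique.Propositional.Properties using (allFin⁺)
open import Data.Maybe.Base using (Maybe; just; nothing)
open import Data.Nat.Base as ℕ using (ℕ; zero; suc; NonZero; _!)
import Data.Nat.Properties as ℕ
open import Data.Product.Base using (∃; _×_; _,_; proj₁; proj₂)
open import Data.Sum.Base using (_⊎_; inj₁; inj₂)
open import Data.Vec.Base as Vec using (Vec; []; _∷_; lookup; replicate)
open import Data.Vec.Functional using (Vector)
open import Defs
open import Function.Base using (_∘_)
open import Function.Bundles using (Equivalence)
open import Relation.Binary.Definitions using (DecidableEquality)
open import Relation.Binary.PropositionalEquality as ≡ using (_≡_; _≢_)
import Relation.Binary.Reasoning.Base.Triple as TripleReasoning
import Relation.Binary.Reasoning.Setoid as SetoidReasoning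
open import Relation.Binary.Structures using (IsStrictPartialOrder; IsPreorder)
open import Relation.Nullary using (¬_; Dec; yes; no)

-- The weights c_θ are fixed by balance. If E₂(μ_θ) is close to 1/Cap₂(S_θ), the piece c_θ μ_θ has
-- squared L⁴ norm c_θ² E₂(μ_θ)^½ ≈ c_θ² Cap₂(S_θ)^(-½), and this equals its mass c_θ exactly when
-- c_θ = Cap₂(S_θ)^½. Then C = Σ c_θ satisfies C⁴ ≤ K⁴ C² |A| ‖A‖², from which C² is cancelled.
--
-- The obstacle is that the order is undecidable and that exp, √ and the integrals are known only
-- through their specifications. An infimum does not hand over a near-minimiser; but `≤` is a
-- negation, so a proof of it may argue by cases and may use measures whose existence is only doubly
-- negated. The decoupling hypothesis applies only to L⁴ norms exhibited as Riemann integrals with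
-- arbitrary tags, so the exact values on grids are complemented by a Lipschitz bound for e.
-- Inequalities between integrals go the other way: they are proved for the averages over each grid
-- and passed to the limit.

module IntegerCoefficients {c ℓ} (R : CommutativeRing c ℓ) where
  open CommutativeRing R hiding (zero)
  open AbelianGroupProperties +-abelianGroup using (⁻¹-∙-comm; ε⁻¹≈ε; ⁻¹-involutive)
  open RingProperties ring using (-‿distribˡ-*)
  open Multiples semiring using () renaming (_×_ to _×′_; ×-homo-+ to ×′-homo-+; 1+× to 1+×′)
  open SetoidReasoning setoid

  -- `1 ×′ x` reduces to `x`, so the solver constants 0 and 1 become `0#` and `1#` by computation.
  ι : ℤ → Carrier
  ι (pos n)  = n ×′ 1#
  ι -[1+ n ] = - (suc n ×′ 1#)

  ι-⊖ : ∀ m n → ι (m ℤ.⊖ n) ≈ m ×′ 1# - n ×′ 1#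
  ι-⊖ m       zero    = begin
    m ×′ 1#       ≈⟨ +-identityʳ _ ⟨
    m ×′ 1# + 0#  ≈⟨ +-congˡ ε⁻¹≈ε ⟨
    m ×′ 1# - 0#  ∎
  ι-⊖ zero    (suc n) = sym (+-identityˡ _)
  ι-⊖ (suc m) (suc n) = begin
    ι (suc m ℤ.⊖ suc n)              ≡⟨ ≡.cong ι (ℤ.[1+m]⊖[1+n]≡m⊖n m n) ⟩
    ι (m ℤ.⊖ n)                      ≈⟨ ι-⊖ m n ⟩
    x - y                            ≈⟨ +-congʳ (+-identityˡ x) ⟨
    0# + x - y                       ≈⟨ +-congʳ (+-congʳ (-‿inverseʳ 1#)) ⟨
    1# - 1# + x - y                  ≈⟨ +-congʳ (trans (+-assoc _ _ _) (+-congˡ (+-comm _ _))) ⟩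
    1# + (x - 1#) - y                ≈⟨ +-congʳ (+-assoc _ _ _) ⟨
    1# + x - 1# - y                  ≈⟨ +-assoc _ _ _ ⟩
    1# + x + (- 1# - y)              ≈⟨ +-congˡ (⁻¹-∙-comm 1# y) ⟩
    1# + x - (1# + y)                ≈⟨ +-cong (1+×′ m 1#) (-‿cong (1+×′ n 1#)) ⟨
    suc m ×′ 1# - suc n ×′ 1#        ∎
    where
    x = m ×′ 1#
    y = n ×′ 1#

  ι-+ : ∀ i j → ι (i ℤ.+ j) ≈ ι i + ι j
  ι-+ (pos m)  (pos n)  = ×′-homo-+ 1# m n
  ι-+ (pos m)  -[1+ n ] = ι-⊖ m (suc n)
  ι-+ -[1+ m ] (pos n)  = trans (ι-⊖ n (suc m)) (+-comm _ _)
  ι-+ -[1+ m ] -[1+ n ] = begin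
    - (suc (suc (m ℕ.+ n)) ×′ 1#)        ≡⟨ ≡.cong (λ k → - (k ×′ 1#)) (≡.cong suc (ℕ-+-suc m n)) ⟨
    - ((suc m ℕ.+ suc n) ×′ 1#)          ≈⟨ -‿cong (×′-homo-+ 1# (suc m) (suc n)) ⟩
    - (suc m ×′ 1# + suc n ×′ 1#)        ≈⟨ ⁻¹-∙-comm _ _ ⟨
    - (suc m ×′ 1#) + - (suc n ×′ 1#)    ∎
    where open import Data.Nat.Properties using () renaming (+-suc to ℕ-+-suc)

  ι-neg : ∀ i → ι (ℤ.- i) ≈ - ι i
  ι-neg (pos zero)    = sym ε⁻¹≈ε
  ι-neg (pos (suc n)) = refl
  ι-neg -[1+ n ]      = sym (⁻¹-involutive _)

  ι-pos-* : ∀ m j → ι (pos m ℤ.* j) ≈ m ×′ 1# * ι j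
  ι-pos-* zero    j = begin
    ι (pos zero ℤ.* j)  ≡⟨ ≡.cong ι (ℤ.*-zeroˡ j) ⟩
    0#                  ≈⟨ zeroˡ _ ⟨
    0# * ι j            ∎
  ι-pos-* (suc m) j = begin
    ι (pos (suc m) ℤ.* j)            ≡⟨ ≡.cong ι (ℤ.suc-* (pos m) j) ⟩
    ι (j ℤ.+ pos m ℤ.* j)            ≈⟨ ι-+ j _ ⟩
    ι j + ι (pos m ℤ.* j)            ≈⟨ +-cong (sym (*-identityˡ _)) (ι-pos-* m j) ⟩
    1# * ι j + m ×′ 1# * ι j         ≈⟨ distribʳ _ _ _ ⟨
    (1# + m ×′ 1#) * ι j             ≈⟨ *-congʳ (1+×′ m 1#) ⟨
    suc m ×′ 1# * ι j                ∎

  ι-* : ∀ i j → ι (i ℤ.* j) ≈ ι i * ι j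
  ι-* (pos m)  j = ι-pos-* m j
  ι-* -[1+ m ] j = begin
    ι (-[1+ m ] ℤ.* j)            ≡⟨ ≡.cong ι (ℤ.neg-distribˡ-* (pos (suc m)) j) ⟨
    ι (ℤ.- (pos (suc m) ℤ.* j))   ≈⟨ ι-neg (pos (suc m) ℤ.* j) ⟩
    - ι (pos (suc m) ℤ.* j)       ≈⟨ -‿cong (ι-pos-* (suc m) j) ⟩
    - (suc m ×′ 1# * ι j)         ≈⟨ -‿distribˡ-* _ _ ⟩
    - (suc m ×′ 1#) * ι j         ∎

  homomorphism : CommutativeRing.rawRing ℤ.+-*-commutativeRing -Raw-AlmostCommutative⟶ fromCommutativeRing R
  homomorphism = record
    { ⟦_⟧ = ι ; +-homo = ι-+ ; *-homo = ι-* ; -‿homo = ι-neg ; 0-homo = refl ; 1-homo = refl }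

  -- The solver must recognise equal coefficients. Equality in `R` need not be decidable, so
  -- coefficients are taken in ℤ.
  _coeff≟_ : ∀ i j → Maybe (ι i ≈ ι j)
  i coeff≟ j with i ℤ.≟ j
  ... | yes i≡j = just (reflexive (≡.cong ι i≡j))
  ... | no _    = nothing

  module Solver = RingSolver _ _ homomorphism _coeff≟_

-- Finite sums over lists in a commutative ring.

module ListSums {c ℓ} (R : CommutativeRing c ℓ) where
  open CommutativeRing R hiding (zero)
  open IntegerCoefficients R using (module Solver)
  open SetoidReasoning setoid

  private variable
    A B : Set

  -- Σ[ elements X ] unfolds to the sums ∑ X and ∑ᶜ X of the statement.
  Σ[_] : List A → (A → Carrier) → Carrier
  Σ[ xs ] f = List.foldr (λ x s → f x + s) 0# xs

  Σ-cong∈ : ∀ xs {f g : A → Carrier} → (∀ {x} → x List.∈ xs → f x ≈ g x) → Σ[ xs ] f ≈ Σ[ xs ] g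
  Σ-cong∈ []       _   = refl
  Σ-cong∈ (x ∷ xs) f≈g = +-cong (f≈g (here ≡.refl)) (Σ-cong∈ xs (f≈g ∘ there))

  Σ-cong : ∀ xs {f g : A → Carrier} → (∀ x → f x ≈ g x) → Σ[ xs ] f ≈ Σ[ xs ] g
  Σ-cong xs f≈g = Σ-cong∈ xs (λ {x} _ → f≈g x)

  Σ-+ : ∀ xs (f g : A → Carrier) → Σ[ xs ] (λ x → f x + g x) ≈ Σ[ xs ] f + Σ[ xs ] g
  Σ-+ []       f g = sym (+-identityˡ _)
  Σ-+ (x ∷ xs) f g = trans (+-congˡ (Σ-+ xs f g))
    (solve 4 (λ a b c d → a :+ b :+ (c :+ d) := a :+ c :+ (b :+ d)) refl (f x) (g x) _ _)
    where open Solver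

  Σ-*ˡ : ∀ xs a (f : A → Carrier) → Σ[ xs ] (λ x → a * f x) ≈ a * Σ[ xs ] f
  Σ-*ˡ []       a f = sym (zeroʳ a)
  Σ-*ˡ (x ∷ xs) a f = trans (+-congˡ (Σ-*ˡ xs a f)) (sym (distribˡ _ _ _))

  Σ-*ʳ : ∀ xs a (f : A → Carrier) → Σ[ xs ] (λ x → f x * a) ≈ Σ[ xs ] f * a
  Σ-*ʳ xs a f = trans (Σ-cong xs (λ x → *-comm (f x) a)) (trans (Σ-*ˡ xs a f) (*-comm _ _))

  Σ-zero : ∀ (xs : List A) → Σ[ xs ] (λ _ → 0#) ≈ 0#
  Σ-zero []       = refl
  Σ-zero (x ∷ xs) = trans (+-identityˡ _) (Σ-zero xs)

  Σ-zero∈ : ∀ xs {f : A → Carrier} → (∀ {x} → x List.∈ xs → f x ≈ 0#) → Σ[ xs ] f ≈ 0#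
  Σ-zero∈ xs f≈0 = trans (Σ-cong∈ xs f≈0) (Σ-zero xs)

  Σ-swap : ∀ (xs : List A) (ys : List B) (f : A → B → Carrier) →
           Σ[ xs ] (λ x → Σ[ ys ] (f x)) ≈ Σ[ ys ] (λ y → Σ[ xs ] (λ x → f x y))
  Σ-swap []       ys f = sym (Σ-zero ys)
  Σ-swap (x ∷ xs) ys f = trans (+-congˡ (Σ-swap xs ys f)) (sym (Σ-+ ys (f x) _))

  Σ-++ : ∀ xs ys (f : A → Carrier) → Σ[ xs ++ ys ] f ≈ Σ[ xs ] f + Σ[ ys ] f
  Σ-++ []       ys f = sym (+-identityˡ _)
  Σ-++ (x ∷ xs) ys f = trans (+-congˡ (Σ-++ xs ys f)) (sym (+-assoc _ _ _))

  Σ-map : ∀ (h : A → B) xs (f : B → Carrier) → Σ[ map h xs ] f ≈ Σ[ xs ] (f ∘ h)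
  Σ-map h []       f = refl
  Σ-map h (x ∷ xs) f = +-congˡ (Σ-map h xs f)

  Σ-cartesianProductWith : ∀ {C : Set} (h : A → B → C) xs ys (f : C → Carrier) →
    Σ[ cartesianProductWith h xs ys ] f ≈ Σ[ xs ] (λ x → Σ[ ys ] (λ y → f (h x y)))
  Σ-cartesianProductWith h []       ys f = refl
  Σ-cartesianProductWith h (x ∷ xs) ys f = trans (Σ-++ (map (h x) ys) _ f)
    (+-cong (Σ-map (h x) ys f) (Σ-cartesianProductWith h xs ys f))

  Σ-*-Σ : ∀ (xs : List A) (ys : List B) f g →
          Σ[ xs ] f * Σ[ ys ] g ≈ Σ[ xs ] (λ x → Σ[ ys ] (λ y → f x * g y))
  Σ-*-Σ xs ys f g = trans (sym (Σ-*ʳ xs _ f)) (Σ-cong xs (λ x → sym (Σ-*ˡ ys (f x) g)))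

  -- The Iverson bracket. It takes the decision itself as argument, so that decisions of equivalent
  -- propositions can be exchanged.
  [_]₁ : ∀ {p} {P : Set p} → Dec P → Carrier
  [ yes _ ]₁ = 1#
  [ no  _ ]₁ = 0#

  []₁-cong : ∀ {p q} {P : Set p} {Q : Set q} (P? : Dec P) (Q? : Dec Q) →
             (P → Q) → (Q → P) → [ P? ]₁ ≈ [ Q? ]₁
  []₁-cong (yes _) (yes _) _   _   = refl
  []₁-cong (no _)  (no _)  _   _   = refl
  []₁-cong (yes p) (no ¬q) P⇒Q _   = ⊥-elim (¬q (P⇒Q p))
  []₁-cong (no ¬p) (yes q) _   Q⇒P = ⊥-elim (¬p (Q⇒P q))

  []₁-yes : ∀ {p} {P : Set p} (P? : Dec P) → P → [ P? ]₁ ≈ 1#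
  []₁-yes (yes _) _ = refl
  []₁-yes (no ¬p) p = ⊥-elim (¬p p)

  []₁-no : ∀ {p} {P : Set p} (P? : Dec P) → ¬ P → [ P? ]₁ ≈ 0#
  []₁-no (yes p) ¬p = ⊥-elim (¬p p)
  []₁-no (no _)  _  = refl

  -- The tool behind every change of summation variable below: a sum of brackets is inserted, the
  -- order of summation is exchanged, and the other sum collapses. `Unique` ensures that the
  -- surviving term is counted once.
  Σ-pick : ∀ {p} {P : A → Set p} (P? : ∀ x → Dec (P x)) {xs x₀} (f : A → Carrier) →
           Unique xs → x₀ List.∈ xs → P x₀ → (∀ {x} → x List.∈ xs → P x → x ≡ x₀) →
           Σ[ xs ] (λ x → [ P? x ]₁ * f x) ≈ f x₀
  Σ-pick P? {x ∷ xs} f (x∉xs ∷ _) (here ≡.refl) Px₀ only = begin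
    [ P? x ]₁ * f x + Σ[ xs ] _  ≈⟨ +-cong (*-congʳ ([]₁-yes (P? x) Px₀)) (Σ-zero∈ xs rest≈0) ⟩
    1# * f x + 0#                ≈⟨ trans (+-identityʳ _) (*-identityˡ _) ⟩
    f x                          ∎
    where
    rest≈0 : ∀ {y} → y List.∈ xs → [ P? y ]₁ * f y ≈ 0#
    rest≈0 {y} y∈xs = trans
      (*-congʳ ([]₁-no (P? y) (λ Py → All.lookup x∉xs y∈xs (≡.sym (only (there y∈xs) Py)))))
      (zeroˡ _)
  Σ-pick P? {x ∷ xs} {x₀} f (x∉xs ∷ xs!) (there x₀∈xs) Px₀ only = begin
    [ P? x ]₁ * f x + Σ[ xs ] _  ≈⟨ +-cong
      (*-congʳ ([]₁-no (P? x) (λ Px → All.lookup x∉xs x₀∈xs (only (here ≡.refl) Px))))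
      (Σ-pick P? f xs! x₀∈xs Px₀ (only ∘ there)) ⟩
    0# * f x + f x₀              ≈⟨ trans (+-congʳ (zeroˡ _)) (+-identityˡ _) ⟩
    f x₀                         ∎

  Σ-pick-≡ : (_≟_ : DecidableEquality A) → ∀ {xs x₀} (f : A → Carrier) →
             Unique xs → x₀ List.∈ xs → Σ[ xs ] (λ x → [ x ≟ x₀ ]₁ * f x) ≈ f x₀
  Σ-pick-≡ _≟_ {x₀ = x₀} f xs! x₀∈xs = Σ-pick (_≟ x₀) f xs! x₀∈xs ≡.refl (λ _ x≡x₀ → x≡x₀)

-- Order and inequalities in the constructive reals.

module Order {c ℓ₁ ℓ₂} (R : CompleteOrderedField c ℓ₁ ℓ₂) where
  open Reals R hiding (zero)
  open IsStrictPartialOrder isStrictPartialOrder public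
    using (<-resp-≈; <-respˡ-≈; <-respʳ-≈) renaming (irrefl to <-irrefl; trans to <-trans; asym to <-asym)
  open IntegerCoefficients commutativeRing
  open Solver using (solve; _:=_; _:+_; _:*_; :-_; _:-_; con)
  open ListSums commutativeRing
  open HeytingProperties (HeytingField.heytingCommutativeRing heytingField) using (x-0≈x)

  -- Cotransitivity of apartness carried over to the order. It stands in for trichotomy: the two
  -- alternatives overlap, so one of them can always be found.
  <-cotrans : ∀ {x y} → x < y → ∀ z → x < z ⊎ z < y
  <-cotrans {x} {y} x<y z with #-cotrans (Equivalence.from #⇔<⊎> (inj₁ x<y)) z
  ... | inj₁ x#z with Equivalence.to #⇔<⊎> x#z
  ...   | inj₁ x<z = inj₁ x<z
  ...   | inj₂ z<x = inj₂ (<-trans z<x x<y)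
  <-cotrans {x} {y} x<y z | inj₂ z#y with Equivalence.to #⇔<⊎> z#y
  ...   | inj₁ z<y = inj₂ z<y
  ...   | inj₂ y<z = inj₁ (<-trans x<y y<z)

  <⇒≤ : ∀ {x y} → x < y → x ≤ y
  <⇒≤ x<y y<x = <-asym x<y y<x

  ≤-reflexive : ∀ {x y} → x ≈ y → x ≤ y
  ≤-reflexive x≈y y<x = <-irrefl (sym x≈y) y<x

  ≤-refl : ∀ {x} → x ≤ x
  ≤-refl = ≤-reflexive refl

  <-≤-trans : ∀ {x y z} → x < y → y ≤ z → x < z
  <-≤-trans {z = z} x<y y≤z with <-cotrans x<y z
  ... | inj₁ x<z = x<z
  ... | inj₂ z<y = ⊥-elim (y≤z z<y)

  ≤-<-trans : ∀ {x y z} → x ≤ y → y < z → x < z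
  ≤-<-trans {x} x≤y y<z with <-cotrans y<z x
  ... | inj₁ y<x = ⊥-elim (x≤y y<x)
  ... | inj₂ x<z = x<z

  ≤-trans : ∀ {x y z} → x ≤ y → y ≤ z → x ≤ z
  ≤-trans x≤y y≤z z<x = x≤y (≤-<-trans y≤z z<x)

  ≤-antisym : ∀ {x y} → x ≤ y → y ≤ x → x ≈ y
  ≤-antisym {x} {y} x≤y y≤x = proj₁ (tight x y) ¬#
    where
    ¬# : ¬ (x # y)
    ¬# x#y with Equivalence.to #⇔<⊎> x#y
    ... | inj₁ x<y = y≤x x<y
    ... | inj₂ y<x = x≤y y<x

  ≤-isPreorder : IsPreorder _≈_ _≤_
  ≤-isPreorder = record { isEquivalence = isEquivalence ; reflexive = ≤-reflexive ; trans = ≤-trans }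

  module ≤-Reasoning = TripleReasoning ≤-isPreorder <-asym <-trans <-resp-≈ <⇒≤ <-≤-trans ≤-<-trans

  -- Negations, and so inequalities ≤, may be proved classically.
  ¬-cases : ∀ {q} {Q : Set q} x y → (x < y → ¬ Q) → (y ≤ x → ¬ Q) → ¬ Q
  ¬-cases x y x<y⇒¬Q y≤x⇒¬Q q = y≤x⇒¬Q (λ x<y → x<y⇒¬Q x<y q) q

  +-monoʳ-< : ∀ z {x y} → x < y → z + x < z + y
  +-monoʳ-< z x<y = <-respˡ-≈ (+-comm _ _) (<-respʳ-≈ (+-comm _ _) (+-monoˡ-< z x<y))

  +-mono-< : ∀ {x y u v} → x < y → u < v → x + u < y + v
  +-mono-< {y = y} {u} x<y u<v = <-trans (+-monoˡ-< u x<y) (+-monoʳ-< y u<v)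

  +-cancelʳ-< : ∀ z {x y} → x + z < y + z → x < y
  +-cancelʳ-< z {x} {y} p = <-respˡ-≈ (lem x) (<-respʳ-≈ (lem y) (+-monoˡ-< (- z) p))
    where
    lem : ∀ x → x + z - z ≈ x
    lem x = solve 2 (λ x z → x :+ z :- z := x) refl x z

  +-monoˡ-≤ : ∀ z {x y} → x ≤ y → x + z ≤ y + z
  +-monoˡ-≤ z x≤y p = x≤y (+-cancelʳ-< z p)

  +-monoʳ-≤ : ∀ z {x y} → x ≤ y → z + x ≤ z + y
  +-monoʳ-≤ z x≤y = ≤-trans (≤-reflexive (+-comm _ _)) (≤-trans (+-monoˡ-≤ z x≤y) (≤-reflexive (+-comm _ _)))

  +-mono-≤ : ∀ {x y u v} → x ≤ y → u ≤ v → x + u ≤ y + v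
  +-mono-≤ {y = y} {u} x≤y u≤v = ≤-trans (+-monoˡ-≤ u x≤y) (+-monoʳ-≤ y u≤v)

  +-nonneg : ∀ {x y} → 0# ≤ x → 0# ≤ y → 0# ≤ x + y
  +-nonneg 0≤x 0≤y = ≤-trans (≤-reflexive (sym (+-identityˡ _))) (+-mono-≤ 0≤x 0≤y)

  ≤-by : ∀ {x y} d → 0# ≤ d → y ≈ x + d → x ≤ y
  ≤-by {x} {y} d 0≤d y≈x+d = begin
    x       ≈⟨ +-identityʳ x ⟨
    x + 0#  ≤⟨ +-monoʳ-≤ x 0≤d ⟩
    x + d   ≈⟨ y≈x+d ⟨
    y       ∎
    where open ≤-Reasoning

  <-by : ∀ {x y} d → 0# < d → y ≈ x + d → x < y
  <-by {x} {y} d 0<d y≈x+d = begin-strict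
    x       ≈⟨ +-identityʳ x ⟨
    x + 0#  <⟨ +-monoʳ-< x 0<d ⟩
    x + d   ≈⟨ y≈x+d ⟨
    y       ∎
    where open ≤-Reasoning

  x≤y⇒0≤y-x : ∀ {x y} → x ≤ y → 0# ≤ y - x
  x≤y⇒0≤y-x {x} x≤y = ≤-trans (≤-reflexive (sym (-‿inverseʳ x))) (+-monoˡ-≤ (- x) x≤y)

  x<y⇒0<y-x : ∀ {x y} → x < y → 0# < y - x
  x<y⇒0<y-x {x} x<y = <-respˡ-≈ (-‿inverseʳ x) (+-monoˡ-< (- x) x<y)

  *-nonneg : ∀ {x y} → 0# ≤ x → 0# ≤ y → 0# ≤ x * y
  *-nonneg {x} {y} 0≤x 0≤y = ¬-cases 0# x
    (λ 0<x → ¬-cases 0# y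
      (λ 0<y → <⇒≤ (*-positive 0<x 0<y))
      (λ y≤0 → ≤-reflexive (sym (trans (*-congˡ (≤-antisym y≤0 0≤y)) (zeroʳ x)))))
    (λ x≤0 → ≤-reflexive (sym (trans (*-congʳ (≤-antisym x≤0 0≤x)) (zeroˡ y))))

  *-monoʳ-≤ : ∀ {z} → 0# ≤ z → ∀ {x y} → x ≤ y → z * x ≤ z * y
  *-monoʳ-≤ {z} 0≤z {x} {y} x≤y = ≤-by (z * (y - x)) (*-nonneg 0≤z (x≤y⇒0≤y-x x≤y))
    (solve 3 (λ x y z → z :* y := z :* x :+ z :* (y :- x)) refl x y z)

  *-monoˡ-≤ : ∀ {z} → 0# ≤ z → ∀ {x y} → x ≤ y → x * z ≤ y * z
  *-monoˡ-≤ 0≤z x≤y = ≤-trans (≤-reflexive (*-comm _ _)) (≤-trans (*-monoʳ-≤ 0≤z x≤y) (≤-reflexive (*-comm _ _)))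

  *-monoʳ-< : ∀ {z} → 0# < z → ∀ {x y} → x < y → z * x < z * y
  *-monoʳ-< {z} 0<z {x} {y} x<y = <-by (z * (y - x)) (*-positive 0<z (x<y⇒0<y-x x<y))
    (solve 3 (λ x y z → z :* y := z :* x :+ z :* (y :- x)) refl x y z)

  *-monoˡ-< : ∀ {z} → 0# < z → ∀ {x y} → x < y → x * z < y * z
  *-monoˡ-< 0<z x<y = <-respˡ-≈ (*-comm _ _) (<-respʳ-≈ (*-comm _ _) (*-monoʳ-< 0<z x<y))

  *-mono-≤ : ∀ {x y u v} → 0# ≤ x → 0# ≤ u → x ≤ y → u ≤ v → x * u ≤ y * v
  *-mono-≤ 0≤x 0≤u x≤y u≤v = ≤-trans (*-monoˡ-≤ 0≤u x≤y) (*-monoʳ-≤ (≤-trans 0≤x x≤y) u≤v)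

  *-cancelʳ-≤ : ∀ {z} → 0# < z → ∀ {x y} → x * z ≤ y * z → x ≤ y
  *-cancelʳ-≤ 0<z xz≤yz y<x = xz≤yz (*-monoˡ-< 0<z y<x)

  square-nonneg : ∀ x → 0# ≤ x * x
  square-nonneg x = ¬-cases 0# x
    (λ 0<x → <⇒≤ (*-positive 0<x 0<x))
    (λ x≤0 → ≤-trans (*-nonneg (0≤-x x≤0) (0≤-x x≤0)) (≤-reflexive (solve 1 (λ x → :- x :* :- x := x :* x) refl x)))
    where
    0≤-x : x ≤ 0# → 0# ≤ - x
    0≤-x x≤0 = ≤-by (0# - x) (x≤y⇒0≤y-x x≤0) (solve 1 (λ x → :- x := con (pos 0) :+ (con (pos 0) :- x)) refl x)

  square-cancel-≤ : ∀ {x y} → 0# ≤ y → x * x ≤ y * y → x ≤ y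
  square-cancel-≤ {x} {y} 0≤y xx≤yy y<x = xx≤yy (begin-strict
    y * y  ≤⟨ *-monoʳ-≤ 0≤y (<⇒≤ y<x) ⟩
    y * x  ≈⟨ *-comm y x ⟩
    x * y  <⟨ *-monoʳ-< (≤-<-trans 0≤y y<x) y<x ⟩
    x * x  ∎)
    where open ≤-Reasoning

  square-mono-≤ : ∀ {x y} → 0# ≤ x → x ≤ y → x * x ≤ y * y
  square-mono-≤ 0≤x x≤y = *-mono-≤ 0≤x 0≤x x≤y x≤y

  inverse : ∀ {x} → 0# < x → ∃ λ y → 0# < y × x * y ≈ 1#
  inverse {x} 0<x = y , 0<y , xy≈1
    where
    x⁻¹ = #⇒invertible (Equivalence.from #⇔<⊎> (inj₂ 0<x))
    y = proj₁ x⁻¹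
    xy≈1 : x * y ≈ 1#
    xy≈1 = trans (*-congʳ (sym (x-0≈x x))) (proj₂ (proj₂ x⁻¹))
    y-0 : (y - 0#) * x ≈ 1#
    y-0 = trans (*-congʳ (x-0≈x y)) (trans (*-comm y x) xy≈1)
    0<y : 0# < y
    0<y with Equivalence.to #⇔<⊎> (invertible⇒# (x , trans (*-comm _ _) y-0 , y-0))
    ... | inj₂ 0<y = 0<y
    ... | inj₁ y<0 = ⊥-elim (<-asym 0<1 (<-respˡ-≈ xy≈1 (<-respʳ-≈ (zeroʳ x) (*-monoʳ-< 0<x y<0))))

  fromℕ-≈ : ∀ n → fromℕ n ≈ ι (pos n)
  fromℕ-≈ n = Multiples.×ᵤ≈× semiring n 1#

  fromℕ-* : ∀ m n → fromℕ (m ℕ.* n) ≈ fromℕ m * fromℕ n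
  fromℕ-* = UnoptimisedMultiples.×1-homo-* semiring

  fromℕ-nonneg : ∀ n → 0# ≤ fromℕ n
  fromℕ-nonneg zero    = ≤-refl
  fromℕ-nonneg (suc n) = <⇒≤ (0<fromℕ (suc n))

  fromℕ-mono : ∀ {m n} → m ℕ.≤ n → fromℕ m ≤ fromℕ n
  fromℕ-mono {n = n} ℕ.z≤n = fromℕ-nonneg n
  fromℕ-mono (ℕ.s≤s m≤n) = +-monoʳ-≤ 1# (fromℕ-mono m≤n)

  fromℤ-≈ : ∀ i → fromℤ i ≈ ι i
  fromℤ-≈ (pos n)  = fromℕ-≈ n
  fromℤ-≈ -[1+ n ] = -‿cong (fromℕ-≈ (suc n))

  fromℤ-+ : ∀ i j → fromℤ (i ℤ.+ j) ≈ fromℤ i + fromℤ j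
  fromℤ-+ i j = trans (fromℤ-≈ (i ℤ.+ j)) (trans (ι-+ i j) (sym (+-cong (fromℤ-≈ i) (fromℤ-≈ j))))

  fromℤ-neg : ∀ i → fromℤ (ℤ.- i) ≈ - fromℤ i
  fromℤ-neg i = trans (fromℤ-≈ (ℤ.- i)) (trans (ι-neg i) (-‿cong (sym (fromℤ-≈ i))))

  -- Inverses are unique up to `≈`, so positivity carries over from the inverse supplied by
  -- `inverse`.
  0<1/ : ∀ n .{{_ : NonZero n}} → 0# < 1/ n
  0<1/ n = 0<1/n
    where
    y = inverse (0<fromℕ n)
    0<1/n : 0# < 1/ n
    0<1/n = <-respʳ-≈ (begin
      proj₁ y                        ≈⟨ *-identityˡ _ ⟨
      1# * proj₁ y                   ≈⟨ *-congʳ (*-inverseˡ n) ⟨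
      1/ n * fromℕ n * proj₁ y       ≈⟨ *-assoc _ _ _ ⟩
      1/ n * (fromℕ n * proj₁ y)     ≈⟨ *-congˡ (proj₂ (proj₂ y)) ⟩
      1/ n * 1#                      ≈⟨ *-identityʳ _ ⟩
      1/ n                           ∎) (proj₁ (proj₂ y))
      where open SetoidReasoning setoid

  ½ : ℝ
  ½ = 1/ 2

  ½+½ : ½ + ½ ≈ 1#
  ½+½ = trans (solve 1 (λ h → h :+ h := h :* con (pos 2)) refl ½) (trans (*-congˡ (sym (fromℕ-≈ 2))) (*-inverseˡ 2))

  halves : ∀ ε → ½ * ε + ½ * ε ≈ ε
  halves ε = trans (sym (distribʳ ε ½ ½)) (trans (*-congʳ ½+½) (*-identityˡ ε))

  0<½* : ∀ {ε} → 0# < ε → 0# < ½ * ε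
  0<½* = *-positive (0<1/ 2)

  ½*<  : ∀ {ε} → 0# < ε → ½ * ε < ε
  ½*< {ε} 0<ε = <-by (½ * ε) (0<½* 0<ε) (sym (halves ε))

  ≤-by-ε : ∀ {x y} → (∀ ε → 0# < ε → x ≤ y + ε) → x ≤ y
  ≤-by-ε {x} {y} x≤y+ε y<x = x≤y+ε (½ * (x - y)) (0<½* 0<d) (begin-strict
    y + ½ * (x - y)  <⟨ +-monoʳ-< y (½*< 0<d) ⟩
    y + (x - y)      ≈⟨ solve 2 (λ x y → y :+ (x :- y) := x) refl x y ⟩
    x                ∎)
    where
    open ≤-Reasoning
    0<d = x<y⇒0<y-x y<x

  square≈^2 : ∀ x → x ^ 2 ≈ x * x
  square≈^2 x = *-congˡ (*-identityʳ x)

  ^4≈ : ∀ x → x ^ 4 ≈ (x * x) * (x * x)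
  ^4≈ x = solve 1 (λ x → x :* (x :* (x :* (x :* con (pos 1)))) := x :* x :* (x :* x)) refl x

  private variable
    A : Set

  Σ-mono∈ : ∀ xs {f g : A → ℝ} → (∀ {x} → x List.∈ xs → f x ≤ g x) → Σ[ xs ] f ≤ Σ[ xs ] g
  Σ-mono∈ []       _   = ≤-refl
  Σ-mono∈ (x ∷ xs) f≤g = +-mono-≤ (f≤g (here ≡.refl)) (Σ-mono∈ xs (f≤g ∘ there))

  Σ-mono : ∀ xs {f g : A → ℝ} → (∀ x → f x ≤ g x) → Σ[ xs ] f ≤ Σ[ xs ] g
  Σ-mono xs f≤g = Σ-mono∈ xs (λ {x} _ → f≤g x)

  Σ-nonneg : ∀ xs {f : A → ℝ} → (∀ x → 0# ≤ f x) → 0# ≤ Σ[ xs ] f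
  Σ-nonneg xs 0≤f = ≤-trans (≤-reflexive (sym (Σ-zero xs))) (Σ-mono xs 0≤f)

  Σ-const : ∀ (xs : List A) → Σ[ xs ] (λ _ → 1#) ≈ fromℕ (length xs)
  Σ-const []       = refl
  Σ-const (x ∷ xs) = +-congˡ (Σ-const xs)

  -- Induction on the list. Splitting off the head leaves the cross term 2uvs ≤ u²V + Uv², which is
  -- the inequality of the means combined with the induction hypothesis s² ≤ UV. No division occurs,
  -- so vanishing sums need no separate case.
  cauchy-schwarz : ∀ xs (f g : A → ℝ) →
    Σ[ xs ] (λ x → f x * g x) * Σ[ xs ] (λ x → f x * g x) ≤
    Σ[ xs ] (λ x → f x * f x) * Σ[ xs ] (λ x → g x * g x)
  cauchy-schwarz []       f g = ≤-refl
  cauchy-schwarz (x ∷ xs) f g = begin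
    (u * v + s) * (u * v + s)
      ≈⟨ solve 3 (λ u v s → (u :* v :+ s) :* (u :* v :+ s) := u :* u :* (v :* v) :+ con (pos 2) :* (u :* v :* s) :+ s :* s) refl u v s ⟩
    u * u * (v * v) + 2ℝ * (u * v * s) + s * s
      ≤⟨ +-mono-≤ (+-monoʳ-≤ _ cross) (cauchy-schwarz xs f g) ⟩
    u * u * (v * v) + (u * u * V + U * (v * v)) + U * V
      ≈⟨ solve 4 (λ u v U V → u :* u :* (v :* v) :+ (u :* u :* V :+ U :* (v :* v)) :+ U :* V := (u :* u :+ U) :* (v :* v :+ V)) refl u v U V ⟩
    (u * u + U) * (v * v + V)  ∎
    where
    open ≤-Reasoning
    u = f x
    v = g x
    s = Σ[ xs ] (λ x → f x * g x)
    U = Σ[ xs ] (λ x → f x * f x)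
    V = Σ[ xs ] (λ x → g x * g x)
    2ℝ = ι (pos 2)
    -- both sides squared differ by 4u²v²(UV − s²) + (u²V − Uv²)²
    cross : 2ℝ * (u * v * s) ≤ u * u * V + U * (v * v)
    cross = square-cancel-≤
      (+-nonneg (*-nonneg (square-nonneg u) (Σ-nonneg xs (square-nonneg ∘ g))) (*-nonneg (Σ-nonneg xs (square-nonneg ∘ f)) (square-nonneg v)))
      (≤-by (2ℝ * u * v * (2ℝ * u * v) * (U * V - s * s) + (u * u * V - U * (v * v)) * (u * u * V - U * (v * v)))
        (+-nonneg (*-nonneg (square-nonneg _) (x≤y⇒0≤y-x (cauchy-schwarz xs f g))) (square-nonneg _))
        (solve 5 (λ u v s U V →
          (u :* u :* V :+ U :* (v :* v)) :* (u :* u :* V :+ U :* (v :* v)) :=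
          con (pos 2) :* (u :* v :* s) :* (con (pos 2) :* (u :* v :* s)) :+
          (con (pos 2) :* u :* v :* (con (pos 2) :* u :* v) :* (U :* V :- s :* s) :+ (u :* u :* V :- U :* (v :* v)) :* (u :* u :* V :- U :* (v :* v)))) refl u v s U V))

-- Square roots, absolute values and the complex numbers.

module Modulus {c ℓ₁ ℓ₂} (R : CompleteOrderedField c ℓ₁ ℓ₂) (F : Reals.ElementaryFunctions R) where
  open Reals R hiding (zero)
  open ExponentialSums F
  open Order R
  open IntegerCoefficients commutativeRing using (module Solver)
  open Solver using (solve; _:=_; _:+_; _:*_; :-_; _:-_; con)
  open ListSums commutativeRing

  private variable
    A : Set

  √-≤ : ∀ {x y} → 0# ≤ x → 0# ≤ y → x ≤ y * y → √ x ≤ y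
  √-≤ 0≤x 0≤y x≤yy = square-cancel-≤ 0≤y (≤-trans (≤-reflexive (√-square 0≤x)) x≤yy)

  ≤-√ : ∀ {x y} → 0# ≤ x → y * y ≤ x → y ≤ √ x
  ≤-√ 0≤x yy≤x = square-cancel-≤ (√-nonneg 0≤x) (≤-trans yy≤x (≤-reflexive (sym (√-square 0≤x))))

  -- The specification of `√_` does not include compatibility with `≈`; uniqueness of the
  -- nonnegative root supplies it.
  √-unique : ∀ {x y} → 0# ≤ y → y * y ≈ x → √ x ≈ y
  √-unique {x} {y} 0≤y yy≈x = ≤-antisym (√-≤ 0≤x 0≤y (≤-reflexive (sym yy≈x))) (≤-√ 0≤x (≤-reflexive yy≈x))
    where
    0≤x : 0# ≤ x
    0≤x = ≤-trans (square-nonneg y) (≤-reflexive yy≈x)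

  -- A root rather than a case distinction on the sign, which is undecidable.
  abs : ℝ → ℝ
  abs x = √ (x * x)

  abs-square : ∀ x → abs x * abs x ≈ x * x
  abs-square x = √-square (square-nonneg x)

  abs-nonneg : ∀ x → 0# ≤ abs x
  abs-nonneg x = √-nonneg (square-nonneg x)

  abs-cong : ∀ {x y} → x ≈ y → abs x ≈ abs y
  abs-cong {x} {y} x≈y = √-unique (abs-nonneg y) (trans (abs-square y) (sym (*-cong x≈y x≈y)))

  abs-neg : ∀ x → abs (- x) ≈ abs x
  abs-neg x = √-unique (abs-nonneg x) (trans (abs-square x) (solve 1 (λ x → x :* x := :- x :* :- x) refl x))

  abs-* : ∀ x y → abs (x * y) ≈ abs x * abs y
  abs-* x y = √-unique (*-nonneg (abs-nonneg x) (abs-nonneg y)) (begin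
    abs x * abs y * (abs x * abs y)    ≈⟨ solve 2 (λ a b → a :* b :* (a :* b) := a :* a :* (b :* b)) refl _ _ ⟩
    abs x * abs x * (abs y * abs y)    ≈⟨ *-cong (abs-square x) (abs-square y) ⟩
    x * x * (y * y)                    ≈⟨ solve 2 (λ a b → a :* a :* (b :* b) := a :* b :* (a :* b)) refl x y ⟩
    x * y * (x * y)                    ∎)
    where open SetoidReasoning setoid

  x≤abs : ∀ x → x ≤ abs x
  x≤abs x = ≤-√ (square-nonneg x) ≤-refl

  -x≤abs : ∀ x → - x ≤ abs x
  -x≤abs x = ≤-trans (x≤abs (- x)) (≤-reflexive (abs-neg x))

  abs-≤ : ∀ {x b} → x ≤ b → - x ≤ b → abs x ≤ b
  abs-≤ {x} {b} x≤b -x≤b = √-≤ (square-nonneg x) 0≤b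
    (≤-by ((b - x) * (b - - x)) (*-nonneg (x≤y⇒0≤y-x x≤b) (x≤y⇒0≤y-x -x≤b))
      (solve 2 (λ b x → b :* b := x :* x :+ (b :- x) :* (b :- :- x)) refl b x))
    where
    0≤b : 0# ≤ b
    -- b is the average of b - x and b + x.
    0≤b = ≤-trans (*-nonneg (<⇒≤ (0<1/ 2)) (+-nonneg (x≤y⇒0≤y-x x≤b) (x≤y⇒0≤y-x -x≤b)))
      (≤-reflexive (trans (solve 3 (λ h b x → h :* (b :- x :+ (b :- :- x)) := h :* b :+ h :* b) refl ½ b x) (halves b)))

  abs-of-nonneg : ∀ {x} → 0# ≤ x → abs x ≈ x
  abs-of-nonneg 0≤x = √-unique 0≤x refl

  abs-+ : ∀ x y → abs (x + y) ≤ abs x + abs y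
  abs-+ x y = abs-≤ (+-mono-≤ (x≤abs x) (x≤abs y))
    (≤-trans (≤-reflexive (solve 2 (λ x y → :- (x :+ y) := :- x :+ :- y) refl x y)) (+-mono-≤ (-x≤abs x) (-x≤abs y)))

  abs-0 : abs 0# ≈ 0#
  abs-0 = abs-of-nonneg ≤-refl

  abs-Σ : ∀ xs (f : A → ℝ) → abs (Σ[ xs ] f) ≤ Σ[ xs ] (λ x → abs (f x))
  abs-Σ []       f = ≤-reflexive abs-0
  abs-Σ (x ∷ xs) f = ≤-trans (abs-+ _ _) (+-monoʳ-≤ _ (abs-Σ xs f))

  abs-swap : ∀ x y → abs (x - y) ≈ abs (y - x)
  abs-swap x y = trans (abs-cong (solve 2 (λ x y → x :- y := :- (y :- x)) refl x y)) (abs-neg _)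

  ∼⇒abs : ∀ {x y ε} → x ∼[ ε ] y → abs (x - y) ≤ ε
  ∼⇒abs {x} {y} {ε} (x<y+ε , y<x+ε) = abs-≤
    (≤-by (y + ε - x) (x≤y⇒0≤y-x (<⇒≤ x<y+ε)) (solve 3 (λ x y e → e := x :- y :+ (y :+ e :- x)) refl x y ε))
    (≤-by (x + ε - y) (x≤y⇒0≤y-x (<⇒≤ y<x+ε)) (solve 3 (λ x y e → e := :- (x :- y) :+ (x :+ e :- y)) refl x y ε))

  abs⇒∼ : ∀ {x y δ ε} → abs (x - y) ≤ δ → δ < ε → x ∼[ ε ] y
  abs⇒∼ {x} {y} {δ} {ε} p δ<ε = lem x y p , lem y x (≤-trans (≤-reflexive (abs-swap y x)) p)
    where
    lem : ∀ x y → abs (x - y) ≤ δ → x < y + ε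
    lem x y p = <-respˡ-≈ (solve 2 (λ x y → y :+ (x :- y) := x) refl x y)
      (+-monoʳ-< y (≤-<-trans (≤-trans (x≤abs _) p) δ<ε))

  infix 4 _≈ᶜ_
  _≈ᶜ_ : ℂ → ℂ → Set ℓ₁
  z ≈ᶜ w = (re z ≈ re w) × (im z ≈ im w)

  infix 8 -ᶜ_
  -ᶜ_ : ℂ → ℂ
  -ᶜ z = - re z +i - im z

  -- Makes the solver, the list sums and the Cauchy products available over ℂ.
  ℂ-commutativeRing : CommutativeRing c ℓ₁
  ℂ-commutativeRing = record
    { Carrier = ℂ ; _≈_ = _≈ᶜ_ ; _+_ = _+ᶜ_ ; _*_ = _*ᶜ_ ; -_ = -ᶜ_ ; 0# = 0ᶜ ; 1# = 1ᶜ
    ; isCommutativeRing = record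
      { isRing = record
        { +-isAbelianGroup = record
          { isGroup = record
            { isMonoid = record
              { isSemigroup = record
                { isMagma = record
                  { isEquivalence = record
                    { refl  = refl , refl
                    ; sym   = λ (p , q) → sym p , sym q
                    ; trans = λ (p , q) (p′ , q′) → trans p p′ , trans q q′ }
                  ; ∙-cong = λ (p , q) (p′ , q′) → +-cong p p′ , +-cong q q′ }
                ; assoc = λ x y z → +-assoc _ _ _ , +-assoc _ _ _ }
              ; identity = (λ x → +-identityˡ _ , +-identityˡ _) , (λ x → +-identityʳ _ , +-identityʳ _) }
            ; inverse = (λ x → -‿inverseˡ _ , -‿inverseˡ _) , (λ x → -‿inverseʳ _ , -‿inverseʳ _)
            ; ⁻¹-cong = λ (p , q) → -‿cong p , -‿cong q }
          ; comm = λ x y → +-comm _ _ , +-comm _ _ }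
        ; *-cong = λ (p , q) (p′ , q′) →
            +-cong (*-cong p p′) (-‿cong (*-cong q q′)) , +-cong (*-cong p q′) (*-cong q p′)
        ; *-assoc = λ (a +i b) (c +i d) (e +i f) →
            solve 6 (λ a b c d e f → (a :* c :- b :* d) :* e :- (a :* d :+ b :* c) :* f := a :* (c :* e :- d :* f) :- b :* (c :* f :+ d :* e)) refl a b c d e f ,
            solve 6 (λ a b c d e f → (a :* c :- b :* d) :* f :+ (a :* d :+ b :* c) :* e := a :* (c :* f :+ d :* e) :+ b :* (c :* e :- d :* f)) refl a b c d e f
        ; *-identity =
            (λ (a +i b) → solve 2 (λ a b → con (pos 1) :* a :- con (pos 0) :* b := a) refl a b ,
                          solve 2 (λ a b → con (pos 1) :* b :+ con (pos 0) :* a := b) refl a b) ,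
            (λ (a +i b) → solve 2 (λ a b → a :* con (pos 1) :- b :* con (pos 0) := a) refl a b ,
                          solve 2 (λ a b → a :* con (pos 0) :+ b :* con (pos 1) := b) refl a b)
        ; distrib =
            (λ (a +i b) (c +i d) (e +i f) →
              solve 6 (λ a b c d e f → a :* (c :+ e) :- b :* (d :+ f) := a :* c :- b :* d :+ (a :* e :- b :* f)) refl a b c d e f ,
              solve 6 (λ a b c d e f → a :* (d :+ f) :+ b :* (c :+ e) := a :* d :+ b :* c :+ (a :* f :+ b :* e)) refl a b c d e f) ,
            (λ (a +i b) (c +i d) (e +i f) →
              solve 6 (λ a b c d e f → (c :+ e) :* a :- (d :+ f) :* b := c :* a :- d :* b :+ (e :* a :- f :* b)) refl a b c d e f ,
              solve 6 (λ a b c d e f → (c :+ e) :* b :+ (d :+ f) :* a := c :* b :+ d :* a :+ (e :* b :+ f :* a)) refl a b c d e f)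
        }
      ; *-comm = λ (a +i b) (c +i d) →
          solve 4 (λ a b c d → a :* c :- b :* d := c :* a :- d :* b) refl a b c d ,
          solve 4 (λ a b c d → a :* d :+ b :* c := c :* b :+ d :* a) refl a b c d
      }
    }

  module ℂR = CommutativeRing ℂ-commutativeRing
  module ℂΣ = ListSums ℂ-commutativeRing

  conj : ℂ → ℂ
  conj z = re z +i - im z

  conj-* : ∀ z w → conj (z *ᶜ w) ≈ᶜ conj z *ᶜ conj w
  conj-* (a +i b) (c +i d) =
    solve 4 (λ a b c d → a :* c :- b :* d := a :* c :- :- b :* :- d) refl a b c d ,
    solve 4 (λ a b c d → :- (a :* d :+ b :* c) := a :* :- d :+ :- b :* c) refl a b c d

  norm² : ℂ → ℝ
  norm² z = re z * re z + im z * im z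

  norm²-nonneg : ∀ z → 0# ≤ norm² z
  norm²-nonneg z = +-nonneg (square-nonneg _) (square-nonneg _)

  norm²-cong : ∀ {z w} → z ≈ᶜ w → norm² z ≈ norm² w
  norm²-cong (p , q) = +-cong (*-cong p p) (*-cong q q)

  norm²-* : ∀ z w → norm² (z *ᶜ w) ≈ norm² z * norm² w
  norm²-* (a +i b) (c +i d) = solve 4 (λ a b c d →
    (a :* c :- b :* d) :* (a :* c :- b :* d) :+ (a :* d :+ b :* c) :* (a :* d :+ b :* c) :=
    (a :* a :+ b :* b) :* (c :* c :+ d :* d)) refl a b c d

  private
    norm²′ : ∀ z → re z ^ 2 + im z ^ 2 ≈ norm² z
    norm²′ z = +-cong (square≈^2 _) (square≈^2 _)

    norm²′-nonneg : ∀ z → 0# ≤ re z ^ 2 + im z ^ 2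
    norm²′-nonneg z = ≤-trans (norm²-nonneg z) (≤-reflexive (sym (norm²′ z)))

  ∣∣-nonneg : ∀ z → 0# ≤ ∣ z ∣
  ∣∣-nonneg z = √-nonneg (norm²′-nonneg z)

  ∣∣-square : ∀ z → ∣ z ∣ * ∣ z ∣ ≈ norm² z
  ∣∣-square z = trans (√-square (norm²′-nonneg z)) (norm²′ z)

  ∣∣-unique : ∀ z {y} → 0# ≤ y → y * y ≈ norm² z → ∣ z ∣ ≈ y
  ∣∣-unique z 0≤y yy≈ = √-unique 0≤y (trans yy≈ (sym (norm²′ z)))

  ∣∣-≤ : ∀ z {y} → 0# ≤ y → norm² z ≤ y * y → ∣ z ∣ ≤ y
  ∣∣-≤ z 0≤y ≤yy = square-cancel-≤ 0≤y (≤-trans (≤-reflexive (∣∣-square z)) ≤yy)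

  ∣∣-cong : ∀ {z w} → z ≈ᶜ w → ∣ z ∣ ≈ ∣ w ∣
  ∣∣-cong {z} {w} z≈w = ∣∣-unique z (∣∣-nonneg w) (trans (∣∣-square w) (sym (norm²-cong z≈w)))

  ∣∣-* : ∀ z w → ∣ z *ᶜ w ∣ ≈ ∣ z ∣ * ∣ w ∣
  ∣∣-* z w = ∣∣-unique (z *ᶜ w) (*-nonneg (∣∣-nonneg z) (∣∣-nonneg w)) (begin
    ∣ z ∣ * ∣ w ∣ * (∣ z ∣ * ∣ w ∣)    ≈⟨ solve 2 (λ a b → a :* b :* (a :* b) := a :* a :* (b :* b)) refl _ _ ⟩
    ∣ z ∣ * ∣ z ∣ * (∣ w ∣ * ∣ w ∣)    ≈⟨ *-cong (∣∣-square z) (∣∣-square w) ⟩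
    norm² z * norm² w                  ≈⟨ norm²-* z w ⟨
    norm² (z *ᶜ w)                     ∎)
    where open SetoidReasoning setoid

  ∣conj∣ : ∀ z → ∣ conj z ∣ ≈ ∣ z ∣
  ∣conj∣ z = ∣∣-unique (conj z) (∣∣-nonneg z) (trans (∣∣-square z)
    (solve 2 (λ a b → a :* a :+ b :* b := a :* a :+ :- b :* :- b) refl (re z) (im z)))

  abs-re≤ : ∀ z → abs (re z) ≤ ∣ z ∣
  abs-re≤ z = square-cancel-≤ (∣∣-nonneg z) (≤-by (im z * im z) (square-nonneg _) (trans (∣∣-square z) (+-congʳ (sym (abs-square _)))))

  abs-im≤ : ∀ z → abs (im z) ≤ ∣ z ∣
  abs-im≤ z = square-cancel-≤ (∣∣-nonneg z) (≤-by (re z * re z) (square-nonneg _) (trans (∣∣-square z) (trans (+-comm _ _) (+-congʳ (sym (abs-square _))))))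

  ∣+∣≤ : ∀ z w → ∣ z +ᶜ w ∣ ≤ ∣ z ∣ + ∣ w ∣
  ∣+∣≤ z@(a +i b) w@(c +i d) = ∣∣-≤ (z +ᶜ w) (+-nonneg (∣∣-nonneg z) (∣∣-nonneg w)) (begin
    norm² (z +ᶜ w)
      ≈⟨ solve 4 (λ a b c d → (a :+ c) :* (a :+ c) :+ (b :+ d) :* (b :+ d) := a :* a :+ b :* b :+ (a :* c :+ b :* d) :+ (a :* c :+ b :* d) :+ (c :* c :+ d :* d)) refl a b c d ⟩
    norm² z + (a * c + b * d) + (a * c + b * d) + norm² w
      ≤⟨ +-monoˡ-≤ _ (+-mono-≤ (+-monoʳ-≤ _ inner) inner) ⟩
    norm² z + ∣ z ∣ * ∣ w ∣ + ∣ z ∣ * ∣ w ∣ + norm² w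
      ≈⟨ +-cong (+-congʳ (+-congʳ (sym (∣∣-square z)))) (sym (∣∣-square w)) ⟩
    ∣ z ∣ * ∣ z ∣ + ∣ z ∣ * ∣ w ∣ + ∣ z ∣ * ∣ w ∣ + ∣ w ∣ * ∣ w ∣
      ≈⟨ solve 2 (λ p q → p :* p :+ p :* q :+ p :* q :+ q :* q := (p :+ q) :* (p :+ q)) refl ∣ z ∣ ∣ w ∣ ⟩
    (∣ z ∣ + ∣ w ∣) * (∣ z ∣ + ∣ w ∣)  ∎)
    where
    open ≤-Reasoning
    -- Lagrange's identity: |z|² |w|² exceeds (ac + bd)² by (ad - bc)².
    inner : a * c + b * d ≤ ∣ z ∣ * ∣ w ∣
    inner = square-cancel-≤ (*-nonneg (∣∣-nonneg z) (∣∣-nonneg w))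
      (≤-by ((a * d - b * c) * (a * d - b * c)) (square-nonneg _) (begin-equality
        ∣ z ∣ * ∣ w ∣ * (∣ z ∣ * ∣ w ∣)    ≈⟨ solve 2 (λ a b → a :* b :* (a :* b) := a :* a :* (b :* b)) refl _ _ ⟩
        ∣ z ∣ * ∣ z ∣ * (∣ w ∣ * ∣ w ∣)    ≈⟨ *-cong (∣∣-square z) (∣∣-square w) ⟩
        norm² z * norm² w                  ≈⟨ solve 4 (λ a b c d → (a :* a :+ b :* b) :* (c :* c :+ d :* d) :=
             (a :* c :+ b :* d) :* (a :* c :+ b :* d) :+ (a :* d :- b :* c) :* (a :* d :- b :* c)) refl a b c d ⟩
        _  ∎))

  ∣real∣ : ∀ x → ∣ x +i 0# ∣ ≈ abs x
  ∣real∣ x = ∣∣-unique (x +i 0#) (abs-nonneg x) (trans (abs-square x)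
    (solve 1 (λ x → x :* x := x :* x :+ con (pos 0) :* con (pos 0)) refl x))

  ∣0∣ : ∣ 0ᶜ ∣ ≈ 0#
  ∣0∣ = trans (∣real∣ 0#) abs-0

  ∣1∣ : ∣ 1ᶜ ∣ ≈ 1#
  ∣1∣ = trans (∣real∣ 1#) (abs-of-nonneg (<⇒≤ 0<1))

  re-Σ : ∀ xs (f : A → ℂ) → re (ℂΣ.Σ[ xs ] f) ≡ Σ[ xs ] (λ x → re (f x))
  re-Σ []       f = ≡.refl
  re-Σ (x ∷ xs) f = ≡.cong (re (f x) +_) (re-Σ xs f)

  im-Σ : ∀ xs (f : A → ℂ) → im (ℂΣ.Σ[ xs ] f) ≡ Σ[ xs ] (λ x → im (f x))
  im-Σ []       f = ≡.refl
  im-Σ (x ∷ xs) f = ≡.cong (im (f x) +_) (im-Σ xs f)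

  conj-Σ : ∀ xs (f : A → ℂ) → conj (ℂΣ.Σ[ xs ] f) ≈ᶜ ℂΣ.Σ[ xs ] (λ x → conj (f x))
  conj-Σ []       f = refl , solve 0 (:- con (pos 0) := con (pos 0)) refl
  conj-Σ (x ∷ xs) f = +-congˡ (proj₁ (conj-Σ xs f)) ,
    trans (solve 2 (λ a b → :- (a :+ b) := :- a :+ :- b) refl _ _) (+-congˡ (proj₂ (conj-Σ xs f)))

-- Statements that hold from some index on.

Eventually : ∀ {p} → (ℕ → Set p) → Set p
Eventually P = ∃ λ N → ∀ {n} → N ℕ.≤ n → P n

eventually-× : ∀ {p q} {P : ℕ → Set p} {Q : ℕ → Set q} →
               Eventually P → Eventually Q → Eventually (λ n → P n × Q n)
eventually-× (M , p) (N , q) = M ℕ.⊔ N , λ M⊔N≤n →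
  p (ℕ.≤-trans (ℕ.m≤m⊔n M N) M⊔N≤n) , q (ℕ.≤-trans (ℕ.m≤n⊔m M N) M⊔N≤n)

eventually-map : ∀ {p q} {P : ℕ → Set p} {Q : ℕ → Set q} →
                 (∀ {n} → P n → Q n) → Eventually P → Eventually Q
eventually-map f (N , p) = N , λ N≤n → f (p N≤n)

-- Cauchy products of sequences.

module CauchyProduct {c ℓ} (R : CommutativeRing c ℓ) where
  open CommutativeRing R hiding (zero)
  open IntegerCoefficients R using (module Solver)
  open Solver using (solve; _:=_; _:+_; _:*_; :-_; _:-_; con)
  open SetoidReasoning setoid

  partialSum : (ℕ → Carrier) → ℕ → Carrier
  partialSum u zero    = 0#
  partialSum u (suc n) = partialSum u n + u n

  partialSum-cong : ∀ {u v} → (∀ i → u i ≈ v i) → ∀ n → partialSum u n ≈ partialSum v n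
  partialSum-cong u≈v zero    = refl
  partialSum-cong u≈v (suc n) = +-cong (partialSum-cong u≈v n) (u≈v n)

  partialSum-*ˡ : ∀ a u n → partialSum (λ i → a * u i) n ≈ a * partialSum u n
  partialSum-*ˡ a u zero    = sym (zeroʳ a)
  partialSum-*ˡ a u (suc n) = trans (+-congʳ (partialSum-*ˡ a u n)) (sym (distribˡ _ _ _))

  partialSum-front : ∀ u n → partialSum u (suc n) ≈ u 0 + partialSum (u ∘ suc) n
  partialSum-front u zero    = +-comm _ _
  partialSum-front u (suc n) = trans (+-congʳ (partialSum-front u n)) (+-assoc _ _ _)

  -- The coefficient Σ u i * v (n - i) over i ≤ n of the product of two power series, with the
  -- recursion shifting `u` so that no subtraction of indices is needed.
  conv : (ℕ → Carrier) → (ℕ → Carrier) → ℕ → Carrier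
  conv u v zero    = u 0 * v 0
  conv u v (suc n) = u 0 * v (suc n) + conv (u ∘ suc) v n

  conv-congˡ : ∀ {u u′} v → (∀ i → u i ≈ u′ i) → ∀ n → conv u v n ≈ conv u′ v n
  conv-congˡ v u≈u′ zero    = *-congʳ (u≈u′ 0)
  conv-congˡ v u≈u′ (suc n) = +-cong (*-congʳ (u≈u′ 0)) (conv-congˡ v (u≈u′ ∘ suc) n)

  conv-congʳ : ∀ u {v v′} → (∀ i → v i ≈ v′ i) → ∀ n → conv u v n ≈ conv u v′ n
  conv-congʳ u v≈v′ zero    = *-congˡ (v≈v′ 0)
  conv-congʳ u v≈v′ (suc n) = +-cong (*-congˡ (v≈v′ (suc n))) (conv-congʳ (u ∘ suc) v≈v′ n)

  conv-*ˡ : ∀ a u v n → conv (λ i → a * u i) v n ≈ a * conv u v n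
  conv-*ˡ a u v zero    = *-assoc _ _ _
  conv-*ˡ a u v (suc n) = trans (+-cong (*-assoc _ _ _) (conv-*ˡ a (u ∘ suc) v n)) (sym (distribˡ _ _ _))

  conv-*ʳ : ∀ a u v n → conv u (λ i → a * v i) n ≈ a * conv u v n
  conv-*ʳ a u v zero    = solve 3 (λ a u v → u :* (a :* v) := a :* (u :* v)) refl a (u 0) (v 0)
  conv-*ʳ a u v (suc n) = trans (+-congˡ (conv-*ʳ a (u ∘ suc) v n))
    (solve 4 (λ a u v s → u :* (a :* v) :+ a :* s := a :* (u :* v :+ s)) refl a (u 0) (v (suc n)) _)

  conv-+ˡ : ∀ u u′ v n → conv (λ i → u i + u′ i) v n ≈ conv u v n + conv u′ v n
  conv-+ˡ u u′ v zero    = distribʳ _ _ _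
  conv-+ˡ u u′ v (suc n) = trans (+-congˡ (conv-+ˡ (u ∘ suc) (u′ ∘ suc) v n))
    (solve 5 (λ u u′ v s t → (u :+ u′) :* v :+ (s :+ t) := u :* v :+ s :+ (u′ :* v :+ t)) refl (u 0) (u′ 0) (v (suc n)) _ _)

  conv-shiftʳ : ∀ u v → v 0 ≈ 0# → ∀ n → conv u v (suc n) ≈ conv u (v ∘ suc) n
  conv-shiftʳ u v v0≈0 zero    = trans (+-congˡ (trans (*-congˡ v0≈0) (zeroʳ _))) (+-identityʳ _)
  conv-shiftʳ u v v0≈0 (suc n) = +-congˡ (conv-shiftʳ (u ∘ suc) v v0≈0 n)

  module _ (ν : ℕ → Carrier) (ν-zero : ν 0 ≈ 0#) (ν-suc : ∀ n → ν (suc n) ≈ 1# + ν n) where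

    -- The Leibniz rule for the operator uᵢ ↦ i uᵢ, which is x d/dx on power series: each product uᵢ
    -- vⱼ with i + j = n receives the factor i + j. Here ν embeds ℕ in the ring.
    conv-leibniz : ∀ u v n → conv (λ i → ν i * u i) v n + conv u (λ i → ν i * v i) n ≈ ν n * conv u v n
    conv-leibniz u v zero = begin
      ν 0 * u 0 * v 0 + u 0 * (ν 0 * v 0)  ≈⟨ +-cong (*-congʳ (*-congʳ ν-zero)) (*-congˡ (*-congʳ ν-zero)) ⟩
      0# * u 0 * v 0 + u 0 * (0# * v 0)    ≈⟨ solve 2 (λ u v → con (pos 0) :* u :* v :+ u :* (con (pos 0) :* v) := con (pos 0) :* (u :* v)) refl (u 0) (v 0) ⟩
      0# * (u 0 * v 0)                     ≈⟨ *-congʳ ν-zero ⟨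
      ν 0 * (u 0 * v 0)                    ∎
    conv-leibniz u v (suc n) = begin
      ν 0 * u 0 * v (suc n) + conv (λ i → ν (suc i) * u (suc i)) v n + (u 0 * (ν (suc n) * v (suc n)) + q)
        ≈⟨ +-congʳ (+-cong (*-congʳ (*-congʳ ν-zero)) shifted) ⟩
      0# * u 0 * v (suc n) + (r + p) + (u 0 * (ν (suc n) * v (suc n)) + q)
        ≈⟨ solve 6 (λ u v n p q r → con (pos 0) :* u :* v :+ (r :+ p) :+ (u :* (n :* v) :+ q) := n :* (u :* v) :+ (r :+ (p :+ q))) refl (u 0) (v (suc n)) (ν (suc n)) p q r ⟩
      ν (suc n) * (u 0 * v (suc n)) + (r + (p + q))
        ≈⟨ +-congˡ (+-congˡ (conv-leibniz (u ∘ suc) v n)) ⟩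
      ν (suc n) * (u 0 * v (suc n)) + (r + ν n * r)
        ≈⟨ +-congˡ (+-congʳ (sym (*-identityˡ r))) ⟩
      ν (suc n) * (u 0 * v (suc n)) + (1# * r + ν n * r)
        ≈⟨ +-congˡ (trans (sym (distribʳ r 1# (ν n))) (*-congʳ (sym (ν-suc n)))) ⟩
      ν (suc n) * (u 0 * v (suc n)) + ν (suc n) * r
        ≈⟨ distribˡ _ _ _ ⟨
      ν (suc n) * (u 0 * v (suc n) + r) ∎
      where
      p = conv (λ i → ν i * u (suc i)) v n
      q = conv (u ∘ suc) (λ i → ν i * v i) n
      r = conv (u ∘ suc) v n
      shifted : conv (λ i → ν (suc i) * u (suc i)) v n ≈ r + p
      shifted = trans
        (conv-congˡ v (λ i → trans (*-congʳ (ν-suc i)) (trans (distribʳ _ _ _) (+-congʳ (*-identityˡ _)))) n)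
        (conv-+ˡ (u ∘ suc) (λ i → ν i * u (suc i)) v n)

    -- A sequence u with (i + 1) uᵢ₊₁ = a uᵢ is determined by a and u₀, and
    -- the coefficients of a product of two such series satisfy the
    -- recurrence for the sum of the two ratios.
    conv-exponential : ∀ {u v w : ℕ → Carrier} {a b} (ν⁻¹ : ℕ → Carrier) → (∀ n → ν⁻¹ n * ν (suc n) ≈ 1#) →
      (∀ n → ν (suc n) * u (suc n) ≈ a * u n) → (∀ n → ν (suc n) * v (suc n) ≈ b * v n) →
      (∀ n → ν (suc n) * w (suc n) ≈ (a + b) * w n) → u 0 * v 0 ≈ w 0 → ∀ n → conv u v n ≈ w n
    conv-exponential                         ν⁻¹ inv u-rec v-rec w-rec uv≈w zero = uv≈w
    conv-exponential {u} {v} {w} {a} {b} ν⁻¹ inv u-rec v-rec w-rec uv≈w (suc n) = begin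
      conv u v (suc n)                               ≈⟨ cancel _ ⟨
      ν⁻¹ n * (ν (suc n) * conv u v (suc n))         ≈⟨ *-congˡ (conv-leibniz u v (suc n)) ⟨
      ν⁻¹ n * (conv (λ i → ν i * u i) v (suc n) + conv u (λ i → ν i * v i) (suc n))
                                                     ≈⟨ *-congˡ (+-cong left right) ⟩
      ν⁻¹ n * (a * conv u v n + b * conv u v n)      ≈⟨ *-congˡ (trans (sym (distribʳ _ _ _)) (*-congˡ (conv-exponential {u} {v} {w} {a} {b} ν⁻¹ inv u-rec v-rec w-rec uv≈w n))) ⟩
      ν⁻¹ n * ((a + b) * w n)                        ≈⟨ *-congˡ (w-rec n) ⟨
      ν⁻¹ n * (ν (suc n) * w (suc n))                ≈⟨ cancel _ ⟩
      w (suc n)                                      ∎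
      where
      cancel : ∀ x → ν⁻¹ n * (ν (suc n) * x) ≈ x
      cancel x = trans (sym (*-assoc _ _ _)) (trans (*-congʳ (inv n)) (*-identityˡ x))
      left : conv (λ i → ν i * u i) v (suc n) ≈ a * conv u v n
      left = begin
        ν 0 * u 0 * v (suc n) + conv (λ i → ν (suc i) * u (suc i)) v n
          ≈⟨ +-cong (trans (*-congʳ (trans (*-congʳ ν-zero) (zeroˡ _))) (zeroˡ _)) (conv-congˡ v u-rec n) ⟩
        0# + conv (λ i → a * u i) v n  ≈⟨ trans (+-identityˡ _) (conv-*ˡ a u v n) ⟩
        a * conv u v n ∎
      right : conv u (λ i → ν i * v i) (suc n) ≈ b * conv u v n
      right = trans (conv-shiftʳ u _ (trans (*-congʳ ν-zero) (zeroˡ _)) n)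
        (trans (conv-congʳ u v-rec n) (conv-*ʳ b u v n))

  -- Σ u i * v j over the pairs with i + j < n
  triangle : (ℕ → Carrier) → (ℕ → Carrier) → ℕ → Carrier
  triangle u v zero    = 0#
  triangle u v (suc n) = u 0 * partialSum v (suc n) + triangle (u ∘ suc) v n

  -- Enlarging the triangle by one adds the antidiagonal i + j = n.
  triangle-suc : ∀ u v n → triangle u v (suc n) ≈ triangle u v n + conv u v n
  triangle-suc u v zero    = solve 2 (λ u v → u :* (con (pos 0) :+ v) :+ con (pos 0) := con (pos 0) :+ u :* v) refl (u 0) (v 0)
  triangle-suc u v (suc n) = trans (+-congˡ (triangle-suc (u ∘ suc) v n))
    (solve 5 (λ u s v t k → u :* (s :+ v) :+ (t :+ k) := u :* s :+ t :+ (u :* v :+ k)) refl (u 0) (partialSum v (suc n)) (v (suc n)) _ _)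

  triangle≈ : ∀ u v n → triangle u v n ≈ partialSum (conv u v) n
  triangle≈ u v zero    = refl
  triangle≈ u v (suc n) = trans (triangle-suc u v n) (+-congʳ (triangle≈ u v n))

  -- For n ≤ N this is the sum of u i * v j over the part of the rectangle i < n, j < N that lies
  -- outside the triangle i + j < n.
  excess : (ℕ → Carrier) → (ℕ → Carrier) → ℕ → ℕ → Carrier
  excess u v n N = partialSum u n * partialSum v N - triangle u v n

  -- Splits off the row i = 0, which contributes `u 0` times a tail of `v`; the other rows form an
  -- excess for the shifted sequence. In this form the excess can be estimated row by row.
  excess-suc : ∀ u v n N → excess u v (suc n) N ≈
               u 0 * (partialSum v N - partialSum v (suc n)) + excess (u ∘ suc) v n N
  excess-suc u v n N = trans (+-congʳ (*-congʳ (partialSum-front u n)))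
    (solve 5 (λ u s V w t → (u :+ s) :* V :- (u :* w :+ t) := u :* (V :- w) :+ (s :* V :- t)) refl
      (u 0) (partialSum (u ∘ suc) n) (partialSum v N) (partialSum v (suc n)) (triangle (u ∘ suc) v n))

-- Limits of real sequences.

module Limits {c ℓ₁ ℓ₂} (R : CompleteOrderedField c ℓ₁ ℓ₂) (F : Reals.ElementaryFunctions R) where
  open Reals R hiding (zero)
  open Order R
  open Modulus R F
  open IntegerCoefficients commutativeRing using (module Solver)
  open Solver using (solve; _:=_; _:+_; _:*_; :-_; _:-_; con)

  infix 4 _⇝_
  -- A form of `⟶` with one closed condition in place of two strict ones, so that error bounds can
  -- be chained with `≤` and proved classically.
  _⇝_ : (ℕ → ℝ) → ℝ → Set _
  s ⇝ l = ∀ ε → 0# < ε → Eventually (λ n → abs (s n - l) ≤ ε)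

  ⟶⇒⇝ : ∀ {s l} → s ⟶ l → s ⇝ l
  ⟶⇒⇝ s⟶l ε 0<ε = eventually-map ∼⇒abs (s⟶l ε 0<ε)

  ⇝-cong : ∀ {s t l m} → (∀ n → s n ≈ t n) → l ≈ m → s ⇝ l → t ⇝ m
  ⇝-cong s≈t l≈m s⇝l ε 0<ε = eventually-map
    (λ {n} p → ≤-trans (≤-reflexive (abs-cong (+-cong (sym (s≈t n)) (-‿cong (sym l≈m))))) p) (s⇝l ε 0<ε)

  ⇝-eventually-const : ∀ {s l} → Eventually (λ n → s n ≈ l) → s ⇝ l
  ⇝-eventually-const {l = l} s≈l ε 0<ε = eventually-map
    (λ p → ≤-trans (≤-reflexive (trans (abs-cong (trans (+-congʳ p) (-‿inverseʳ l))) abs-0)) (<⇒≤ 0<ε)) s≈l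

  ⇝-const : ∀ l → (λ _ → l) ⇝ l
  ⇝-const l = ⇝-eventually-const (0 , λ _ → refl)

  ⇝-subsequence : ∀ {s l} (f : ℕ → ℕ) → (∀ n → n ℕ.≤ f n) → s ⇝ l → (s ∘ f) ⇝ l
  ⇝-subsequence f n≤fn s⇝l ε 0<ε with s⇝l ε 0<ε
  ... | N , p = N , λ N≤n → p (ℕ.≤-trans N≤n (n≤fn _))

  ⇝-+ : ∀ {s t a b} → s ⇝ a → t ⇝ b → (λ n → s n + t n) ⇝ a + b
  ⇝-+ {s} {t} {a} {b} s⇝a t⇝b ε 0<ε = eventually-map
    (λ {n} (p , q) → begin
      abs (s n + t n - (a + b))        ≈⟨ abs-cong (solve 4 (λ s t a b → s :+ t :- (a :+ b) := (s :- a) :+ (t :- b)) refl (s n) (t n) a b) ⟩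
      abs ((s n - a) + (t n - b))      ≤⟨ abs-+ _ _ ⟩
      abs (s n - a) + abs (t n - b)    ≤⟨ +-mono-≤ p q ⟩
      ½ * ε + ½ * ε                    ≈⟨ halves ε ⟩
      ε                                ∎)
    (eventually-× (s⇝a (½ * ε) (0<½* 0<ε)) (t⇝b (½ * ε) (0<½* 0<ε)))
    where open ≤-Reasoning

  ⇝-neg : ∀ {s a} → s ⇝ a → (λ n → - s n) ⇝ - a
  ⇝-neg {s} {a} s⇝a ε 0<ε = eventually-map
    (λ {n} p → ≤-trans (≤-reflexive (trans (abs-cong (solve 2 (λ s a → :- s :- :- a := :- (s :- a)) refl (s n) a)) (abs-neg _))) p)
    (s⇝a ε 0<ε)

  ⇝-- : ∀ {s t a b} → s ⇝ a → t ⇝ b → (λ n → s n - t n) ⇝ a - b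
  ⇝-- s⇝a t⇝b = ⇝-+ s⇝a (⇝-neg t⇝b)

  ⇝-* : ∀ {s t a b} → s ⇝ a → t ⇝ b → (λ n → s n * t n) ⇝ a * b
  ⇝-* {s} {t} {a} {b} s⇝a t⇝b ε 0<ε = eventually-map
    (λ {n} (p , q , r) → begin
      abs (s n * t n - a * b)
        ≈⟨ abs-cong (solve 4 (λ s t a b → s :* t :- a :* b := (s :- a) :* (t :- b) :+ (a :* (t :- b) :+ b :* (s :- a))) refl (s n) (t n) a b) ⟩
      abs ((s n - a) * (t n - b) + (a * (t n - b) + b * (s n - a)))
        ≤⟨ ≤-trans (abs-+ _ _) (+-monoʳ-≤ _ (abs-+ _ _)) ⟩
      abs ((s n - a) * (t n - b)) + (abs (a * (t n - b)) + abs (b * (s n - a)))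
        ≈⟨ +-cong (abs-* _ _) (+-cong (abs-* _ _) (abs-* _ _)) ⟩
      abs (s n - a) * abs (t n - b) + (abs a * abs (t n - b) + abs b * abs (s n - a))
        ≤⟨ +-mono-≤ (*-mono-≤ (abs-nonneg _) (abs-nonneg _) p r)
             (+-mono-≤ (*-monoʳ-≤ (abs-nonneg a) r) (*-monoʳ-≤ (abs-nonneg b) q)) ⟩
      1# * (ε * M⁻¹) + (abs a * (ε * M⁻¹) + abs b * (ε * M⁻¹))
        ≈⟨ solve 4 (λ e i a b → con (pos 1) :* (e :* i) :+ (a :* (e :* i) :+ b :* (e :* i)) := e :* ((con (pos 1) :+ (a :+ b)) :* i)) refl ε M⁻¹ (abs a) (abs b) ⟩
      ε * (M * M⁻¹)
        ≈⟨ trans (*-congˡ (proj₂ (proj₂ M-inverse))) (*-identityʳ ε) ⟩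
      ε ∎)
    (eventually-× (s⇝a 1# 0<1) (eventually-× (s⇝a (ε * M⁻¹) 0<εM⁻¹) (t⇝b (ε * M⁻¹) 0<εM⁻¹)))
    where
    open ≤-Reasoning
    -- The error of the product is at most |s - a| |t - b| + |a| |t - b| + |b| |s - a|. With |s - a|
    -- ≤ 1 in the first term and errors ε/M elsewhere, this adds up to ε.
    M = 1# + (abs a + abs b)
    M-inverse = inverse (<-≤-trans 0<1 (≤-by (abs a + abs b) (+-nonneg (abs-nonneg a) (abs-nonneg b)) refl))
    M⁻¹ = proj₁ M-inverse
    0<εM⁻¹ : 0# < ε * M⁻¹
    0<εM⁻¹ = *-positive 0<ε (proj₁ (proj₂ M-inverse))

  ⇝-≤ : ∀ {s t a b} → Eventually (λ n → s n ≤ t n) → s ⇝ a → t ⇝ b → a ≤ b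
  ⇝-≤ {s} {t} {a} {b} s≤t s⇝a t⇝b = ≤-by-ε λ ε 0<ε → bound ε
    (eventually-× s≤t (eventually-× (s⇝a (½ * ε) (0<½* 0<ε)) (t⇝b (½ * ε) (0<½* 0<ε))))
    where
    open ≤-Reasoning
    bound : ∀ ε → Eventually (λ n → s n ≤ t n × abs (s n - a) ≤ ½ * ε × abs (t n - b) ≤ ½ * ε) → a ≤ b + ε
    bound ε (N , p) with p {N} ℕ.≤-refl
    ... | sN≤tN , q , r = begin
      a                                        ≈⟨ solve 2 (λ s a → a := s :+ :- (s :- a)) refl (s N) a ⟩
      s N + - (s N - a)                        ≤⟨ +-mono-≤ sN≤tN (≤-trans (-x≤abs _) q) ⟩
      t N + ½ * ε                              ≈⟨ +-congʳ (solve 2 (λ t b → t := b :+ (t :- b)) refl (t N) b) ⟩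
      b + (t N - b) + ½ * ε                    ≤⟨ +-monoˡ-≤ _ (+-monoʳ-≤ b (≤-trans (x≤abs _) r)) ⟩
      b + ½ * ε + ½ * ε                        ≈⟨ trans (+-assoc _ _ _) (+-congˡ (halves ε)) ⟩
      b + ε                                    ∎

  ⇝-unique : ∀ {s a b} → s ⇝ a → s ⇝ b → a ≈ b
  ⇝-unique s⇝a s⇝b = ≤-antisym (⇝-≤ (0 , λ _ → ≤-refl) s⇝a s⇝b) (⇝-≤ (0 , λ _ → ≤-refl) s⇝b s⇝a)

  ⇝-squeeze : ∀ {s t l} → (∀ n → abs (s n - l) ≤ t n) → t ⇝ 0# → s ⇝ l
  ⇝-squeeze {t = t} s≤t t⇝0 ε 0<ε = eventually-map
    (λ {n} p → ≤-trans (s≤t n) (≤-trans (x≤abs (t n)) (≤-trans (≤-reflexive (abs-cong (solve 1 (λ t → t := t :- con (pos 0)) refl (t n)))) p)))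
    (t⇝0 ε 0<ε)

  eventually-small : ∀ x ε → 0# < ε → Eventually (λ n → x * 1/ (suc n) ≤ ε)
  eventually-small x ε 0<ε = N₀ , λ {n} N₀≤n →
    *-cancelʳ-≤ (0<fromℕ (suc n)) (begin
      x * 1/ (suc n) * fromℕ (suc n)  ≈⟨ trans (*-assoc _ _ _) (trans (*-congˡ (*-inverseˡ (suc n))) (*-identityʳ x)) ⟩
      x                               ≈⟨ *-identityʳ x ⟨
      x * 1#                          ≈⟨ *-congˡ (proj₂ (proj₂ ε-inverse)) ⟨
      x * (ε * ε⁻¹)                   ≈⟨ solve 3 (λ x e i → x :* (e :* i) := e :* (x :* i)) refl x ε ε⁻¹ ⟩
      ε * (x * ε⁻¹)                   ≤⟨ *-monoʳ-≤ (<⇒≤ 0<ε) (<⇒≤ (proj₂ (archimedean (x * ε⁻¹)))) ⟩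
      ε * fromℕ N₀                    ≤⟨ *-monoʳ-≤ (<⇒≤ 0<ε) (fromℕ-mono (ℕ.m≤n⇒m≤1+n N₀≤n)) ⟩
      ε * fromℕ (suc n)               ∎)
    where
    open ≤-Reasoning
    ε-inverse = inverse 0<ε
    ε⁻¹ = proj₁ ε-inverse
    N₀ = proj₁ (archimedean (x * ε⁻¹))

-- The functional equation of the exponential.

module Exponential {c ℓ₁ ℓ₂} (R : CompleteOrderedField c ℓ₁ ℓ₂) (F : Reals.ElementaryFunctions R) where
  open Reals R hiding (zero)
  open ExponentialSums F
  open Order R
  open Modulus R F
  open Limits R F
  open IntegerCoefficients commutativeRing using (module Solver)
  open Solver using (solve; _:=_; _:+_; _:*_; :-_; _:-_; con)
  open CauchyProduct commutativeRing
  private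
    module ℂΠ = CauchyProduct ℂ-commutativeRing
    module ℂS = IntegerCoefficients.Solver ℂ-commutativeRing

  open ℂR using () renaming (_-_ to _-ᶜ_)

  private variable
    u v : ℕ → ℂ
    ũ ṽ : ℕ → ℝ

  ∣partialSum∣≤ : (∀ i → ∣ u i ∣ ≤ ũ i) → ∀ n → ∣ ℂΠ.partialSum u n ∣ ≤ partialSum ũ n
  ∣partialSum∣≤ u≤ũ zero    = ≤-reflexive ∣0∣
  ∣partialSum∣≤ u≤ũ (suc n) = ≤-trans (∣+∣≤ _ _) (+-mono-≤ (∣partialSum∣≤ u≤ũ n) (u≤ũ n))

  ∣tail∣≤ : (∀ i → ∣ u i ∣ ≤ ũ i) → ∀ {n N} → n ℕ.≤′ N →
            ∣ ℂΠ.partialSum u N -ᶜ ℂΠ.partialSum u n ∣ ≤ partialSum ũ N - partialSum ũ n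
  ∣tail∣≤ u≤ũ {n} (ℕ.≤′-reflexive ≡.refl) = ≤-reflexive (trans (∣∣-cong (ℂR.-‿inverseʳ (ℂΠ.partialSum _ n))) (trans ∣0∣ (sym (-‿inverseʳ _))))
  ∣tail∣≤ {u} {ũ} u≤ũ {n} (ℕ.≤′-step {N} n≤N) = begin
    ∣ ℂΠ.partialSum u N +ᶜ u N -ᶜ ℂΠ.partialSum u n ∣
      ≈⟨ ∣∣-cong (ℂS.solve 3 (λ p x q → p ℂS.:+ x ℂS.:- q ℂS.:= (p ℂS.:- q) ℂS.:+ x) ℂR.refl (ℂΠ.partialSum u N) (u N) (ℂΠ.partialSum u n)) ⟩
    ∣ (ℂΠ.partialSum u N -ᶜ ℂΠ.partialSum u n) +ᶜ u N ∣
      ≤⟨ ∣+∣≤ _ _ ⟩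
    ∣ ℂΠ.partialSum u N -ᶜ ℂΠ.partialSum u n ∣ + ∣ u N ∣
      ≤⟨ +-mono-≤ (∣tail∣≤ u≤ũ n≤N) (u≤ũ N) ⟩
    partialSum ũ N - partialSum ũ n + ũ N
      ≈⟨ solve 3 (λ p x q → p :- q :+ x := p :+ x :- q) refl (partialSum ũ N) (ũ N) (partialSum ũ n) ⟩
    partialSum ũ N + ũ N - partialSum ũ n ∎
    where open ≤-Reasoning

  -- The excess is a sum of products u i * v j without signs, so it is dominated by the same sum for
  -- the majorants. The condition n ≤ N makes every row a genuine tail, bounded by `∣tail∣≤`.
  ∣excess∣≤ : (∀ i → ∣ u i ∣ ≤ ũ i) → (∀ i → ∣ v i ∣ ≤ ṽ i) → ∀ n N → n ℕ.≤ N →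
              ∣ ℂΠ.excess u v n N ∣ ≤ excess ũ ṽ n N
  ∣excess∣≤ {v = v} {ṽ = ṽ} u≤ũ v≤ṽ zero N _ = ≤-reflexive (trans
    (∣∣-cong (ℂS.solve 1 (λ p → ℂS.con (pos 0) ℂS.:* p ℂS.:- ℂS.con (pos 0) ℂS.:= ℂS.con (pos 0)) ℂR.refl (ℂΠ.partialSum v N)))
    (trans ∣0∣ (solve 1 (λ p → con (pos 0) := con (pos 0) :* p :- con (pos 0)) refl (partialSum ṽ N))))
  ∣excess∣≤ {u} {ũ} {v} {ṽ} u≤ũ v≤ṽ (suc n) N n<N = begin
    ∣ ℂΠ.excess u v (suc n) N ∣
      ≈⟨ ∣∣-cong (ℂΠ.excess-suc u v n N) ⟩
    ∣ u 0 *ᶜ (ℂΠ.partialSum v N -ᶜ ℂΠ.partialSum v (suc n)) +ᶜ ℂΠ.excess (u ∘ suc) v n N ∣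
      ≤⟨ ∣+∣≤ _ _ ⟩
    ∣ u 0 *ᶜ (ℂΠ.partialSum v N -ᶜ ℂΠ.partialSum v (suc n)) ∣ + ∣ ℂΠ.excess (u ∘ suc) v n N ∣
      ≤⟨ +-mono-≤ (≤-trans (≤-reflexive (∣∣-* _ _))
           (*-mono-≤ (∣∣-nonneg _) (∣∣-nonneg _) (u≤ũ 0) (∣tail∣≤ v≤ṽ (ℕ.≤⇒≤′ n<N))))
         (∣excess∣≤ (u≤ũ ∘ suc) v≤ṽ n N (ℕ.<⇒≤ n<N)) ⟩
    ũ 0 * (partialSum ṽ N - partialSum ṽ (suc n)) + excess (ũ ∘ suc) ṽ n N
      ≈⟨ excess-suc ũ ṽ n N ⟨
    excess ũ ṽ (suc n) N ∎
    where open ≤-Reasoning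

  module _ (0≤ṽ : ∀ i → 0# ≤ ṽ i) where
    partialSum-nonneg : ∀ n → 0# ≤ partialSum ṽ n
    partialSum-nonneg zero    = ≤-refl
    partialSum-nonneg (suc n) = +-nonneg (partialSum-nonneg n) (0≤ṽ n)

    partialSum-mono : ∀ {n N} → n ℕ.≤′ N → partialSum ṽ n ≤ partialSum ṽ N
    partialSum-mono (ℕ.≤′-reflexive ≡.refl) = ≤-refl
    partialSum-mono (ℕ.≤′-step n≤N) = ≤-trans (partialSum-mono n≤N) (≤-by _ (0≤ṽ _) refl)

    triangle-nonneg : (∀ i → 0# ≤ ũ i) → ∀ n → 0# ≤ triangle ũ ṽ n
    triangle-nonneg 0≤ũ zero    = ≤-refl
    triangle-nonneg 0≤ũ (suc n) = +-nonneg (*-nonneg (0≤ũ 0) (partialSum-nonneg (suc n))) (triangle-nonneg (0≤ũ ∘ suc) n)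

    -- i < n and j < N imply i + j < n + N, so the rectangle lies inside the larger triangle and the
    -- remaining terms are nonnegative.
    product≤triangle : (∀ i → 0# ≤ ũ i) → ∀ n N → partialSum ũ n * partialSum ṽ N ≤ triangle ũ ṽ (n ℕ.+ N)
    product≤triangle 0≤ũ zero    N = ≤-trans (≤-reflexive (zeroˡ _)) (triangle-nonneg 0≤ũ N)
    product≤triangle {ũ} 0≤ũ (suc n) N = begin
      partialSum ũ (suc n) * partialSum ṽ N
        ≈⟨ trans (*-congʳ (partialSum-front ũ n)) (distribʳ _ _ _) ⟩
      ũ 0 * partialSum ṽ N + partialSum (ũ ∘ suc) n * partialSum ṽ N
        ≤⟨ +-mono-≤ (*-monoʳ-≤ (0≤ũ 0) (partialSum-mono (ℕ.≤⇒≤′ (ℕ.m≤n+m N (suc n))))) (product≤triangle (0≤ũ ∘ suc) n N) ⟩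
      ũ 0 * partialSum ṽ (suc n ℕ.+ N) + triangle (ũ ∘ suc) ṽ (n ℕ.+ N) ∎
      where open ≤-Reasoning

  factorial⁻¹ : ℕ → ℝ
  factorial⁻¹ n = (1/ (n !)) {{n ℕ.!≢0}}

  factorial⁻¹-pos : ∀ n → 0# < factorial⁻¹ n
  factorial⁻¹-pos n = 0<1/ (n !) {{n ℕ.!≢0}}

  factorial⁻¹-suc : ∀ n → fromℕ (suc n) * factorial⁻¹ (suc n) ≈ factorial⁻¹ n
  factorial⁻¹-suc n = begin
    s * f′                                 ≈⟨ *-identityˡ _ ⟨
    1# * (s * f′)                          ≈⟨ *-congʳ (*-inverseˡ (n !) {{n ℕ.!≢0}}) ⟨
    f * fromℕ (n !) * (s * f′)             ≈⟨ solve 4 (λ f m s g → f :* m :* (s :* g) := f :* (g :* (s :* m))) refl f (fromℕ (n !)) s f′ ⟩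
    f * (f′ * (s * fromℕ (n !)))           ≈⟨ *-congˡ (*-congˡ (fromℕ-* (suc n) (n !))) ⟨
    f * (f′ * fromℕ (suc n !))             ≈⟨ *-congˡ (*-inverseˡ (suc n !) {{suc n ℕ.!≢0}}) ⟩
    f * 1#                                 ≈⟨ *-identityʳ f ⟩
    f ∎
    where
    open SetoidReasoning setoid
    s  = fromℕ (suc n)
    f  = factorial⁻¹ n
    f′ = factorial⁻¹ (suc n)

  1/1 : ∀ {{_ : NonZero 1}} → 1/ 1 ≈ 1#
  1/1 = trans (sym (*-identityʳ _)) (trans (*-congˡ (sym (+-identityʳ 1#))) (*-inverseˡ 1))

  term : ℝ → ℕ → ℝ
  term x n = x ^ n * factorial⁻¹ n

  ^-nonneg : ∀ {x} → 0# ≤ x → ∀ n → 0# ≤ x ^ n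
  ^-nonneg 0≤x zero    = <⇒≤ 0<1
  ^-nonneg 0≤x (suc n) = *-nonneg 0≤x (^-nonneg 0≤x n)

  term-nonneg : ∀ {x} → 0# ≤ x → ∀ n → 0# ≤ term x n
  term-nonneg 0≤x n = *-nonneg (^-nonneg 0≤x n) (<⇒≤ (factorial⁻¹-pos n))

  -- The recurrence that `conv-exponential` asks for, with ratio x.
  term-suc : ∀ x n → fromℕ (suc n) * term x (suc n) ≈ x * term x n
  term-suc x n = trans
    (solve 4 (λ s x p f → s :* (x :* p :* f) := x :* (p :* (s :* f))) refl (fromℕ (suc n)) x (x ^ n) (factorial⁻¹ (suc n)))
    (*-congˡ (*-congˡ (factorial⁻¹-suc n)))

  term-zero : ∀ x → term x 0 ≈ 1#
  term-zero x = trans (*-identityˡ _) 1/1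

  termᶜ : ℂ → ℕ → ℂ
  termᶜ z n = z ^ᶜ n *ᶜ (factorial⁻¹ n +i 0#)

  expPartialSum≡ : ∀ z n → expPartialSum z n ≡ ℂΠ.partialSum (termᶜ z) n
  expPartialSum≡ z zero    = ≡.refl
  expPartialSum≡ z (suc n) = ≡.cong (_+ᶜ termᶜ z n) (expPartialSum≡ z n)

  real : ℝ → ℂ
  real x = x +i 0#

  real-* : ∀ x y → real (x * y) ≈ᶜ real x *ᶜ real y
  real-* x y = solve 2 (λ x y → x :* y := x :* y :- con (pos 0) :* con (pos 0)) refl x y ,
               solve 2 (λ x y → con (pos 0) := x :* con (pos 0) :+ con (pos 0) :* y) refl x y

  termᶜ-suc : ∀ z n → real (fromℕ (suc n)) *ᶜ termᶜ z (suc n) ≈ᶜ z *ᶜ termᶜ z n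
  termᶜ-suc z n = ℂR.trans
    (ℂS.solve 4 (λ s x p f → s ℂS.:* (x ℂS.:* p ℂS.:* f) ℂS.:= x ℂS.:* (p ℂS.:* (s ℂS.:* f))) ℂR.refl (real (fromℕ (suc n))) z (z ^ᶜ n) (real (factorial⁻¹ (suc n))))
    (ℂR.*-congˡ {z} (ℂR.*-congˡ {z ^ᶜ n} (ℂR.trans (ℂR.sym (real-* (fromℕ (suc n)) (factorial⁻¹ (suc n)))) (factorial⁻¹-suc n , refl))))

  termᶜ-zero : ∀ z → termᶜ z 0 ≈ᶜ 1ᶜ
  termᶜ-zero z = ℂR.trans (ℂR.*-identityˡ (real (factorial⁻¹ 0))) (1/1 , refl)

  -- The binomial theorem divided by n!, obtained from the recurrence of the exponential
  -- coefficients instead of from binomial coefficients.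
  conv-term : ∀ x y n → conv (term x) (term y) n ≈ term (x + y) n
  conv-term x y = conv-exponential fromℕ refl (λ _ → refl) {u = term x} {term y} {term (x + y)} (λ n → 1/ (suc n)) (λ n → *-inverseˡ (suc n))
    (term-suc x) (term-suc y) (term-suc (x + y))
    (trans (*-cong (term-zero x) (term-zero y)) (trans (*-identityˡ 1#) (sym (term-zero (x + y)))))

  conv-termᶜ : ∀ z w n → ℂΠ.conv (termᶜ z) (termᶜ w) n ≈ᶜ termᶜ (z +ᶜ w) n
  conv-termᶜ z w = ℂΠ.conv-exponential (real ∘ fromℕ) ℂR.refl (λ _ → refl , sym (+-identityˡ 0#)) {u = termᶜ z} {termᶜ w} {termᶜ (z +ᶜ w)}
    (λ n → real (1/ (suc n)))
    (λ n → ℂR.trans (ℂR.sym (real-* (1/ (suc n)) (fromℕ (suc n)))) (*-inverseˡ (suc n) , refl))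
    (termᶜ-suc z) (termᶜ-suc w) (termᶜ-suc (z +ᶜ w))
    (ℂR.trans (ℂR.*-cong (termᶜ-zero z) (termᶜ-zero w)) (ℂR.trans (ℂR.*-identityˡ 1ᶜ) (ℂR.sym (termᶜ-zero (z +ᶜ w)))))

  ∣^∣ : ∀ z n → ∣ z ^ᶜ n ∣ ≈ ∣ z ∣ ^ n
  ∣^∣ z zero    = ∣1∣
  ∣^∣ z (suc n) = trans (∣∣-* z (z ^ᶜ n)) (*-congˡ (∣^∣ z n))

  ∣term∣ : ∀ z n → ∣ termᶜ z n ∣ ≈ term ∣ z ∣ n
  ∣term∣ z n = trans (∣∣-* (z ^ᶜ n) _) (*-cong (∣^∣ z n) (trans (∣real∣ _) (abs-of-nonneg (<⇒≤ (factorial⁻¹-pos n)))))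

  real-^ : ∀ x n → real (x ^ n) ≈ᶜ real x ^ᶜ n
  real-^ x zero    = ℂR.refl
  real-^ x (suc n) = ℂR.trans (real-* x (x ^ n)) (ℂR.*-congˡ {real x} (real-^ x n))

  real-partialSum : ∀ x n → re (ℂΠ.partialSum (termᶜ (real x)) n) ≈ partialSum (term x) n
  real-partialSum x zero    = refl
  real-partialSum x (suc n) = +-cong (real-partialSum x n)
    (proj₁ (ℂR.sym (ℂR.trans (real-* (x ^ n) (factorial⁻¹ n)) (ℂR.*-congʳ {real (factorial⁻¹ n)} (real-^ x n)))))

  series : ℂ → ℕ → ℂ
  series z = ℂΠ.partialSum (termᶜ z)

  re-exp : ∀ z → (λ n → re (series z n)) ⇝ re (exp z)
  re-exp z = ⇝-cong (λ n → reflexive (≡.cong re (expPartialSum≡ z n))) refl (⟶⇒⇝ (proj₁ (exp-series z)))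

  im-exp : ∀ z → (λ n → im (series z n)) ⇝ im (exp z)
  im-exp z = ⇝-cong (λ n → reflexive (≡.cong im (expPartialSum≡ z n))) refl (⟶⇒⇝ (proj₂ (exp-series z)))

  expℝ : ℝ → ℝ
  expℝ x = re (exp (real x))

  series⇝expℝ : ∀ x → partialSum (term x) ⇝ expℝ x
  series⇝expℝ x = ⇝-cong (real-partialSum x) refl (re-exp (real x))

  -- `exp` is specified only as a limit, so its compatibility with `≈` comes from uniqueness of
  -- limits.
  exp-cong : ∀ {z w} → z ≈ᶜ w → exp z ≈ᶜ exp w
  exp-cong {z} {w} z≈w =
    ⇝-unique (⇝-cong (proj₁ ∘ series-cong) refl (re-exp z)) (re-exp w) ,
    ⇝-unique (⇝-cong (proj₂ ∘ series-cong) refl (im-exp z)) (im-exp w)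
    where
    ^-cong : ∀ n → z ^ᶜ n ≈ᶜ w ^ᶜ n
    ^-cong zero    = ℂR.refl
    ^-cong (suc n) = ℂR.*-cong z≈w (^-cong n)
    series-cong : ∀ n → series z n ≈ᶜ series w n
    series-cong = ℂΠ.partialSum-cong (λ n → ℂR.*-congʳ {real (factorial⁻¹ n)} (^-cong n))

  exp-conj : ∀ z → exp (conj z) ≈ᶜ conj (exp z)
  exp-conj z =
    ⇝-unique (re-exp (conj z)) (⇝-cong (λ n → sym (proj₁ (series-conj n))) refl (re-exp z)) ,
    ⇝-unique (im-exp (conj z)) (⇝-cong (λ n → sym (proj₂ (series-conj n))) refl (⇝-neg (im-exp z)))
    where
    ^-conj : ∀ n → conj z ^ᶜ n ≈ᶜ conj (z ^ᶜ n)
    ^-conj zero    = refl , solve 0 (con (pos 0) := :- con (pos 0)) refl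
    ^-conj (suc n) = ℂR.trans (ℂR.*-congˡ {conj z} (^-conj n)) (ℂR.sym (conj-* z (z ^ᶜ n)))
    term-conj : ∀ n → termᶜ (conj z) n ≈ᶜ conj (termᶜ z n)
    term-conj n = ℂR.trans
      (ℂR.*-cong (^-conj n) (refl , solve 0 (con (pos 0) := :- con (pos 0)) refl))
      (ℂR.sym (conj-* (z ^ᶜ n) (real (factorial⁻¹ n))))
    series-conj : ∀ n → series (conj z) n ≈ᶜ conj (series z n)
    series-conj zero    = refl , solve 0 (con (pos 0) := :- con (pos 0)) refl
    series-conj (suc n) = ℂR.trans (ℂR.+-cong (series-conj n) (term-conj n))
      (refl , solve 2 (λ a b → :- a :+ :- b := :- (a :+ b)) refl _ _)

  -- The n × n square lies between the triangles of sizes n and 2n, whose sums are partial sums of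
  -- the series at x + y. Hence the excess is at most a difference of two such partial sums, and
  -- this tends to 0 because that series converges.
  excess⇝0 : ∀ {x y} → 0# ≤ x → 0# ≤ y → (λ n → excess (term x) (term y) n n) ⇝ 0#
  excess⇝0 {x} {y} 0≤x 0≤y = ⇝-squeeze bound
    (⇝-cong (λ _ → refl) (-‿inverseʳ _)
      (⇝-- (⇝-subsequence (λ n → n ℕ.+ n) (λ n → ℕ.m≤m+n n n) (series⇝expℝ (x + y))) (series⇝expℝ (x + y))))
    where
    open ≤-Reasoning
    triangle-term : ∀ n → triangle (term x) (term y) n ≈ partialSum (term (x + y)) n
    triangle-term n = trans (triangle≈ _ _ n) (partialSum-cong (conv-term x y) n)
    upper : ∀ n → excess (term x) (term y) n n ≤ partialSum (term (x + y)) (n ℕ.+ n) - partialSum (term (x + y)) n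
    upper n = +-mono-≤
      (≤-trans (product≤triangle (term-nonneg 0≤y) (term-nonneg 0≤x) n n) (≤-reflexive (triangle-term (n ℕ.+ n))))
      (≤-reflexive (-‿cong (triangle-term n)))
    lower : ∀ n → 0# ≤ excess (term x) (term y) n n
    -- Majorising the real terms by themselves bounds a modulus by the excess, which is therefore
    -- nonnegative.
    lower n = ≤-trans (∣∣-nonneg (ℂΠ.excess (real ∘ term x) (real ∘ term y) n n))
      (∣excess∣≤ (λ i → real-term 0≤x i) (λ i → real-term 0≤y i) n n ℕ.≤-refl)
      where
      real-term : ∀ {x} → 0# ≤ x → ∀ i → ∣ real (term x i) ∣ ≤ term x i
      real-term 0≤x i = ≤-reflexive (trans (∣real∣ _) (abs-of-nonneg (term-nonneg 0≤x i)))
    bound : ∀ n → abs (excess (term x) (term y) n n - 0#) ≤ partialSum (term (x + y)) (n ℕ.+ n) - partialSum (term (x + y)) n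
    bound n = begin
      abs (excess (term x) (term y) n n - 0#)  ≈⟨ abs-cong (solve 1 (λ x → x :- con (pos 0) := x) refl _) ⟩
      abs (excess (term x) (term y) n n)       ≈⟨ abs-of-nonneg (lower n) ⟩
      excess (term x) (term y) n n             ≤⟨ upper n ⟩
      _                                        ∎

  -- The product of the partial sums at z and w minus the partial sum at z + w is a complex excess.
  -- It is dominated by the real excess at the moduli, which tends to 0.
  exp-+ : ∀ z w → exp (z +ᶜ w) ≈ᶜ exp z *ᶜ exp w
  exp-+ z w =
    equal abs-re≤ (λ _ _ → refl) (⇝-- (⇝-* (re-exp z) (re-exp w)) (⇝-* (im-exp z) (im-exp w))) (re-exp (z +ᶜ w)) ,
    equal abs-im≤ (λ _ _ → refl) (⇝-+ (⇝-* (re-exp z) (im-exp w)) (⇝-* (im-exp z) (re-exp w))) (im-exp (z +ᶜ w))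
    where
    open ≤-Reasoning
    triangle-termᶜ : ∀ n → ℂΠ.triangle (termᶜ z) (termᶜ w) n ≈ᶜ series (z +ᶜ w) n
    triangle-termᶜ n = ℂR.trans (ℂΠ.triangle≈ _ _ n) (ℂΠ.partialSum-cong (conv-termᶜ z w) n)
    -- `p` is `re` or `im`: exp is specified by the convergence of its components, while the
    -- estimate is for the modulus.
    equal : ∀ {p : ℂ → ℝ} → (∀ z → abs (p z) ≤ ∣ z ∣) → (∀ z w → p (z -ᶜ w) ≈ p z - p w) → ∀ {l m} →
            (λ n → p (series z n *ᶜ series w n)) ⇝ l → (λ n → p (series (z +ᶜ w) n)) ⇝ m → m ≈ l
    equal {p} p≤ p-- s⇝l t⇝m = trans
      (solve 2 (λ m l → m := l :- (l :- m)) refl _ _)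
      (trans (+-congˡ (-‿cong (⇝-unique (⇝-- s⇝l t⇝m) (⇝-squeeze (λ n → begin
        abs (p (series z n *ᶜ series w n) - p (series (z +ᶜ w) n) - 0#)
          ≈⟨ abs-cong (trans (solve 1 (λ x → x :- con (pos 0) := x) refl _) (sym (p-- _ _))) ⟩
        abs (p (series z n *ᶜ series w n -ᶜ series (z +ᶜ w) n))
          ≤⟨ p≤ _ ⟩
        ∣ series z n *ᶜ series w n -ᶜ series (z +ᶜ w) n ∣
          ≈⟨ ∣∣-cong (ℂR.+-congˡ {series z n *ᶜ series w n} (ℂR.-‿cong (ℂR.sym (triangle-termᶜ n)))) ⟩
        ∣ ℂΠ.excess (termᶜ z) (termᶜ w) n n ∣
          ≤⟨ ∣excess∣≤ (≤-reflexive ∘ ∣term∣ z) (≤-reflexive ∘ ∣term∣ w) n n ℕ.≤-refl ⟩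
        excess (term ∣ z ∣) (term ∣ w ∣) n n ∎)
        (excess⇝0 (∣∣-nonneg z) (∣∣-nonneg w))))))
        (solve 1 (λ l → l :- con (pos 0) := l) refl _))

-- The characters e(x): modulus, period and continuity.

module Characters {c ℓ₁ ℓ₂} (R : CompleteOrderedField c ℓ₁ ℓ₂) (F : Reals.ElementaryFunctions R) where
  open Reals R hiding (zero)
  open ExponentialSums F
  open Order R
  open Modulus R F
  open Limits R F
  open Exponential R F
  open IntegerCoefficients commutativeRing using (module Solver)
  open Solver using (solve; _:=_; _:+_; _:*_; :-_; _:-_; con)
  open CauchyProduct commutativeRing
  private
    module ℂΠ = CauchyProduct ℂ-commutativeRing
    module ℂS = IntegerCoefficients.Solver ℂ-commutativeRing
  open ℂR using () renaming (_-_ to _-ᶜ_)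

  term-mono : ∀ {x y} → 0# ≤ x → x ≤ y → ∀ n → term x n ≤ term y n
  term-mono 0≤x x≤y n = *-monoˡ-≤ (<⇒≤ (factorial⁻¹-pos n)) (^-mono n)
    where
    ^-mono : ∀ n → _ ^ n ≤ _ ^ n
    ^-mono zero    = ≤-refl
    ^-mono (suc n) = *-mono-≤ 0≤x (^-nonneg 0≤x n) x≤y (^-mono n)

  -- Pulls one factor x out of every term after the first, which is what makes the bound on |exp z -
  -- 1| linear in |z|.
  term-suc-≤ : ∀ {x} → 0# ≤ x → x ≤ 1# → ∀ n → term x (suc n) ≤ x * term 1# n
  term-suc-≤ {x} 0≤x x≤1 n = begin
    term x (suc n)                       ≈⟨ *-identityˡ _ ⟨
    1# * term x (suc n)                  ≤⟨ *-monoˡ-≤ (term-nonneg 0≤x (suc n)) (≤-by (fromℕ n) (fromℕ-nonneg n) refl) ⟩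
    fromℕ (suc n) * term x (suc n)       ≈⟨ term-suc x n ⟩
    x * term x n                         ≤⟨ *-monoʳ-≤ 0≤x (term-mono 0≤x x≤1 n) ⟩
    x * term 1# n                        ∎
    where open ≤-Reasoning

  partialSum≤expℝ : ∀ {x} → 0# ≤ x → ∀ n → partialSum (term x) n ≤ expℝ x
  partialSum≤expℝ {x} 0≤x n = ⇝-≤ (n , λ n≤m → partialSum-mono (term-nonneg 0≤x) (ℕ.≤⇒≤′ n≤m)) (⇝-const _) (series⇝expℝ x)

  -- The series without its constant term is dominated by Σ |z|/n!, hence by |z| exp(1). The limit
  -- is taken in the squared modulus, a polynomial in the two components, so that no continuity of √
  -- is required.
  ∣exp-1∣≤ : ∀ z → ∣ z ∣ ≤ 1# → ∣ exp z -ᶜ 1ᶜ ∣ ≤ ∣ z ∣ * expℝ 1#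
  ∣exp-1∣≤ z ∣z∣≤1 = ∣∣-≤ (exp z -ᶜ 1ᶜ) 0≤b (⇝-≤ {b = b * b} (0 , λ {n} _ → square-bound n)
    (⇝-+ (⇝-* re⇝ re⇝) (⇝-* im⇝ im⇝)) (⇝-const _))
    where
    open ≤-Reasoning
    b = ∣ z ∣ * expℝ 1#
    0≤b : 0# ≤ b
    0≤b = *-nonneg (∣∣-nonneg z) (partialSum≤expℝ (<⇒≤ 0<1) 0)
    d : ℕ → ℂ
    -- The shift of the index guarantees that the constant term 1 is present to be subtracted.
    d n = series z (suc n) -ᶜ 1ᶜ
    re⇝ : (λ n → re (d n)) ⇝ re (exp z -ᶜ 1ᶜ)
    re⇝ = ⇝-- (⇝-subsequence suc ℕ.n≤1+n (re-exp z)) (⇝-const _)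
    im⇝ : (λ n → im (d n)) ⇝ im (exp z -ᶜ 1ᶜ)
    im⇝ = ⇝-- (⇝-subsequence suc ℕ.n≤1+n (im-exp z)) (⇝-const _)
    d≈ : ∀ n → d n ≈ᶜ ℂΠ.partialSum (termᶜ z ∘ suc) n
    d≈ n = ℂR.trans (ℂR.+-congʳ {x = -ᶜ 1ᶜ} (ℂR.trans (ℂΠ.partialSum-front (termᶜ z) n) (ℂR.+-congʳ {x = ℂΠ.partialSum (termᶜ z ∘ suc) n} (termᶜ-zero z))))
      (ℂS.solve 1 (λ s → ℂS.con (pos 1) ℂS.:+ s ℂS.:- ℂS.con (pos 1) ℂS.:= s) ℂR.refl (ℂΠ.partialSum (termᶜ z ∘ suc) n))
    bound : ∀ n → ∣ d n ∣ ≤ b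
    bound n = begin
      ∣ d n ∣                                          ≈⟨ ∣∣-cong (d≈ n) ⟩
      ∣ ℂΠ.partialSum (termᶜ z ∘ suc) n ∣              ≤⟨ ∣partialSum∣≤ (λ i → ≤-trans (≤-reflexive (∣term∣ z (suc i))) (term-suc-≤ (∣∣-nonneg z) ∣z∣≤1 i)) n ⟩
      partialSum (λ i → ∣ z ∣ * term 1# i) n           ≈⟨ partialSum-*ˡ ∣ z ∣ (term 1#) n ⟩
      ∣ z ∣ * partialSum (term 1#) n                   ≤⟨ *-monoʳ-≤ (∣∣-nonneg z) (partialSum≤expℝ (<⇒≤ 0<1) n) ⟩
      b                                                ∎
    square-bound : ∀ n → norm² (d n) ≤ b * b
    square-bound n = ≤-trans (≤-reflexive (sym (∣∣-square (d n)))) (square-mono-≤ (∣∣-nonneg _) (bound n))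

  abs≤0⇒≈0 : ∀ {x} → abs x ≤ 0# → x ≈ 0#
  abs≤0⇒≈0 {x} p = ≤-antisym (≤-trans (x≤abs x) p)
    (≤-by (0# - - x) (x≤y⇒0≤y-x (≤-trans (-x≤abs x) p)) (solve 1 (λ x → x := con (pos 0) :+ (con (pos 0) :- :- x)) refl x))

  ∣∣≤0⇒≈0 : ∀ {z} → ∣ z ∣ ≤ 0# → z ≈ᶜ 0ᶜ
  ∣∣≤0⇒≈0 p = abs≤0⇒≈0 (≤-trans (abs-re≤ _) p) , abs≤0⇒≈0 (≤-trans (abs-im≤ _) p)

  -- The case z = 0 of the preceding bound.
  exp-0 : exp 0ᶜ ≈ᶜ 1ᶜ
  exp-0 = ℂR.trans (ℂS.solve 1 (λ z → z ℂS.:= z ℂS.:- ℂS.con (pos 1) ℂS.:+ ℂS.con (pos 1)) ℂR.refl (exp 0ᶜ))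
    (ℂR.trans (ℂR.+-congʳ {1ᶜ} (∣∣≤0⇒≈0 diff≤0)) (ℂR.+-identityˡ 1ᶜ))
    where
    diff≤0 : ∣ exp 0ᶜ -ᶜ 1ᶜ ∣ ≤ 0#
    diff≤0 = ≤-trans (∣exp-1∣≤ 0ᶜ (≤-trans (≤-reflexive ∣0∣) (<⇒≤ 0<1))) (≤-reflexive (trans (*-congʳ ∣0∣) (zeroˡ _)))

  cis : ℝ → ℂ
  cis y = exp (0# +i y)

  cis-cong : ∀ {x y} → x ≈ y → cis x ≈ᶜ cis y
  cis-cong x≈y = exp-cong (refl , x≈y)

  cis-+ : ∀ x y → cis (x + y) ≈ᶜ cis x *ᶜ cis y
  cis-+ x y = ℂR.trans (exp-cong (sym (+-identityˡ 0#) , refl)) (exp-+ (0# +i x) (0# +i y))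

  conj-cis : ∀ x → conj (cis x) ≈ᶜ cis (- x)
  conj-cis x = ℂR.sym (exp-conj (0# +i x))

  norm²-cis : ∀ x → norm² (cis x) ≈ 1#
  norm²-cis x = begin
    norm² (cis x)                    ≈⟨ solve 2 (λ a b → a :* a :+ b :* b := a :* a :- b :* :- b) refl _ _ ⟩
    re (cis x *ᶜ conj (cis x))       ≈⟨ proj₁ (ℂR.*-congˡ {cis x} (conj-cis x)) ⟩
    re (cis x *ᶜ cis (- x))          ≈⟨ proj₁ (cis-+ x (- x)) ⟨
    re (cis (x - x))                 ≈⟨ proj₁ (cis-cong (-‿inverseʳ x)) ⟩
    re (cis 0#)                      ≈⟨ proj₁ exp-0 ⟩
    1#                               ∎
    where open SetoidReasoning setoid

  2π : ℝ
  2π = fromℕ 2 * π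

  2π≈ : 2π ≈ π + π
  2π≈ = solve 1 (λ p → (con (pos 1) :+ (con (pos 1) :+ con (pos 0))) :* p := p :+ p) refl π

  0≤2π : 0# ≤ 2π
  0≤2π = *-nonneg (fromℕ-nonneg 2) (<⇒≤ π-positive)

  e-cong : ∀ {x y} → x ≈ y → e x ≈ᶜ e y
  e-cong x≈y = cis-cong (*-congˡ x≈y)

  e-+ : ∀ x y → e (x + y) ≈ᶜ e x *ᶜ e y
  e-+ x y = ℂR.trans (cis-cong (distribˡ _ _ _)) (cis-+ _ _)

  e-0 : e 0# ≈ᶜ 1ᶜ
  e-0 = ℂR.trans (cis-cong (zeroʳ _)) exp-0

  conj-e : ∀ x → conj (e x) ≈ᶜ e (- x)
  conj-e x = ℂR.trans (conj-cis (2π * x)) (cis-cong (solve 2 (λ p x → :- (p :* x) := p :* :- x) refl 2π x))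

  ∣e∣ : ∀ x → ∣ e x ∣ ≈ 1#
  ∣e∣ x = ∣∣-unique (e x) (<⇒≤ 0<1) (trans (*-identityˡ 1#) (sym (norm²-cis (2π * x))))

  -- The double-angle formulas, with the cosine written as 1 - 2 sin² because the specification of π
  -- speaks of the sine.
  cis-double : ∀ y → cis (y + y) ≈ᶜ (1# - (im (cis y) * im (cis y) + im (cis y) * im (cis y)) +i (im (cis y) * re (cis y) + im (cis y) * re (cis y)))
  cis-double y = ℂR.trans (cis-+ y y)
    ( trans (solve 2 (λ a b → a :* a :- b :* b := a :* a :+ b :* b :- (b :* b :+ b :* b)) refl (re (cis y)) (im (cis y))) (+-congʳ (norm²-cis y))
    , +-congʳ (*-comm _ _))

  -- After doubling, every term other than the constant 1 contains the factor sin π = 0; the sign of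
  -- cos π does not enter.
  e-1 : e 1# ≈ᶜ 1ᶜ
  e-1 = ℂR.trans (cis-cong (trans (*-identityʳ _) 2π≈)) (ℂR.trans (cis-double π)
    ( trans (+-congˡ (-‿cong (+-cong (*-cong sin-π sin-π) (*-cong sin-π sin-π)))) (solve 0 (con (pos 1) :- (con (pos 0) :* con (pos 0) :+ con (pos 0) :* con (pos 0)) := con (pos 1)) refl)
    , trans (+-cong (trans (*-congʳ sin-π) (zeroˡ _)) (trans (*-congʳ sin-π) (zeroˡ _))) (+-identityˡ 0#)))

  e-ℕ : ∀ n → e (fromℕ n) ≈ᶜ 1ᶜ
  e-ℕ zero    = e-0
  e-ℕ (suc n) = ℂR.trans (e-+ 1# (fromℕ n)) (ℂR.trans (ℂR.*-cong e-1 (e-ℕ n)) (ℂR.*-identityˡ 1ᶜ))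

  conj-1 : conj 1ᶜ ≈ᶜ 1ᶜ
  conj-1 = refl , solve 0 (:- con (pos 0) := con (pos 0)) refl

  e-neg : ∀ x → e (- x) ≈ᶜ conj (e x)
  e-neg x = ℂR.sym (conj-e x)

  conj-cong : ∀ {z w} → z ≈ᶜ w → conj z ≈ᶜ conj w
  conj-cong (p , q) = p , -‿cong q

  e-ℤ : ∀ i → e (fromℤ i) ≈ᶜ 1ᶜ
  e-ℤ (pos n)  = e-ℕ n
  e-ℤ -[1+ n ] = ℂR.trans (e-neg (fromℕ (suc n))) (ℂR.trans (conj-cong (e-ℕ (suc n))) conj-1)

  re-e<1 : ∀ {x} → 0# < x → x < 1# → re (e x) < 1#
  re-e<1 {x} 0<x x<1 = <-by (s * s + s * s) (≤-<-trans (≤-reflexive (sym (+-identityˡ 0#))) (+-mono-< 0<ss 0<ss))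
    (trans (solve 1 (λ s → con (pos 1) := con (pos 1) :- (s :* s :+ s :* s) :+ (s :* s :+ s :* s)) refl s)
      (+-congʳ (sym (trans (proj₁ (cis-cong (trans (*-congʳ 2π≈) (distribʳ _ _ _)))) (proj₁ (cis-double (π * x)))))))
    where
    s = im (cis (π * x))
    0<s : 0# < s
    0<s = sin-below-π (*-positive π-positive 0<x) (<-respʳ-≈ (*-identityʳ π) (*-monoʳ-< π-positive x<1))
    0<ss : 0# < s * s
    0<ss = *-positive 0<s 0<s

  -- A Lipschitz constant for e at distances with 2π |x - y| ≤ 1, which is the range where |exp z -
  -- 1| ≤ |z| exp(1) is available.
  lipschitz : ℝ
  lipschitz = 2π * expℝ 1#

  0≤lipschitz : 0# ≤ lipschitz
  0≤lipschitz = *-nonneg 0≤2π (partialSum≤expℝ (<⇒≤ 0<1) 0)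

  ∣e-1∣≤ : ∀ h → 2π * abs h ≤ 1# → ∣ e h -ᶜ 1ᶜ ∣ ≤ lipschitz * abs h
  ∣e-1∣≤ h 2πh≤1 = begin
    ∣ e h -ᶜ 1ᶜ ∣                     ≤⟨ ∣exp-1∣≤ (0# +i 2π * h) (≤-trans (≤-reflexive ∣iy∣) 2πh≤1) ⟩
    ∣ 0# +i 2π * h ∣ * expℝ 1#        ≈⟨ *-congʳ ∣iy∣ ⟩
    2π * abs h * expℝ 1#              ≈⟨ solve 3 (λ p h x → p :* h :* x := p :* x :* h) refl 2π (abs h) (expℝ 1#) ⟩
    lipschitz * abs h                         ∎
    where
    open ≤-Reasoning
    ∣iy∣ : ∣ 0# +i 2π * h ∣ ≈ 2π * abs h
    ∣iy∣ = ∣∣-unique (0# +i 2π * h) (*-nonneg 0≤2π (abs-nonneg h)) (begin-equality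
      2π * abs h * (2π * abs h)         ≈⟨ solve 2 (λ p h → p :* h :* (p :* h) := p :* p :* (h :* h)) refl 2π (abs h) ⟩
      2π * 2π * (abs h * abs h)         ≈⟨ *-congˡ (abs-square h) ⟩
      2π * 2π * (h * h)                 ≈⟨ solve 2 (λ p h → p :* p :* (h :* h) := con (pos 0) :* con (pos 0) :+ p :* h :* (p :* h)) refl 2π h ⟩
      norm² (0# +i 2π * h)              ∎)

  ∣e-e∣≤ : ∀ x y → 2π * abs (x - y) ≤ 1# → ∣ e x -ᶜ e y ∣ ≤ lipschitz * abs (x - y)
  ∣e-e∣≤ x y small = begin
    ∣ e x -ᶜ e y ∣                    ≈⟨ ∣∣-cong factor ⟩
    ∣ e y *ᶜ (e (x - y) -ᶜ 1ᶜ) ∣      ≈⟨ ∣∣-* (e y) _ ⟩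
    ∣ e y ∣ * ∣ e (x - y) -ᶜ 1ᶜ ∣     ≈⟨ trans (*-congʳ (∣e∣ y)) (*-identityˡ _) ⟩
    ∣ e (x - y) -ᶜ 1ᶜ ∣               ≤⟨ ∣e-1∣≤ (x - y) small ⟩
    lipschitz * abs (x - y)                   ∎
    where
    open ≤-Reasoning
    factor : e x -ᶜ e y ≈ᶜ e y *ᶜ (e (x - y) -ᶜ 1ᶜ)
    factor = ℂR.trans
      (ℂR.+-congʳ {x = -ᶜ e y} (ℂR.trans (e-cong (solve 2 (λ x y → x := y :+ (x :- y)) refl x y)) (e-+ y (x - y))))
      (ℂS.solve 2 (λ a b → a ℂS.:* b ℂS.:- a ℂS.:= a ℂS.:* (b ℂS.:- ℂS.con (pos 1))) ℂR.refl (e y) (e (x - y)))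

-- Riemann sums and integrals over the unit cube.

module RiemannSums {c ℓ₁ ℓ₂} (R : CompleteOrderedField c ℓ₁ ℓ₂) (F : Reals.ElementaryFunctions R) where
  open Reals R hiding (zero)
  open Order R
  open Modulus R F
  open Exponential R F
  open IntegerCoefficients commutativeRing using (module Solver)
  open Solver using (solve; _:=_; _:+_; _:*_; :-_; _:-_; con)
  open ListSums commutativeRing
  open VectorSums semiring using (sum-cong-≋)

  Σ-tabulate : ∀ {A : Set} {n} (h : Fin n → A) (f : A → ℝ) → Σ[ List.tabulate h ] f ≈ sum (λ i → f (h i))
  Σ-tabulate {n = zero}  h f = refl
  Σ-tabulate {n = suc n} h f = +-congˡ (Σ-tabulate (h ∘ Fin.suc) f)

  Σ-allFin : ∀ n (f : Fin n → ℝ) → Σ[ List.allFin n ] f ≈ sum f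
  Σ-allFin n = Σ-tabulate {n = n} (λ i → i)

  -- All multi-indices, nested in the order of `sumCells`, so that Riemann sums become list sums.
  cells : ∀ N n → List (Vec (Fin N) n)
  cells N zero    = [] ∷ []
  cells N (suc n) = List.cartesianProductWith _∷_ (List.allFin N) (cells N n)

  sumCells≈ : ∀ {N} n (f : Vec (Fin N) n → ℝ) → sumCells n f ≈ Σ[ cells N n ] f
  sumCells≈ {N} zero    f = sym (+-identityʳ _)
  sumCells≈ {N} (suc n) f = begin
    sum (λ i → sumCells n (λ k → f (i ∷ k)))                            ≈⟨ sum-cong-≋ (λ i → sumCells≈ n (λ k → f (i ∷ k))) ⟩
    sum (λ i → Σ[ cells N n ] (λ k → f (i ∷ k)))                        ≈⟨ Σ-allFin N _ ⟨
    Σ[ List.allFin N ] (λ i → Σ[ cells N n ] (λ k → f (i ∷ k)))         ≈⟨ Σ-cartesianProductWith _∷_ (List.allFin N) (cells N n) f ⟨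
    Σ[ cells N (suc n) ] f                                              ∎
    where open SetoidReasoning setoid

  ^-cancel : ∀ n N .{{_ : NonZero N}} → 1/ N ^ n * Σ[ cells N n ] (λ _ → 1#) ≈ 1#
  ^-cancel zero    N = trans (*-identityˡ _) (+-identityʳ 1#)
  ^-cancel (suc n) N = begin
    1/ N * 1/ N ^ n * Σ[ cells N (suc n) ] (λ _ → 1#)
      ≈⟨ *-congˡ (Σ-cartesianProductWith _∷_ (List.allFin N) (cells N n) (λ _ → 1#)) ⟩
    1/ N * 1/ N ^ n * Σ[ List.allFin N ] (λ _ → Σ[ cells N n ] (λ _ → 1#))
      ≈⟨ *-congˡ (trans (Σ-cong (List.allFin N) (λ _ → sym (*-identityˡ _))) (Σ-*ʳ (List.allFin N) _ (λ _ → 1#))) ⟩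
    1/ N * 1/ N ^ n * (Σ[ List.allFin N ] (λ _ → 1#) * Σ[ cells N n ] (λ _ → 1#))
      ≈⟨ *-congˡ (*-congʳ (trans (Σ-const (List.allFin N)) (reflexive (≡.cong fromℕ (length-tabulate {n = N} (λ i → i)))))) ⟩
    1/ N * 1/ N ^ n * (fromℕ N * Σ[ cells N n ] (λ _ → 1#))
      ≈⟨ solve 4 (λ i p m s → i :* p :* (m :* s) := i :* m :* (p :* s)) refl (1/ N) (1/ N ^ n) (fromℕ N) _ ⟩
    1/ N * fromℕ N * (1/ N ^ n * Σ[ cells N n ] (λ _ → 1#))
      ≈⟨ *-cong (*-inverseˡ N) (^-cancel n N) ⟩
    1# * 1#
      ≈⟨ *-identityˡ 1# ⟩
    1# ∎
    where
    open SetoidReasoning setoid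

  avg : ∀ {n} N .{{_ : NonZero N}} → (Vec (Fin N) n → ℝ) → ℝ
  avg {n} N f = 1/ N ^ n * Σ[ cells N n ] f

  module _ {n : ℕ} (N : ℕ) .{{_ : NonZero N}} where
    private
      K : Set
      K = Vec (Fin N) n

    avg-cong : ∀ {f g : K → ℝ} → (∀ k → f k ≈ g k) → avg N f ≈ avg N g
    avg-cong f≈g = *-congˡ (Σ-cong (cells N n) f≈g)

    avg-+ : ∀ (f g : K → ℝ) → avg N (λ k → f k + g k) ≈ avg N f + avg N g
    avg-+ f g = trans (*-congˡ (Σ-+ (cells N n) f g)) (distribˡ _ _ _)

    avg-* : ∀ a (f : K → ℝ) → avg N (λ k → a * f k) ≈ a * avg N f
    avg-* a f = trans (*-congˡ (Σ-*ˡ (cells N n) a f))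
      (solve 3 (λ w a s → w :* (a :* s) := a :* (w :* s)) refl (1/ N ^ n) a _)

    avg-const : ∀ a → avg N (λ (_ : K) → a) ≈ a
    avg-const a = trans (avg-cong (λ _ → sym (*-identityʳ a))) (trans (avg-* a (λ _ → 1#)) (trans (*-congˡ (^-cancel n N)) (*-identityʳ a)))

    0≤weight : 0# ≤ 1/ N ^ n
    0≤weight = ^-nonneg (<⇒≤ (0<1/ N)) n

    avg-mono : ∀ {f g : K → ℝ} → (∀ k → f k ≤ g k) → avg N f ≤ avg N g
    avg-mono f≤g = *-monoʳ-≤ 0≤weight (Σ-mono (cells N n) f≤g)

    abs-avg : ∀ (f : K → ℝ) → abs (avg N f) ≤ avg N (λ k → abs (f k))
    abs-avg f = ≤-trans (≤-reflexive (trans (abs-* _ _) (*-congʳ (abs-of-nonneg 0≤weight)))) (*-monoʳ-≤ 0≤weight (abs-Σ (cells N n) f))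

    avg-- : ∀ (f g : K → ℝ) → avg N (λ k → f k - g k) ≈ avg N f - avg N g
    avg-- f g = trans (avg-+ f (λ k → - g k)) (+-congˡ (trans (avg-cong (λ k → solve 1 (λ x → :- x := :- con (pos 1) :* x) refl (g k)))
      (trans (avg-* (- 1#) g) (solve 1 (λ x → :- con (pos 1) :* x := :- x) refl (avg N g)))))

    avg-close : ∀ {f g : K → ℝ} {ε} → (∀ k → abs (f k - g k) ≤ ε) → abs (avg N f - avg N g) ≤ ε
    avg-close {f} {g} {ε} close = begin
      abs (avg N f - avg N g)           ≈⟨ abs-cong (avg-- f g) ⟨
      abs (avg N (λ k → f k - g k))     ≤⟨ abs-avg _ ⟩
      avg N (λ k → abs (f k - g k))     ≤⟨ avg-mono close ⟩
      avg N (λ (_ : K) → ε)               ≈⟨ avg-const ε ⟩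
      ε                                 ∎
      where open ≤-Reasoning

    avg-cauchy-schwarz : ∀ (f g : K → ℝ) →
      avg N (λ k → f k * g k) * avg N (λ k → f k * g k) ≤ avg N (λ k → f k * f k) * avg N (λ k → g k * g k)
    avg-cauchy-schwarz f g = begin
      w * s * (w * s)    ≈⟨ solve 2 (λ w s → w :* s :* (w :* s) := w :* w :* (s :* s)) refl w s ⟩
      w * w * (s * s)    ≤⟨ *-monoʳ-≤ (square-nonneg w) (cauchy-schwarz (cells N n) f g) ⟩
      w * w * (p * q)    ≈⟨ solve 3 (λ w p q → w :* w :* (p :* q) := w :* p :* (w :* q)) refl w p q ⟩
      w * p * (w * q)    ∎
      where
      open ≤-Reasoning
      w = 1/ N ^ n
      s = Σ[ cells N n ] (λ k → f k * g k)
      p = Σ[ cells N n ] (λ k → f k * f k)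
      q = Σ[ cells N n ] (λ k → g k * g k)

  -- N is one less than the number of subdivisions, which is thus nonzero.
  Integral : ∀ {n} → (Vector ℝ n → ℝ) → ℝ → Set _
  Integral {n} f I = ∀ ε → 0# < ε → Eventually (λ N →
    (tag : Vec (Fin (suc N)) n → Vector ℝ n) → (∀ k → InCell k (tag k)) → abs (avg (suc N) (λ k → f (tag k)) - I) ≤ ε)

  module _ {n : ℕ} where
    private variable
      f g : Vector ℝ n → ℝ
      I J : ℝ

    fromHasIntegral : HasIntegral f I → Integral f I
    fromHasIntegral int ε 0<ε with int ε 0<ε
    ... | N₀ , p = N₀ , λ {N} N₀≤N tag inCell →
      ≤-trans (≤-reflexive (abs-cong (+-congʳ (*-congˡ (sym (sumCells≈ n _)))))) (∼⇒abs (p (suc N) (ℕ.m≤n⇒m≤1+n N₀≤N) tag inCell))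

    toHasIntegral : Integral f I → HasIntegral f I
    toHasIntegral int ε 0<ε with int (½ * ε) (0<½* 0<ε)
    -- Half of ε turns the closed bound into the strict one, and the threshold grows by one because
    -- `Integral` counts subdivisions from 1.
    ... | N₀ , p = suc N₀ , λ { (suc N) (ℕ.s≤s N₀≤N) tag inCell →
      abs⇒∼ (≤-trans (≤-reflexive (abs-cong (+-congʳ (*-congˡ (sumCells≈ n _))))) (p N₀≤N tag inCell)) (½*< 0<ε) }

    ∫-cong : (∀ t → f t ≈ g t) → I ≈ J → Integral f I → Integral g J
    ∫-cong f≈g I≈J int ε 0<ε = eventually-map
      (λ {N} p tag inCell → ≤-trans (≤-reflexive (abs-cong (+-cong (avg-cong {n} (suc N) (λ k → sym (f≈g (tag k)))) (-‿cong (sym I≈J))))) (p tag inCell))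
      (int ε 0<ε)

    ∫-0 : Integral {n} (λ _ → 0#) 0#
    ∫-0 ε 0<ε = 0 , λ {N} _ tag _ → ≤-trans (≤-reflexive (trans (abs-cong (trans (+-congʳ (avg-const {n} (suc N) 0#)) (-‿inverseʳ 0#))) abs-0)) (<⇒≤ 0<ε)

    ∫-+ : Integral f I → Integral g J → Integral (λ t → f t + g t) (I + J)
    ∫-+ {f} {I} {g} {J} int-f int-g ε 0<ε = eventually-map
      (λ {N} (p , q) tag inCell → begin
        abs (avg (suc N) (λ k → f (tag k) + g (tag k)) - (I + J))
          ≈⟨ abs-cong (trans (+-congʳ (avg-+ {n} (suc N) _ _)) (solve 4 (λ s t a b → s :+ t :- (a :+ b) := (s :- a) :+ (t :- b)) refl _ _ I J)) ⟩
        abs ((avg (suc N) (λ k → f (tag k)) - I) + (avg (suc N) (λ k → g (tag k)) - J))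
          ≤⟨ ≤-trans (abs-+ _ _) (+-mono-≤ (p tag inCell) (q tag inCell)) ⟩
        ½ * ε + ½ * ε
          ≈⟨ halves ε ⟩
        ε ∎)
      (eventually-× (int-f (½ * ε) (0<½* 0<ε)) (int-g (½ * ε) (0<½* 0<ε)))
      where open ≤-Reasoning

    ∫-* : ∀ a → Integral f I → Integral (λ t → a * f t) (a * I)
    ∫-* {f} {I} a int ε 0<ε = eventually-map
      (λ {N} p tag inCell → begin
        abs (avg (suc N) (λ k → a * f (tag k)) - a * I)
          ≈⟨ abs-cong (trans (+-congʳ (avg-* {n} (suc N) a _)) (solve 3 (λ a s i → a :* s :- a :* i := a :* (s :- i)) refl a _ I)) ⟩
        abs (a * (avg (suc N) (λ k → f (tag k)) - I))
          ≈⟨ abs-* _ _ ⟩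
        abs a * abs (avg (suc N) (λ k → f (tag k)) - I)
          ≤⟨ *-mono-≤ (abs-nonneg a) (abs-nonneg _) (≤-by 1# (<⇒≤ 0<1) (+-comm 1# _)) (p tag inCell) ⟩
        M * (ε * M⁻¹)
          ≈⟨ trans (solve 3 (λ m e i → m :* (e :* i) := e :* (m :* i)) refl M ε M⁻¹) (trans (*-congˡ (proj₂ (proj₂ M-inverse))) (*-identityʳ ε)) ⟩
        ε ∎)
      (int (ε * M⁻¹) (*-positive 0<ε (proj₁ (proj₂ M-inverse))))
      where
      open ≤-Reasoning
      -- The summand 1 makes the bound for |a| invertible even where a vanishes.
      M = 1# + abs a
      M-inverse = inverse (<-≤-trans 0<1 (≤-by (abs a) (abs-nonneg a) refl))
      M⁻¹ = proj₁ M-inverse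

    ∫-Σ : ∀ {A : Set} (xs : List A) {f : A → Vector ℝ n → ℝ} {I : A → ℝ} → (∀ x → Integral (f x) (I x)) →
          Integral (λ t → Σ[ xs ] (λ x → f x t)) (Σ[ xs ] I)
    ∫-Σ []       int = ∫-0
    ∫-Σ (x ∷ xs) {f} int = ∫-+ {f = f x} {g = λ t → Σ[ xs ] (λ x → f x t)} (int x) (∫-Σ xs {f} int)

-- Orthogonality of characters, on grids and under the integral.

module CharacterIntegrals {c ℓ₁ ℓ₂} (R : CompleteOrderedField c ℓ₁ ℓ₂) (F : Reals.ElementaryFunctions R) where
  open Reals R hiding (zero)
  open ExponentialSums F
  open Order R
  open Modulus R F
  open Limits R F
  open Exponential R F
  open Characters R F
  open RiemannSums R F
  open IntegerCoefficients commutativeRing using (module Solver)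
  open Solver using (solve; _:=_; _:+_; _:*_; :-_; _:-_; con)
  open ListSums commutativeRing
  private
    module ℂΠ = CauchyProduct ℂ-commutativeRing
    module ℂS = IntegerCoefficients.Solver ℂ-commutativeRing
  open ℂR using () renaming (_-_ to _-ᶜ_)

  ℂΣ-tabulate : ∀ {A : Set} {n} (h : Fin n → A) (f : A → ℂ) (g : ℕ → ℂ) → (∀ i → f (h i) ≈ᶜ g (toℕ i)) →
                ℂΣ.Σ[ List.tabulate h ] f ≈ᶜ ℂΠ.partialSum g n
  ℂΣ-tabulate {n = zero}  h f g f≈g = ℂR.refl
  ℂΣ-tabulate {n = suc n} h f g f≈g = ℂR.trans
    (ℂR.+-cong (f≈g Fin.zero) (ℂΣ-tabulate (h ∘ Fin.suc) f (g ∘ suc) (f≈g ∘ Fin.suc)))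
    (ℂR.sym (ℂΠ.partialSum-front g n))

  -- The geometric sum, with the denominator ω - 1 kept on the left.
  telescope : ∀ (g : ℕ → ℂ) ω → (∀ i → g (suc i) ≈ᶜ g i *ᶜ ω) → ∀ n →
              (ω -ᶜ 1ᶜ) *ᶜ ℂΠ.partialSum g n ≈ᶜ g n -ᶜ g 0
  telescope g ω step zero    = ℂS.solve 2 (λ w g → (w ℂS.:- ℂS.con (pos 1)) ℂS.:* ℂS.con (pos 0) ℂS.:= g ℂS.:- g) ℂR.refl ω (g 0)
  telescope g ω step (suc n) = ℂR.trans (ℂR.distribˡ (ω -ᶜ 1ᶜ) (ℂΠ.partialSum g n) (g n))
    (ℂR.trans (ℂR.+-congʳ {(ω -ᶜ 1ᶜ) *ᶜ g n} (telescope g ω step n))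
    (ℂR.trans (ℂS.solve 3 (λ w g₀ g → g ℂS.:- g₀ ℂS.:+ (w ℂS.:- ℂS.con (pos 1)) ℂS.:* g ℂS.:= g ℂS.:* w ℂS.:- g₀) ℂR.refl ω (g 0) (g n))
    (ℂR.+-congʳ {x = -ᶜ g 0} (ℂR.sym (step n)))))

  -- A negative real part is positive evidence that z is nonzero: it bounds |z|² strictly away from
  -- 0. It is applied to z = ω - 1, where Re ω < 1.
  ℂ-cancel : ∀ {z w} → re z < 0# → z *ᶜ w ≈ᶜ 0ᶜ → w ≈ᶜ 0ᶜ
  ℂ-cancel {z} {w} re<0 zw≈0 = ∣∣≤0⇒≈0 (∣∣-≤ w ≤-refl (≤-trans norm²≤0 (≤-reflexive (sym (zeroˡ 0#)))))
    where
    0<-re : 0# < 0# - re z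
    0<-re = x<y⇒0<y-x re<0
    0<norm² : 0# < norm² z
    0<norm² = <-≤-trans (*-positive 0<-re 0<-re)
      (≤-by (im z * im z) (square-nonneg _) (solve 2 (λ a b → a :* a :+ b :* b := (con (pos 0) :- a) :* (con (pos 0) :- a) :+ b :* b) refl (re z) (im z)))
    norm²≤0 : norm² w ≤ 0#
    norm²≤0 = *-cancelʳ-≤ 0<norm² (≤-reflexive (begin
      norm² w * norm² z   ≈⟨ *-comm _ _ ⟩
      norm² z * norm² w   ≈⟨ norm²-* z w ⟨
      norm² (z *ᶜ w)      ≈⟨ norm²-cong zw≈0 ⟩
      norm² 0ᶜ            ≈⟨ solve 1 (λ z → con (pos 0) :* con (pos 0) :+ con (pos 0) :* con (pos 0) := con (pos 0) :* z) refl (norm² z) ⟩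
      0# * norm² z        ∎))
      where open SetoidReasoning setoid

  grid : ∀ N .{{_ : NonZero N}} → ℕ → ℝ
  grid N i = fromℕ i * 1/ N

  grid-in-unit : ∀ N .{{_ : NonZero N}} j → suc j ℕ.< N → 0# < grid N (suc j) × grid N (suc j) < 1#
  grid-in-unit N j j<N = *-positive (0<fromℕ (suc j)) (0<1/ N) , (begin-strict
    fromℕ (suc j) * 1/ N   ≈⟨ *-comm _ _ ⟩
    1/ N * fromℕ (suc j)   <⟨ *-monoʳ-< (0<1/ N) (<-≤-trans (<-by 1# 0<1 (+-comm 1# _)) (fromℕ-mono j<N)) ⟩
    1/ N * fromℕ N         ≈⟨ *-inverseˡ N ⟩
    1#                     ∎)
    where open ≤-Reasoning

  -- On a grid finer than the frequency, |v|/N lies strictly between 0 and 1; the sign of v only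
  -- conjugates. For |v| ≥ N aliasing could occur.
  root-of-unity : ∀ N .{{_ : NonZero N}} v → v ≢ ℤ.+0 → ℤ.∣ v ∣ ℕ.< N → re (e (fromℤ v * 1/ N)) < 1#
  root-of-unity N (pos zero)    v≢0 _   = ⊥-elim (v≢0 ≡.refl)
  root-of-unity N (pos (suc j)) _   j<N = re-e<1 (proj₁ (grid-in-unit N j j<N)) (proj₂ (grid-in-unit N j j<N))
  root-of-unity N -[1+ j ]      _   j<N = <-respˡ-≈
    (sym (trans (proj₁ (e-cong (solve 2 (λ x n → :- x :* n := :- (x :* n)) refl (fromℕ (suc j)) (1/ N)))) (proj₁ (e-neg _))))
    (re-e<1 (proj₁ (grid-in-unit N j j<N)) (proj₂ (grid-in-unit N j j<N)))

  -- Orthogonality of the characters of ℤ/N: for v ≠ 0 the geometric sum has ω^N = e(v) = 1 and ω -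
  -- 1 invertible, so it vanishes exactly.
  average₁ : ∀ N .{{_ : NonZero N}} v → ℤ.∣ v ∣ ℕ.< N →
             real (1/ N) *ᶜ ℂΣ.Σ[ List.allFin N ] (λ i → e (fromℤ v * grid N (toℕ i))) ≈ᶜ ℂΣ.[ v ℤ.≟ ℤ.+0 ]₁
  average₁ N v v<N with v ℤ.≟ ℤ.+0
  ... | yes ≡.refl = begin
    real (1/ N) *ᶜ ℂΣ.Σ[ List.allFin N ] (λ i → e (0# * grid N (toℕ i)))
      ≈⟨ ℂR.*-congˡ {real (1/ N)} (ℂΣ.Σ-cong (List.allFin N) (λ i → ℂR.trans (e-cong (zeroˡ _)) e-0)) ⟩
    real (1/ N) *ᶜ ℂΣ.Σ[ List.allFin N ] (λ i → 1ᶜ)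
      ≈⟨ ℂR.*-congˡ {real (1/ N)} sum-of-ones ⟩
    real (1/ N) *ᶜ real (fromℕ N)
      ≈⟨ ℂR.sym (real-* (1/ N) (fromℕ N)) ⟩
    real (1/ N * fromℕ N)
      ≈⟨ *-inverseˡ N , refl ⟩
    1ᶜ ∎
    where
    open SetoidReasoning ℂR.setoid
    sum-of-ones : ℂΣ.Σ[ List.allFin N ] (λ _ → 1ᶜ) ≈ᶜ real (fromℕ N)
    sum-of-ones =
      trans (reflexive (re-Σ (List.allFin N) (λ _ → 1ᶜ))) (trans (Σ-const (List.allFin N)) (reflexive (≡.cong fromℕ (length-tabulate {n = N} (λ i → i))))) ,
      trans (reflexive (im-Σ (List.allFin N) (λ _ → 1ᶜ))) (Σ-zero (List.allFin N))
  ... | no v≢0 = begin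
    real (1/ N) *ᶜ ℂΣ.Σ[ List.allFin N ] (λ i → e (fromℤ v * grid N (toℕ i)))
      ≈⟨ ℂR.*-congˡ {real (1/ N)} (ℂΣ-tabulate {n = N} (λ i → i) _ g (λ _ → ℂR.refl)) ⟩
    real (1/ N) *ᶜ ℂΠ.partialSum g N
      ≈⟨ ℂR.*-congˡ {real (1/ N)} (ℂ-cancel {ω -ᶜ 1ᶜ} re<0 (ℂR.trans (telescope g ω step N) (ℂR.trans (ℂR.+-cong gN≈1 (ℂR.-‿cong g0≈1)) (ℂR.-‿inverseʳ 1ᶜ)))) ⟩
    real (1/ N) *ᶜ 0ᶜ
      ≈⟨ ℂR.zeroʳ (real (1/ N)) ⟩
    0ᶜ ∎
    where
    open SetoidReasoning ℂR.setoid
    ω : ℂ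
    ω = e (fromℤ v * 1/ N)
    g : ℕ → ℂ
    g i = e (fromℤ v * grid N i)
    step : ∀ i → g (suc i) ≈ᶜ g i *ᶜ ω
    step i = ℂR.trans (e-cong (solve 3 (λ v i n → v :* ((con (pos 1) :+ i) :* n) := v :* (i :* n) :+ v :* n) refl (fromℤ v) (fromℕ i) (1/ N))) (e-+ _ _)
    g0≈1 : g 0 ≈ᶜ 1ᶜ
    g0≈1 = ℂR.trans (e-cong (solve 2 (λ v n → v :* (con (pos 0) :* n) := con (pos 0)) refl (fromℤ v) (1/ N))) e-0
    gN≈1 : g N ≈ᶜ 1ᶜ
    gN≈1 = ℂR.trans (e-cong (trans (*-congˡ (trans (*-comm _ _) (*-inverseˡ N))) (*-identityʳ _))) (e-ℤ v)
    re<0 : re (ω -ᶜ 1ᶜ) < 0#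
    re<0 = <-respʳ-≈ (-‿inverseʳ 1#) (+-monoˡ-< (- 1#) (root-of-unity N v v≢0 v<N))

  0ᵥ : ∀ {n} → ℤ^ n
  0ᵥ {n} = replicate n ℤ.+0

  -- Grids with more than this many points per axis do not alias the frequency.
  maxNorm : ∀ {n} → ℤ^ n → ℕ
  maxNorm []      = 0
  maxNorm (x ∷ v) = ℤ.∣ x ∣ ℕ.⊔ maxNorm v

  -- The Lipschitz constant of t ↦ v · t for the supremum norm.
  ℓ¹Norm : ∀ {n} → ℤ^ n → ℝ
  ℓ¹Norm []      = 0#
  ℓ¹Norm (x ∷ v) = abs (fromℤ x) + ℓ¹Norm v

  corner : ∀ {n} N .{{_ : NonZero N}} → Vec (Fin N) n → Vector ℝ n
  corner N k i = grid N (toℕ (lookup k i))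

  -- The character is a product over the coordinates, so its average factors into one-dimensional
  -- ones.
  average : ∀ n N .{{_ : NonZero N}} (v : ℤ^ n) → maxNorm v ℕ.< N →
            real (1/ N ^ n) *ᶜ ℂΣ.Σ[ cells N n ] (λ k → e (v · corner N k)) ≈ᶜ ℂΣ.[ v ≟ᵥ 0ᵥ ]₁
  average zero    N []      _   = ℂR.trans (ℂR.*-identityˡ _)
    (ℂR.trans (ℂR.+-identityʳ (e 0#)) e-0)
  average (suc n) N (x ∷ v) v<N = begin
    real (1/ N * 1/ N ^ n) *ᶜ ℂΣ.Σ[ cells N (suc n) ] (λ k → e ((x ∷ v) · corner N k))
      ≈⟨ ℂR.*-cong (real-* (1/ N) (1/ N ^ n)) (ℂΣ.Σ-cartesianProductWith _∷_ (List.allFin N) (cells N n) (λ k → e ((x ∷ v) · corner N k))) ⟩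
    real (1/ N) *ᶜ real (1/ N ^ n) *ᶜ ℂΣ.Σ[ List.allFin N ] (λ i → ℂΣ.Σ[ cells N n ] (λ k → e (fromℤ x * grid N (toℕ i) + v · corner N k)))
      ≈⟨ ℂR.*-congˡ {real (1/ N) *ᶜ real (1/ N ^ n)} (ℂΣ.Σ-cong (List.allFin N) (λ i → ℂΣ.Σ-cong (cells N n) (λ k → e-+ _ _))) ⟩
    real (1/ N) *ᶜ real (1/ N ^ n) *ᶜ ℂΣ.Σ[ List.allFin N ] (λ i → ℂΣ.Σ[ cells N n ] (λ k → f i *ᶜ h k))
      ≈⟨ ℂR.*-congˡ {real (1/ N) *ᶜ real (1/ N ^ n)} (ℂΣ.Σ-*-Σ (List.allFin N) (cells N n) f h) ⟨
    real (1/ N) *ᶜ real (1/ N ^ n) *ᶜ (ℂΣ.Σ[ List.allFin N ] f *ᶜ ℂΣ.Σ[ cells N n ] h)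
      ≈⟨ ℂS.solve 4 (λ a b c d → a ℂS.:* b ℂS.:* (c ℂS.:* d) ℂS.:= a ℂS.:* c ℂS.:* (b ℂS.:* d)) ℂR.refl (real (1/ N)) (real (1/ N ^ n)) (ℂΣ.Σ[ List.allFin N ] f) (ℂΣ.Σ[ cells N n ] h) ⟩
    (real (1/ N) *ᶜ ℂΣ.Σ[ List.allFin N ] f) *ᶜ (real (1/ N ^ n) *ᶜ ℂΣ.Σ[ cells N n ] h)
      ≈⟨ ℂR.*-cong (average₁ N x (ℕ.≤-<-trans (ℕ.m≤m⊔n ℤ.∣ x ∣ (maxNorm v)) v<N)) (average n N v (ℕ.≤-<-trans (ℕ.m≤n⊔m ℤ.∣ x ∣ (maxNorm v)) v<N)) ⟩
    ℂΣ.[ x ℤ.≟ ℤ.+0 ]₁ *ᶜ ℂΣ.[ v ≟ᵥ 0ᵥ ]₁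
      ≈⟨ indicator-∷ ⟩
    ℂΣ.[ (x ∷ v) ≟ᵥ 0ᵥ ]₁ ∎
    where
    open SetoidReasoning ℂR.setoid
    f : Fin N → ℂ
    f i = e (fromℤ x * grid N (toℕ i))
    h : Vec (Fin N) n → ℂ
    h k = e (v · corner N k)
    indicator-∷ : ℂΣ.[ x ℤ.≟ ℤ.+0 ]₁ *ᶜ ℂΣ.[ v ≟ᵥ 0ᵥ ]₁ ≈ᶜ ℂΣ.[ (x ∷ v) ≟ᵥ 0ᵥ ]₁
    indicator-∷ with x ℤ.≟ ℤ.+0 | v ≟ᵥ 0ᵥ
    ... | no _       | p          = ℂR.zeroˡ ℂΣ.[ p ]₁
    ... | yes _      | no _       = ℂR.zeroʳ 1ᶜ
    ... | yes _      | yes _      = ℂR.*-identityˡ 1ᶜ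

  ·-close : ∀ {n} (v : ℤ^ n) (t s : Vector ℝ n) {δ} → (∀ i → abs (t i - s i) ≤ δ) → abs (v · t - v · s) ≤ ℓ¹Norm v * δ
  ·-close []      t s {δ} close = ≤-reflexive (trans (abs-cong (-‿inverseʳ 0#)) (trans abs-0 (sym (zeroˡ δ))))
  ·-close (x ∷ v) t s {δ} close = begin
    abs (fromℤ x * t₀ + v · t′ - (fromℤ x * s₀ + v · s′))
      ≈⟨ abs-cong (solve 5 (λ x t s p q → x :* t :+ p :- (x :* s :+ q) := x :* (t :- s) :+ (p :- q)) refl (fromℤ x) t₀ s₀ (v · t′) (v · s′)) ⟩
    abs (fromℤ x * (t₀ - s₀) + (v · t′ - v · s′))
      ≤⟨ abs-+ _ _ ⟩
    abs (fromℤ x * (t₀ - s₀)) + abs (v · t′ - v · s′)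
      ≤⟨ +-mono-≤ (≤-trans (≤-reflexive (abs-* _ _)) (*-monoʳ-≤ (abs-nonneg _) (close Fin.zero))) (·-close v t′ s′ (close ∘ Fin.suc)) ⟩
    abs (fromℤ x) * δ + ℓ¹Norm v * δ
      ≈⟨ distribʳ _ _ _ ⟨
    (abs (fromℤ x) + ℓ¹Norm v) * δ ∎
    where
    open ≤-Reasoning
    t₀ = t Fin.zero
    s₀ = s Fin.zero
    t′ = λ i → t (Fin.suc i)
    s′ = λ i → s (Fin.suc i)

  tag-close : ∀ {n} N .{{_ : NonZero N}} (k : Vec (Fin N) n) {t} → InCell k t → ∀ i → abs (t i - corner N k i) ≤ 1/ N
  tag-close N k {t} inCell i = abs-≤
    (≤-by (fromℕ (suc j) * 1/ N - t i) (x≤y⇒0≤y-x (proj₂ (inCell i)))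
      (solve 3 (λ n j t → n := t :- j :* n :+ ((con (pos 1) :+ j) :* n :- t)) refl (1/ N) (fromℕ j) (t i)))
    (≤-by (1/ N + (t i - fromℕ j * 1/ N)) (+-nonneg (<⇒≤ (0<1/ N)) (x≤y⇒0≤y-x (proj₁ (inCell i))))
      (solve 3 (λ n j t → n := :- (t :- j :* n) :+ (n :+ (t :- j :* n))) refl (1/ N) (fromℕ j) (t i)))
    where j = toℕ (lookup k i)

  average-re : ∀ n N .{{_ : NonZero N}} (v : ℤ^ n) → maxNorm v ℕ.< N →
               avg N (λ k → re (e (v · corner N k))) ≈ [ v ≟ᵥ 0ᵥ ]₁
  average-re n N v v<N = begin
    1/ N ^ n * Σ[ cells N n ] (λ k → re (e (v · corner N k)))
      ≈⟨ *-congˡ (reflexive (re-Σ (cells N n) (λ k → e (v · corner N k)))) ⟨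
    1/ N ^ n * re z
      ≈⟨ solve 3 (λ w a b → w :* a := w :* a :- con (pos 0) :* b) refl (1/ N ^ n) (re z) (im z) ⟩
    re (real (1/ N ^ n) *ᶜ z)
      ≈⟨ proj₁ (average n N v v<N) ⟩
    re ℂΣ.[ v ≟ᵥ 0ᵥ ]₁
      ≈⟨ re-indicator (v ≟ᵥ 0ᵥ) ⟩
    [ v ≟ᵥ 0ᵥ ]₁ ∎
    where
    open SetoidReasoning setoid
    z = ℂΣ.Σ[ cells N n ] (λ k → e (v · corner N k))
    re-indicator : ∀ {P : Set} (P? : Dec P) → re ℂΣ.[ P? ]₁ ≈ [ P? ]₁
    re-indicator (yes _) = refl
    re-indicator (no _)  = refl

  -- With corners as tags the Riemann sum already equals the limit once N exceeds `maxNorm v`. Any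
  -- other tag lies within 1/N of its corner, and the Lipschitz bound controls the change.
  ∫-character : ∀ {n} (v : ℤ^ n) → Integral (λ t → re (e (v · t))) [ v ≟ᵥ 0ᵥ ]₁
  ∫-character {n} v ε 0<ε = eventually-map
    (λ {N} (large , small₁ , smallε) tag inCell → ≤-trans
      (≤-reflexive (abs-cong (+-congˡ {avg (suc N) (λ k → re (e (v · tag k)))} (-‿cong (sym (average-re n (suc N) v (ℕ.s≤s large)))))))
      (avg-close (suc N) (λ k → close N k (inCell k) small₁ smallε)))
    (eventually-× (maxNorm v , λ N≥ → N≥)
      -- The first condition brings the displacement into the range where the Lipschitz bound holds;
      -- the second makes that bound at most ε.
      (eventually-× (eventually-small (2π * ℓ¹Norm v) 1# 0<1) (eventually-small (lipschitz * ℓ¹Norm v) ε 0<ε)))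
    where
    open ≤-Reasoning
    close : ∀ N (k : Vec (Fin (suc N)) n) {t} → InCell k t → 2π * ℓ¹Norm v * 1/ (suc N) ≤ 1# → lipschitz * ℓ¹Norm v * 1/ (suc N) ≤ ε →
            abs (re (e (v · t)) - re (e (v · corner (suc N) k))) ≤ ε
    close N k {t} inCell small₁ smallε = begin
      abs (re (e (v · t)) - re (e (v · s)))   ≤⟨ abs-re≤ (e (v · t) -ᶜ e (v · s)) ⟩
      ∣ e (v · t) -ᶜ e (v · s) ∣              ≤⟨ ∣e-e∣≤ (v · t) (v · s) (scale 0≤2π small₁) ⟩
      lipschitz * abs (v · t - v · s)                 ≤⟨ scale 0≤lipschitz smallε ⟩
      ε                                       ∎
      where
      s = corner (suc N) k
      scale : ∀ {x b} → 0# ≤ x → x * ℓ¹Norm v * 1/ (suc N) ≤ b → x * abs (v · t - v · s) ≤ b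
      scale {x} 0≤x small = ≤-trans (*-monoʳ-≤ 0≤x (·-close v t s (tag-close (suc N) k inCell)))
        (≤-trans (≤-reflexive (sym (*-assoc _ _ _))) small)

-- Addition and subtraction of integer vectors.

private module ℤ-Group = AbelianGroupProperties ℤ.+-0-abelianGroup

+ᵥ-cancel : ∀ {n} {x y z : ℤ^ n} → x +ᵥ y ≡ z → y ≡ z -ᵥ x
+ᵥ-cancel {x = []}    {[]}    ≡.refl = ≡.refl
+ᵥ-cancel {x = a ∷ x} {b ∷ y} ≡.refl = ≡.cong₂ _∷_ (≡.sym (ℤ-Group.xyx⁻¹≈y a b)) (+ᵥ-cancel {x = x} ≡.refl)

+ᵥ--ᵥ : ∀ {n} (x z : ℤ^ n) → x +ᵥ (z -ᵥ x) ≡ z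
+ᵥ--ᵥ []      []      = ≡.refl
+ᵥ--ᵥ (a ∷ x) (b ∷ z) = ≡.cong₂ _∷_ (≡.trans (≡.sym (ℤ.+-assoc a b (ℤ.- a))) (ℤ-Group.xyx⁻¹≈y a b)) (+ᵥ--ᵥ x z)

-ᵥ≡0⇒≡ : ∀ {n} (x y : ℤ^ n) → x -ᵥ y ≡ replicate n ℤ.+0 → x ≡ y
-ᵥ≡0⇒≡ []      []      _ = ≡.refl
-ᵥ≡0⇒≡ (a ∷ x) (b ∷ y) p = ≡.cong₂ _∷_ (ℤ.i-j≡0⇒i≡j a b (≡.cong Vec.head p)) (-ᵥ≡0⇒≡ x y (≡.cong Vec.tail p))

≡⇒-ᵥ≡0 : ∀ {n} (x : ℤ^ n) → x -ᵥ x ≡ replicate n ℤ.+0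
≡⇒-ᵥ≡0 []      = ≡.refl
≡⇒-ᵥ≡0 (a ∷ x) = ≡.cong₂ _∷_ (ℤ.+-inverseʳ a) (≡⇒-ᵥ≡0 x)

-- Parseval's identity and the additive energy.

module Energy {c ℓ₁ ℓ₂} (R : CompleteOrderedField c ℓ₁ ℓ₂) (F : Reals.ElementaryFunctions R) where
  open Reals R hiding (zero)
  open ExponentialSums F
  open Order R
  open Modulus R F
  open Exponential R F
  open Characters R F
  open RiemannSums R F
  open CharacterIntegrals R F
  open IntegerCoefficients commutativeRing using (module Solver)
  open Solver using (solve; _:=_; _:+_; _:*_; :-_; _:-_; con)
  open ListSums commutativeRing
  private
    module ℂS = IntegerCoefficients.Solver ℂ-commutativeRing

  ·-+ : ∀ {n} (v w : ℤ^ n) t → (v +ᵥ w) · t ≈ v · t + w · t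
  ·-+ []      []      t = sym (+-identityˡ 0#)
  ·-+ (x ∷ v) (y ∷ w) t = trans (+-cong (*-congʳ (fromℤ-+ x y)) (·-+ v w (t ∘ Fin.suc)))
    (solve 5 (λ x y t p q → (x :+ y) :* t :+ (p :+ q) := x :* t :+ p :+ (y :* t :+ q)) refl (fromℤ x) (fromℤ y) (t Fin.zero) (v · (t ∘ Fin.suc)) (w · (t ∘ Fin.suc)))

  ·-- : ∀ {n} (v w : ℤ^ n) t → (v -ᵥ w) · t ≈ v · t - w · t
  ·-- []      []      t = sym (-‿inverseʳ 0#)
  ·-- (x ∷ v) (y ∷ w) t = trans (+-cong (*-congʳ (trans (fromℤ-+ x (ℤ.- y)) (+-congˡ (fromℤ-neg y)))) (·-- v w (t ∘ Fin.suc)))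
    (solve 5 (λ x y t p q → (x :- y) :* t :+ (p :- q) := x :* t :+ p :- (y :* t :+ q)) refl (fromℤ x) (fromℤ y) (t Fin.zero) (v · (t ∘ Fin.suc)) (w · (t ∘ Fin.suc)))

  module _ {n : ℕ} where

    -- A trigonometric polynomial whose frequencies s p need not be distinct.
    trig : {A : Set} → List A → (A → ℝ) → (A → ℤ^ n) → Vector ℝ n → ℂ
    trig P b s t = ℂΣ.Σ[ P ] (λ p → real (b p) *ᶜ e (s p · t))

    -- The L² inner product of two trigonometric polynomials in terms of coefficients: only
    -- coinciding frequencies contribute.
    pairing : {A B : Set} → List A → (A → ℝ) → (A → ℤ^ n) → List B → (B → ℝ) → (B → ℤ^ n) → ℝ
    pairing P b s Q c s′ = Σ[ P ] (λ p → Σ[ Q ] (λ q → b p * c q * [ s p ≟ᵥ s′ q ]₁))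

    e-*-conj : ∀ (v w : ℤ^ n) t → e (v · t) *ᶜ conj (e (w · t)) ≈ᶜ e ((v -ᵥ w) · t)
    e-*-conj v w t = ℂR.trans (ℂR.*-congˡ {e (v · t)} (conj-e (w · t)))
      (ℂR.trans (ℂR.sym (e-+ (v · t) (- (w · t)))) (e-cong (sym (·-- v w t))))

    ∫-pairing : {A B : Set} (P : List A) (b : A → ℝ) (s : A → ℤ^ n) (Q : List B) (c : B → ℝ) (s′ : B → ℤ^ n) →
      Integral (λ t → re (trig P b s t *ᶜ conj (trig Q c s′ t))) (pairing P b s Q c s′)
    ∫-pairing P b s Q c s′ = ∫-cong (λ t → sym (expand t)) refl
      (∫-Σ P {f = λ p t → Σ[ Q ] (λ q → b p * c q * character p q t)} (λ p →
        ∫-Σ Q {f = λ q t → b p * c q * character p q t} (λ q →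
          ∫-cong {f = λ t → b p * c q * character p q t} (λ _ → refl) (*-congˡ (indicator p q)) (∫-* {f = character p q} (b p * c q) (∫-character (s p -ᵥ s′ q))))))
      where
      character : _ → _ → Vector ℝ n → ℝ
      character p q t = re (e ((s p -ᵥ s′ q) · t))
      indicator : ∀ p q → [ (s p -ᵥ s′ q) ≟ᵥ 0ᵥ ]₁ ≈ [ s p ≟ᵥ s′ q ]₁
      indicator p q = []₁-cong ((s p -ᵥ s′ q) ≟ᵥ 0ᵥ) (s p ≟ᵥ s′ q) (-ᵥ≡0⇒≡ (s p) (s′ q)) (λ eq → ≡.trans (≡.cong (_-ᵥ s′ q) eq) (≡⇒-ᵥ≡0 (s′ q)))
      expand : ∀ t → re (trig P b s t *ᶜ conj (trig Q c s′ t)) ≈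
                     Σ[ P ] (λ p → Σ[ Q ] (λ q → b p * c q * re (e ((s p -ᵥ s′ q) · t))))
      expand t = begin
        re (trig P b s t *ᶜ conj (trig Q c s′ t))
          ≈⟨ proj₁ (ℂR.*-congˡ {trig P b s t} (conj-Σ Q _)) ⟩
        re (trig P b s t *ᶜ ℂΣ.Σ[ Q ] (λ q → conj (real (c q) *ᶜ e (s′ q · t))))
          ≈⟨ proj₁ (ℂΣ.Σ-*-Σ P Q (λ p → real (b p) *ᶜ e (s p · t)) (λ q → conj (real (c q) *ᶜ e (s′ q · t)))) ⟩
        re (ℂΣ.Σ[ P ] (λ p → ℂΣ.Σ[ Q ] (λ q → real (b p) *ᶜ e (s p · t) *ᶜ conj (real (c q) *ᶜ e (s′ q · t)))))
          ≈⟨ reflexive (re-Σ P _) ⟩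
        Σ[ P ] (λ p → re (ℂΣ.Σ[ Q ] (λ q → real (b p) *ᶜ e (s p · t) *ᶜ conj (real (c q) *ᶜ e (s′ q · t)))))
          ≈⟨ Σ-cong P (λ p → trans (reflexive (re-Σ Q _)) (Σ-cong Q (λ q → coefficient (b p) (c q) (s p) (s′ q)))) ⟩
        Σ[ P ] (λ p → Σ[ Q ] (λ q → b p * c q * re (e ((s p -ᵥ s′ q) · t)))) ∎
        where
        open SetoidReasoning setoid
        coefficient : ∀ x y v w → re (real x *ᶜ e (v · t) *ᶜ conj (real y *ᶜ e (w · t))) ≈ x * y * re (e ((v -ᵥ w) · t))
        coefficient x y v w = trans
          (solve 6 (λ x y a b c d →
            (x :* a :- con (pos 0) :* b) :* (y :* c :- con (pos 0) :* d) :- (x :* b :+ con (pos 0) :* a) :* :- (y :* d :+ con (pos 0) :* c) :=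
            x :* y :* (a :* c :- b :* :- d)) refl x y (re (e (v · t))) (im (e (v · t))) (re (e (w · t))) (im (e (w · t))))
          (*-congˡ (proj₁ (e-*-conj v w t)))

    norm²≈re : ∀ z → norm² z ≈ re (z *ᶜ conj z)
    norm²≈re (a +i b) = solve 2 (λ a b → a :* a :+ b :* b := a :* a :- b :* :- b) refl a b

    ∫-norm² : {A : Set} (P : List A) (b : A → ℝ) (s : A → ℤ^ n) → Integral (λ t → norm² (trig P b s t)) (pairing P b s P b s)
    ∫-norm² P b s = ∫-cong (λ t → sym (norm²≈re (trig P b s t))) refl (∫-pairing P b s P b s)

    pairs : List (ℤ^ n) → List (ℤ^ n × ℤ^ n)
    pairs X = List.cartesianProduct X X

    _⊗_ : (ℤ^ n → ℝ) → (ℤ^ n → ℝ) → ℤ^ n × ℤ^ n → ℝ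
    (a ⊗ b) (x , y) = a x * b y

    ⊕ : ℤ^ n × ℤ^ n → ℤ^ n
    ⊕ (x , y) = x +ᵥ y

    -- The weighted count of solutions of x₁ + x₂ = x₃ + x₄. It is written as a pairing on pairs
    -- because |f|⁴ = |f²|², and f² has the frequencies x + y.
    energy : List (ℤ^ n) → (ℤ^ n → ℝ) → ℝ
    energy X a = pairing (pairs X) (a ⊗ a) ⊕ (pairs X) (a ⊗ a) ⊕

    trig-square : ∀ X a t → trig X a (λ x → x) t *ᶜ trig X a (λ x → x) t ≈ᶜ trig (pairs X) (a ⊗ a) ⊕ t
    trig-square X a t = ℂR.trans (ℂΣ.Σ-*-Σ X X f f) (ℂR.sym (ℂR.trans
      (ℂΣ.Σ-cartesianProductWith _,_ X X (λ p → real ((a ⊗ a) p) *ᶜ e (⊕ p · t)))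
      (ℂΣ.Σ-cong X (λ x → ℂΣ.Σ-cong X (λ y → term≈ x y)))))
      where
      f : ℤ^ n → ℂ
      f x = real (a x) *ᶜ e (x · t)
      term≈ : ∀ x y → real (a x * a y) *ᶜ e ((x +ᵥ y) · t) ≈ᶜ f x *ᶜ f y
      term≈ x y = ℂR.trans (ℂR.*-cong (real-* (a x) (a y)) (ℂR.trans (e-cong (·-+ x y t)) (e-+ (x · t) (y · t))))
        (ℂS.solve 4 (λ a b c d → a ℂS.:* b ℂS.:* (c ℂS.:* d) ℂS.:= a ℂS.:* c ℂS.:* (b ℂS.:* d)) ℂR.refl (real (a x)) (real (a y)) (e (x · t)) (e (y · t)))

    ∣∣^4≈ : ∀ X a t → ∣ trig X a (λ x → x) t ∣ ^ 4 ≈ norm² (trig (pairs X) (a ⊗ a) ⊕ t)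
    ∣∣^4≈ X a t = begin
      ∣ f ∣ ^ 4                              ≈⟨ ^4≈ ∣ f ∣ ⟩
      ∣ f ∣ * ∣ f ∣ * (∣ f ∣ * ∣ f ∣)        ≈⟨ *-cong (∣∣-square f) (∣∣-square f) ⟩
      norm² f * norm² f                      ≈⟨ norm²-* f f ⟨
      norm² (f *ᶜ f)                         ≈⟨ norm²-cong (trig-square X a t) ⟩
      norm² (trig (pairs X) (a ⊗ a) ⊕ t)     ∎
      where
      open SetoidReasoning setoid
      f = trig X a (λ x → x) t

    ∫-^4 : ∀ X a → Integral (λ t → ∣ trig X a (λ x → x) t ∣ ^ 4) (energy X a)
    ∫-^4 X a = ∫-cong (λ t → sym (∣∣^4≈ X a t)) refl (∫-norm² (pairs X) (a ⊗ a) ⊕)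

    -- Grouping the indices by frequency z gives a sum of squares of the total coefficients. This
    -- yields both the nonnegativity of the energy and its agreement with `E₂`.
    pairing-self : {A : Set} (P : List A) (b : A → ℝ) (s : A → ℤ^ n) {Z : List (ℤ^ n)} → Unique Z → (∀ {p} → p List.∈ P → s p List.∈ Z) →
      pairing P b s P b s ≈ Σ[ Z ] (λ z → Σ[ P ] (λ p → b p * [ s p ≟ᵥ z ]₁) * Σ[ P ] (λ p → b p * [ s p ≟ᵥ z ]₁))
    pairing-self P b s {Z} Z! s∈Z = begin
      Σ[ P ] (λ p → Σ[ P ] (λ q → b p * b q * [ s p ≟ᵥ s q ]₁))
        ≈⟨ Σ-cong∈ P (λ {p} p∈P → Σ-cong P (λ q → split p∈P q)) ⟩
      Σ[ P ] (λ p → Σ[ P ] (λ q → Σ[ Z ] (λ z → g p z * g q z)))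
        ≈⟨ Σ-cong P (λ p → Σ-swap P Z (λ q z → g p z * g q z)) ⟩
      Σ[ P ] (λ p → Σ[ Z ] (λ z → Σ[ P ] (λ q → g p z * g q z)))
        ≈⟨ Σ-swap P Z (λ p z → Σ[ P ] (λ q → g p z * g q z)) ⟩
      Σ[ Z ] (λ z → Σ[ P ] (λ p → Σ[ P ] (λ q → g p z * g q z)))
        ≈⟨ Σ-cong Z (λ z → sym (Σ-*-Σ P P (λ p → g p z) (λ p → g p z))) ⟩
      Σ[ Z ] (λ z → Σ[ P ] (λ p → g p z) * Σ[ P ] (λ p → g p z)) ∎
      where
      open SetoidReasoning setoid
      g = λ p z → b p * [ s p ≟ᵥ z ]₁
      split : ∀ {p} → p List.∈ P → ∀ q → b p * b q * [ s p ≟ᵥ s q ]₁ ≈ Σ[ Z ] (λ z → g p z * g q z)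
      split {p} p∈P q = begin
        b p * b q * [ s p ≟ᵥ s q ]₁
          ≈⟨ *-congˡ ([]₁-cong (s p ≟ᵥ s q) (s q ≟ᵥ s p) ≡.sym ≡.sym) ⟩
        b p * b q * [ s q ≟ᵥ s p ]₁
          ≈⟨ Σ-pick-≡ _≟ᵥ_ (λ z → b p * b q * [ s q ≟ᵥ z ]₁) Z! (s∈Z p∈P) ⟨
        Σ[ Z ] (λ z → [ z ≟ᵥ s p ]₁ * (b p * b q * [ s q ≟ᵥ z ]₁))
          ≈⟨ Σ-cong Z (λ z → trans (*-congʳ ([]₁-cong (z ≟ᵥ s p) (s p ≟ᵥ z) ≡.sym ≡.sym))
               (solve 4 (λ i x y j → i :* (x :* y :* j) := x :* i :* (y :* j)) refl [ s p ≟ᵥ z ]₁ (b p) (b q) [ s q ≟ᵥ z ]₁)) ⟩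
        Σ[ Z ] (λ z → g p z * g q z) ∎

    sumset : List (ℤ^ n) → List (ℤ^ n)
    sumset X = List.deduplicate _≟ᵥ_ (List.cartesianProductWith _+ᵥ_ X X)

    energy≈ : ∀ X a → energy X a ≈ Σ[ sumset X ] (λ z → Σ[ pairs X ] (λ p → (a ⊗ a) p * [ ⊕ p ≟ᵥ z ]₁) * Σ[ pairs X ] (λ p → (a ⊗ a) p * [ ⊕ p ≟ᵥ z ]₁))
    energy≈ X a = pairing-self (pairs X) (a ⊗ a) ⊕ (deduplicate-! _≟ᵥ_ _)
      (λ { {x , y} p∈ → ∈-deduplicate⁺ _≟ᵥ_ (∈-cartesianProductWith⁺ _+ᵥ_ (proj₁ (∈-cartesianProduct⁻ X X p∈)) (proj₂ (∈-cartesianProduct⁻ X X p∈))) })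

    energy-nonneg : ∀ X a → 0# ≤ energy X a
    energy-nonneg X a = ≤-trans (Σ-nonneg (sumset X) (λ _ → square-nonneg _)) (≤-reflexive (sym (energy≈ X a)))

    -- The total coefficient at z is (μ * μ)(z): for fixed x the only partner is y = z - x, and if z
    -- - x lies outside X both sides vanish because μ is supported on X.
    energy≈E₂ : ∀ X {μ} → IsProbabilityMeasure X μ → energy (elements X) μ ≈ E₂ X μ
    energy≈E₂ X {μ} prob = trans (energy≈ (elements X) μ) (Σ-cong (sumset (elements X)) (λ z → trans (*-cong (conv≈ z) (conv≈ z)) (sym (square≈^2 _))))
      where
      open IsProbabilityMeasure prob
      open DecMembership _≟ᵥ_ using (_∈?_)
      inner : ∀ x z → Σ[ elements X ] (λ y → [ (x +ᵥ y) ≟ᵥ z ]₁ * μ y) ≈ μ (z -ᵥ x)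
      inner x z with (z -ᵥ x) ∈? elements X
      ... | yes z-x∈X = Σ-pick (λ y → (x +ᵥ y) ≟ᵥ z) μ (unique X) z-x∈X (+ᵥ--ᵥ x z) (λ _ → +ᵥ-cancel)
      ... | no z-x∉X  = trans
        (Σ-zero∈ (elements X) (λ {y} y∈X → trans (*-congʳ ([]₁-no ((x +ᵥ y) ≟ᵥ z) (λ x+y≡z → z-x∉X (≡.subst (List._∈ elements X) (+ᵥ-cancel x+y≡z) y∈X)))) (zeroˡ _)))
        (sym (supported z-x∉X))
      conv≈ : ∀ z → Σ[ pairs (elements X) ] (λ p → (μ ⊗ μ) p * [ ⊕ p ≟ᵥ z ]₁) ≈ ∑ X (λ x → μ x * μ (z -ᵥ x))
      conv≈ z = trans (Σ-cartesianProductWith _,_ (elements X) (elements X) (λ p → (μ ⊗ μ) p * [ ⊕ p ≟ᵥ z ]₁))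
        (Σ-cong (elements X) (λ x → trans
          (Σ-cong (elements X) (λ y → solve 3 (λ a b i → a :* b :* i := a :* (i :* b)) refl (μ x) (μ y) [ (x +ᵥ y) ≟ᵥ z ]₁))
          (trans (Σ-*ˡ (elements X) (μ x) _) (*-congˡ (inner x z)))))

    -- The form in which each of the four variables can be rewritten or reindexed separately.
    energy-quadruples : ∀ X a → energy X a ≈
      Σ[ X ] (λ x₁ → Σ[ X ] (λ x₂ → Σ[ X ] (λ x₃ → Σ[ X ] (λ x₄ → a x₁ * a x₂ * (a x₃ * a x₄) * [ (x₁ +ᵥ x₂) ≟ᵥ (x₃ +ᵥ x₄) ]₁))))
    energy-quadruples X a = trans (Σ-cartesianProductWith _,_ X X _)
      (Σ-cong X (λ x₁ → Σ-cong X (λ x₂ → Σ-cartesianProductWith _,_ X X _)))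

    energy-cong : ∀ X {a b} → (∀ {x} → x List.∈ X → a x ≈ b x) → energy X a ≈ energy X b
    energy-cong X a≈b = trans (energy-quadruples X _) (trans
      (Σ-cong∈ X (λ x₁ → Σ-cong∈ X (λ x₂ → Σ-cong∈ X (λ x₃ → Σ-cong∈ X (λ x₄ →
        *-congʳ (*-cong (*-cong (a≈b x₁) (a≈b x₂)) (*-cong (a≈b x₃) (a≈b x₄))))))))
      (sym (energy-quadruples X _)))

    energy-* : ∀ X r a → energy X (λ x → r * a x) ≈ r * r * (r * r) * energy X a
    energy-* X r a = trans
      (Σ-cong (pairs X) (λ p → trans
        (Σ-cong (pairs X) (λ q → solve 6 (λ r a b c d i → r :* a :* (r :* b) :* (r :* c :* (r :* d)) :* i := r :* r :* (r :* r) :* (a :* b :* (c :* d) :* i)) refl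
          r (a (proj₁ p)) (a (proj₂ p)) (a (proj₁ q)) (a (proj₂ q)) [ ⊕ p ≟ᵥ ⊕ q ]₁))
        (Σ-*ˡ (pairs X) _ _)))
      (Σ-*ˡ (pairs X) _ _)

-- Lets near-minimisers be chosen for all parts at once although each exists only up to double
-- negation; finiteness of the index set permits the induction.
¬¬-Π : ∀ {p} k {P : Fin k → Set p} → (∀ θ → ¬ ¬ P θ) → ¬ ¬ (∀ θ → P θ)
¬¬-Π zero    ¬¬P ¬ΠP = ¬ΠP (λ ())
¬¬-Π (suc k) ¬¬P ¬ΠP = ¬¬P Fin.zero (λ P₀ → ¬¬-Π k (¬¬P ∘ Fin.suc) (λ Pₛ →
  ¬ΠP (λ { Fin.zero → P₀ ; (Fin.suc θ) → Pₛ θ })))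

-- Freiman invariance of the energy and the duality bound.

module Capacity {c ℓ₁ ℓ₂} (R : CompleteOrderedField c ℓ₁ ℓ₂) (F : Reals.ElementaryFunctions R) where
  open Reals R hiding (zero)
  open ExponentialSums F
  open Order R
  open Modulus R F
  open Limits R F
  open RiemannSums R F
  open CharacterIntegrals R F
  open Energy R F
  open IntegerCoefficients commutativeRing using (module Solver)
  open Solver using (solve; _:=_; _:+_; _:*_; :-_; _:-_; con)
  open ListSums commutativeRing

  -- Double counting of the pairs (d, s) with s = φ d: each d has one image in S, and each s one
  -- preimage in D.
  Σ-reindex : ∀ {m d} {D : FiniteSet (ℤ^ m)} {S : FiniteSet (ℤ^ d)} (iso : FreimanIsomorphism₂ D S) →
              let open FreimanIsomorphism₂ iso in
              ∀ (h : ℤ^ d → ℝ) → Σ[ elements D ] (h ∘ φ) ≈ Σ[ elements S ] h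
  Σ-reindex {D = D} {S} iso h = begin
    Σ[ elements D ] (h ∘ φ)
      ≈⟨ Σ-cong∈ (elements D) (λ d∈D → Σ-pick-≡ _≟ᵥ_ h (unique S) (maps-to d∈D)) ⟨
    Σ[ elements D ] (λ d → Σ[ elements S ] (λ s → [ s ≟ᵥ φ d ]₁ * h s))
      ≈⟨ Σ-swap (elements D) (elements S) _ ⟩
    Σ[ elements S ] (λ s → Σ[ elements D ] (λ d → [ s ≟ᵥ φ d ]₁ * h s))
      ≈⟨ Σ-cong∈ (elements S) only-preimage ⟩
    Σ[ elements S ] h ∎
    where
    open SetoidReasoning setoid
    open FreimanIsomorphism₂ iso
    only-preimage : ∀ {s} → s ∈ S → Σ[ elements D ] (λ d → [ s ≟ᵥ φ d ]₁ * h s) ≈ h s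
    only-preimage {s} s∈S with surjective s∈S
    ... | d , d∈D , φd≡s = Σ-pick (λ d → s ≟ᵥ φ d) (λ _ → h s) (unique D) d∈D (≡.sym φd≡s)
      (λ d′∈D s≡φd′ → injective d′∈D d∈D (≡.sym (≡.trans φd≡s s≡φd′)))

  -- A Freiman isomorphism preserves the relation x₁ + x₂ = x₃ + x₄ in both directions, so the
  -- brackets agree; the four sums are then reindexed from the innermost outwards.
  energy-Freiman : ∀ {m d} {D : FiniteSet (ℤ^ m)} {S : FiniteSet (ℤ^ d)} (iso : FreimanIsomorphism₂ D S) →
                   ∀ a → energy (elements D) (a ∘ FreimanIsomorphism₂.φ iso) ≈ energy (elements S) a
  energy-Freiman {D = D} {S} iso a = trans (energy-quadruples (elements D) (a ∘ φ)) (trans transport (sym (energy-quadruples (elements S) a)))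
    where
    open FreimanIsomorphism₂ iso
    g : _ → _ → _ → _ → ℝ
    g x₁ x₂ x₃ x₄ = a x₁ * a x₂ * (a x₃ * a x₄) * [ (x₁ +ᵥ x₂) ≟ᵥ (x₃ +ᵥ x₄) ]₁
    transport : Σ[ elements D ] (λ x₁ → Σ[ elements D ] (λ x₂ → Σ[ elements D ] (λ x₃ → Σ[ elements D ] (λ x₄ →
                  a (φ x₁) * a (φ x₂) * (a (φ x₃) * a (φ x₄)) * [ (x₁ +ᵥ x₂) ≟ᵥ (x₃ +ᵥ x₄) ]₁)))) ≈
                Σ[ elements S ] (λ y₁ → Σ[ elements S ] (λ y₂ → Σ[ elements S ] (λ y₃ → Σ[ elements S ] (g y₁ y₂ y₃))))
    transport = trans
      (Σ-cong∈ (elements D) (λ x₁ → trans (Σ-cong∈ (elements D) (λ x₂ → trans (Σ-cong∈ (elements D) (λ x₃ → trans (Σ-cong∈ (elements D) (λ x₄ →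
          *-congˡ ([]₁-cong (_ ≟ᵥ _) (_ ≟ᵥ _) (Equivalence.to (additive x₁ x₂ x₃ x₄)) (Equivalence.from (additive x₁ x₂ x₃ x₄)))))
        (Σ-reindex iso (g _ _ _))))
        (Σ-reindex iso (λ y₃ → Σ[ elements S ] (g _ _ y₃)))))
        (Σ-reindex iso (λ y₂ → Σ[ elements S ] (λ y₃ → Σ[ elements S ] (g _ y₂ y₃))))))
      (Σ-reindex iso (λ y₁ → Σ[ elements S ] (λ y₂ → Σ[ elements S ] (λ y₃ → Σ[ elements S ] (g y₁ y₂ y₃)))))

  Σ-subset : ∀ {n} {X Y : FiniteSet (ℤ^ n)} → X ⊆ Y → ∀ {f} → (∀ {x} → x ∉ X → f x ≈ 0#) →
             Σ[ elements Y ] f ≈ Σ[ elements X ] f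
  Σ-subset {X = X} {Y} X⊆Y {f} f≈0 = begin
    Σ[ elements Y ] f
      ≈⟨ Σ-cong (elements Y) inner ⟨
    Σ[ elements Y ] (λ y → Σ[ elements X ] (λ x → [ y ≟ᵥ x ]₁ * f y))
      ≈⟨ Σ-swap (elements Y) (elements X) _ ⟩
    Σ[ elements X ] (λ x → Σ[ elements Y ] (λ y → [ y ≟ᵥ x ]₁ * f y))
      ≈⟨ Σ-cong∈ (elements X) (λ x∈X → Σ-pick-≡ _≟ᵥ_ f (unique Y) (X⊆Y x∈X)) ⟩
    Σ[ elements X ] f ∎
    where
    open SetoidReasoning setoid
    open DecMembership _≟ᵥ_ using (_∈?_)
    inner : ∀ y → Σ[ elements X ] (λ x → [ y ≟ᵥ x ]₁ * f y) ≈ f y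
    inner y with y ∈? elements X
    ... | yes y∈X = Σ-pick (λ x → y ≟ᵥ x) (λ _ → f y) (unique X) y∈X ≡.refl (λ _ → ≡.sym)
    ... | no y∉X  = trans (Σ-zero∈ (elements X) (λ _ → trans (*-congˡ (f≈0 y∉X)) (zeroʳ _))) (sym (f≈0 y∉X))

  corner-in-cell : ∀ {n} N .{{_ : NonZero N}} (k : Vec (Fin N) n) → InCell k (corner N k)
  corner-in-cell N k i = ≤-refl , *-monoˡ-≤ (<⇒≤ (0<1/ N)) (fromℕ-mono (ℕ.n≤1+n (toℕ (lookup k i))))

  -- Realises several integrals as limits along one common sequence of grids, so that an inequality
  -- between finite averages passes to them.
  Integral⇒⇝ : ∀ {n} (f : Vector ℝ n → ℝ) {I} → Integral f I → (λ N → avg (suc N) (λ k → f (corner (suc N) k))) ⇝ I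
  Integral⇒⇝ f int ε 0<ε = eventually-map (λ {N} p → p (corner (suc N)) (corner-in-cell (suc N))) (int ε 0<ε)

  -- Two applications of Cauchy–Schwarz give ∫|f||g| ≤ ‖f‖₄ ‖g‖₂^½ ‖g‖₁^½.
  avg-hölder : ∀ {n} N .{{_ : NonZero N}} (f g : Vec (Fin N) n → ℂ) →
    let x = avg N (λ k → re (f k *ᶜ conj (g k))) ; w = avg N (λ k → ∣ g k ∣) in
    x * x * (x * x) ≤ avg N (λ k → ∣ f k ∣ ^ 4) * avg N (λ k → norm² (g k)) * (w * w)
  avg-hölder {n} N f g = begin
    x * x * (x * x)
      ≈⟨ *-cong (abs-square x) (abs-square x) ⟨
    abs x * abs x * (abs x * abs x)
      ≤⟨ square-mono-≤ (square-nonneg _) (square-mono-≤ (abs-nonneg x) x≤) ⟩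
    avg N (λ k → u k * (v k * v k)) * avg N (λ k → u k * (v k * v k)) * (avg N (λ k → u k * (v k * v k)) * avg N (λ k → u k * (v k * v k)))
      ≤⟨ square-mono-≤ (square-nonneg _) first ⟩
    avg N (λ k → u k * u k * (v k * v k)) * w * (avg N (λ k → u k * u k * (v k * v k)) * w)
      ≈⟨ solve 2 (λ p w → p :* w :* (p :* w) := p :* p :* (w :* w)) refl (avg N (λ k → u k * u k * (v k * v k))) w ⟩
    avg N (λ k → u k * u k * (v k * v k)) * avg N (λ k → u k * u k * (v k * v k)) * (w * w)
      ≤⟨ *-monoˡ-≤ (square-nonneg w) second ⟩
    avg N (λ k → u k ^ 4) * avg N (λ k → norm² (g k)) * (w * w) ∎
    where
    open ≤-Reasoning
    x = avg N (λ k → re (f k *ᶜ conj (g k)))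
    w = avg N (λ k → ∣ g k ∣)
    u v : Vec (Fin N) n → ℝ
    u k = ∣ f k ∣
    -- With |g| = v², the average of u v² is split first as u v against v, which leaves the averages
    -- of u² v² and |g|, and then the former as u² against v², which leaves those of u⁴ and |g|².
    v k = √ ∣ g k ∣
    vv : ∀ k → v k * v k ≈ ∣ g k ∣
    vv k = √-square (∣∣-nonneg (g k))
    x≤ : abs x ≤ avg N (λ k → u k * (v k * v k))
    x≤ = ≤-trans (abs-avg {n} N _) (avg-mono {n} N (λ k → ≤-trans (abs-re≤ _) (≤-reflexive
      (trans (∣∣-* (f k) (conj (g k))) (*-congˡ (trans (∣conj∣ (g k)) (sym (vv k))))))))
    first : avg N (λ k → u k * (v k * v k)) * avg N (λ k → u k * (v k * v k)) ≤ avg N (λ k → u k * u k * (v k * v k)) * w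
    first = begin
      avg N (λ k → u k * (v k * v k)) * avg N (λ k → u k * (v k * v k))
        ≈⟨ *-cong (avg-cong {n} N (λ k → sym (*-assoc _ _ _))) (avg-cong {n} N (λ k → sym (*-assoc _ _ _))) ⟩
      avg N (λ k → u k * v k * v k) * avg N (λ k → u k * v k * v k)
        ≤⟨ avg-cauchy-schwarz {n} N (λ k → u k * v k) v ⟩
      avg N (λ k → u k * v k * (u k * v k)) * avg N (λ k → v k * v k)
        ≈⟨ *-cong (avg-cong {n} N (λ k → solve 2 (λ u v → u :* v :* (u :* v) := u :* u :* (v :* v)) refl (u k) (v k))) (avg-cong {n} N vv) ⟩
      avg N (λ k → u k * u k * (v k * v k)) * w ∎
    second : avg N (λ k → u k * u k * (v k * v k)) * avg N (λ k → u k * u k * (v k * v k)) ≤ avg N (λ k → u k ^ 4) * avg N (λ k → norm² (g k))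
    second = ≤-trans (avg-cauchy-schwarz {n} N (λ k → u k * u k) (λ k → v k * v k))
      (≤-reflexive (*-cong (avg-cong {n} N (λ k → sym (^4≈ (u k)))) (avg-cong {n} N (λ k → trans (*-cong (vv k) (vv k)) (∣∣-square (g k))))))

  module _ {m} (A D : FiniteSet (ℤ^ m)) (D⊆A : D ⊆ A) (a : ℤ^ m → ℝ) {‖A‖ : ℝ} (is‖A‖ : Is‖ A ‖ ‖A‖) where
    private
      id : ℤ^ m → ℤ^ m
      id x = x
      ones : ℤ^ m → ℝ
      ones _ = 1#
      f g : Vector ℝ m → ℂ
      f = trig (elements D) a id
      g = trig (elements A) ones id

    ∫∣g∣ : Integral (λ t → ∣ g t ∣) ‖A‖
    ∫∣g∣ = ∫-cong {f = λ t → ∣ ∑ᶜ A (λ x → e (x · t)) ∣}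
      (λ t → ∣∣-cong (ℂΣ.Σ-cong (elements A) (λ x → ℂR.sym (ℂR.*-identityˡ (e (x · t)))))) refl (fromHasIntegral {f = λ t → ∣ ∑ᶜ A (λ x → e (x · t)) ∣} is‖A‖)

    ‖A‖-nonneg : 0# ≤ ‖A‖
    ‖A‖-nonneg = ⇝-≤ (0 , λ {N} _ → ≤-trans (≤-reflexive (sym (avg-const {m} (suc N) 0#))) (avg-mono {m} (suc N) (λ k → ∣∣-nonneg (g (corner (suc N) k)))))
      (⇝-const 0#) (Integral⇒⇝ (λ t → ∣ g t ∣) ∫∣g∣)

    -- Each d in D lies in A, where the coefficient is 1, so every frequency of f is met exactly
    -- once.
    ⟨f,g⟩ : pairing (elements D) a id (elements A) ones id ≈ ∑ D a
    ⟨f,g⟩ = Σ-cong∈ (elements D) (λ {d} d∈D → trans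
      (Σ-cong (elements A) (λ x → trans (*-cong (*-identityʳ _) ([]₁-cong (d ≟ᵥ x) (x ≟ᵥ d) ≡.sym ≡.sym)) (*-comm _ _)))
      (Σ-pick-≡ _≟ᵥ_ (λ _ → a d) (unique A) (D⊆A d∈D)))

    ‖g‖₂ : pairing (elements A) ones id (elements A) ones id ≈ fromℕ (card A)
    ‖g‖₂ = trans
      (Σ-cong∈ (elements A) (λ {d} d∈A → trans
        (Σ-cong (elements A) (λ x → trans (*-cong (*-identityʳ _) ([]₁-cong (d ≟ᵥ x) (x ≟ᵥ d) ≡.sym ≡.sym)) (*-comm _ _)))
        (Σ-pick-≡ _≟ᵥ_ (λ _ → 1#) (unique A) d∈A)))
      (Σ-const (elements A))

    -- Hölder's inequality is used on each grid, where it is a statement about finite sums; every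
    -- average in it converges to a quantity already known in terms of coefficients or to ‖A‖.
    duality-bound : ∑ D a * ∑ D a * (∑ D a * ∑ D a) ≤ energy (elements D) a * fromℕ (card A) * (‖A‖ * ‖A‖)
    duality-bound = ⇝-≤ (0 , λ {N} _ → avg-hölder (suc N) (f ∘ corner (suc N)) (g ∘ corner (suc N)))
      (⇝-* (⇝-* x⇝ x⇝) (⇝-* x⇝ x⇝))
      (⇝-* (⇝-* (Integral⇒⇝ (λ t → ∣ f t ∣ ^ 4) (∫-^4 (elements D) a)) (⇝-cong (λ _ → refl) ‖g‖₂ (Integral⇒⇝ (λ t → norm² (g t)) (∫-norm² (elements A) ones id))))
        (⇝-* (Integral⇒⇝ (λ t → ∣ g t ∣) ∫∣g∣) (Integral⇒⇝ (λ t → ∣ g t ∣) ∫∣g∣)))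
      where
      x⇝ : (λ N → avg (suc N) (λ k → re (f (corner (suc N) k) *ᶜ conj (g (corner (suc N) k))))) ⇝ ∑ D a
      x⇝ = ⇝-cong (λ _ → refl) ⟨f,g⟩ (Integral⇒⇝ (λ t → re (f t *ᶜ conj (g t))) (∫-pairing (elements D) a id (elements A) ones id))

-- Decoupling of the near-minimisers and the conclusion.

module DecouplingBound {c ℓ₁ ℓ₂} (R : CompleteOrderedField c ℓ₁ ℓ₂) (F : Reals.ElementaryFunctions R) where
  open Reals R hiding (zero)
  open ExponentialSums F
  open Order R
  open Modulus R F
  open Limits R F
  open Exponential R F
  open RiemannSums R F
  open Energy R F
  open Capacity R F
  open IntegerCoefficients commutativeRing using (module Solver)
  open Solver using (solve; _:=_; _:+_; _:*_; :-_; _:-_; con)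
  open ListSums commutativeRing

  -- The decoupling hypothesis compares only numbers already shown to be L⁴ norms; the fourth root
  -- of the energy is such a number.
  isL⁴Norm : ∀ {n} (X : FiniteSet (ℤ^ n)) a → IsL⁴Norm (expSum X (real ∘ a)) (√ √ energy (elements X) a)
  isL⁴Norm X a = √-nonneg (√-nonneg 0≤E) , toHasIntegral {f = λ ξ → ∣ expSum X (real ∘ a) ξ ∣ ^ 4}
    (∫-cong {f = λ ξ → ∣ expSum X (real ∘ a) ξ ∣ ^ 4} (λ _ → refl) (sym (trans (^4≈ _) (trans (*-cong (√-square (√-nonneg 0≤E)) (√-square (√-nonneg 0≤E))) (√-square 0≤E)))) (∫-^4 (elements X) a))
    where
    0≤E : 0# ≤ energy (elements X) a
    0≤E = energy-nonneg (elements X) a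

  E₂-nonneg : ∀ {n} (X : FiniteSet (ℤ^ n)) μ → 0# ≤ E₂ X μ
  E₂-nonneg X μ = Σ-nonneg (sumset (elements X)) (λ _ → ≤-trans (square-nonneg _) (≤-reflexive (sym (square≈^2 _))))

  module _ {n : ℕ} {X : FiniteSet (ℤ^ n)} {κ} (isCap : IsCap₂ X κ) where
    private
      i = proj₁ isCap
      isGLB = proj₁ (proj₂ isCap)
      κi≈1 = proj₂ (proj₂ isCap)

    0≤inf : 0# ≤ i
    0≤inf = proj₂ isGLB (λ { (μ , _ , E≈) → ≤-trans (E₂-nonneg X μ) (≤-reflexive (sym E≈)) })

    Cap₂-nonneg : 0# ≤ κ
    Cap₂-nonneg κ<0 = ≤-trans (≤-reflexive (sym κi≈1)) κi≤0 0<1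
      where
      κi≤0 : κ * i ≤ 0#
      κi≤0 = ≤-trans (*-monoˡ-≤ 0≤inf (<⇒≤ κ<0)) (≤-reflexive (zeroˡ i))

    -- If no such measure existed, i r would be a lower bound for the energies, so i r ≤ i, and
    -- multiplication by κ would give r ≤ 1. The infimum i is characterised by inequalities alone,
    -- hence the double negation.
    near-minimizer : ∀ {r} → 1# < r → ¬ ¬ ∃ λ μ → IsProbabilityMeasure X μ × κ * E₂ X μ ≤ r
    near-minimizer {r} 1<r none = r≤1 1<r
      where
      open ≤-Reasoning
      ir≤i : i * r ≤ i
      ir≤i = proj₂ isGLB (λ { {E} (μ , prob , E≈) E<ir → none (μ , prob , (begin
        κ * E₂ X μ    ≈⟨ *-congˡ E≈ ⟨
        κ * E         ≤⟨ *-monoʳ-≤ Cap₂-nonneg (<⇒≤ E<ir) ⟩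
        κ * (i * r)   ≈⟨ trans (sym (*-assoc κ i r)) (trans (*-congʳ κi≈1) (*-identityˡ r)) ⟩
        r             ∎)) })
      r≤1 : r ≤ 1#
      r≤1 = begin
        r             ≈⟨ trans (sym (*-assoc κ i r)) (trans (*-congʳ κi≈1) (*-identityˡ r)) ⟨
        κ * (i * r)   ≤⟨ *-monoʳ-≤ Cap₂-nonneg ir≤i ⟩
        κ * i         ≈⟨ κi≈1 ⟩
        1#            ∎

  module _ {m d k} (A D : FiniteSet (ℤ^ m)) (S : FiniteSet (ℤ^ d)) (S[_] : Fin k → FiniteSet (ℤ^ d)) (K : ℝ)
    (D⊆A : D ⊆ A) (iso : FreimanIsomorphism₂ D S) (isPartition : IsPartition S S[_]) (decoupling : IsDecouplingConstant S S[_] K)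
    {‖A‖ : ℝ} (is‖A‖ : Is‖ A ‖ ‖A‖) (κ : Fin k → ℝ) (0≤κ : ∀ θ → 0# ≤ κ θ) where

    open FreimanIsomorphism₂ iso using (φ)
    private
      C M : ℝ
      C = Σ[ List.allFin k ] (λ θ → √ κ θ)
      M = K ^ 2 * √ (fromℕ (card A)) * ‖A‖

    0≤C : 0# ≤ C
    0≤C = Σ-nonneg (List.allFin k) (λ θ → √-nonneg (0≤κ θ))

    0≤M : 0# ≤ M
    0≤M = *-nonneg (*-nonneg (≤-trans (square-nonneg K) (≤-reflexive (sym (square≈^2 K)))) (√-nonneg (fromℕ-nonneg (card A))))
      (‖A‖-nonneg A D D⊆A (λ _ → 0#) is‖A‖)

    module _ {r} (0≤r : 0# ≤ r) (μ : Fin k → ℤ^ d → ℝ) (prob : ∀ θ → IsProbabilityMeasure S[ θ ] (μ θ))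
             (near : ∀ θ → κ θ * E₂ S[ θ ] (μ θ) ≤ r * r) where
      private
        c̃ : Fin k → ℝ
        c̃ θ = √ κ θ
        -- On S_θ the energy of `a` is c̃⁴ E₂(μ_θ) ≤ c̃² r², since c̃² = κ θ. The squared L⁴ norm is
        -- then at most c̃ r, linear in c̃ like the mass c̃ of the piece, so both sum to multiples
        -- of C.
        a : ℤ^ d → ℝ
        a x = Σ[ List.allFin k ] (λ θ → c̃ θ * μ θ x)
        L : ℝ
        L = √ √ energy (elements S) a
        Lθ : Fin k → ℝ
        Lθ θ = √ √ energy (elements S[ θ ]) a
        module P θ = IsProbabilityMeasure (prob θ)
        open IsPartition isPartition

      a-on-part : ∀ θ {x} → x ∈ S[ θ ] → a x ≈ c̃ θ * μ θ x
      a-on-part θ {x} x∈Sθ = trans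
        (Σ-cong (List.allFin k) restrict)
        (Σ-pick-≡ Fin._≟_ (λ θ′ → c̃ θ′ * μ θ′ x) (allFin⁺ k) (∈-allFin θ))
        where
        restrict : ∀ θ′ → c̃ θ′ * μ θ′ x ≈ [ θ′ Fin.≟ θ ]₁ * (c̃ θ′ * μ θ′ x)
        restrict θ′ with θ′ Fin.≟ θ
        ... | yes _     = sym (*-identityˡ _)
        ... | no θ′≢θ   = trans (trans (*-congˡ (P.supported θ′ (λ x∈Sθ′ → θ′≢θ (disjoint x∈Sθ′ x∈Sθ)))) (zeroʳ _)) (sym (zeroˡ _))

      Σa≈C : ∑ S a ≈ C
      Σa≈C = begin
        Σ[ elements S ] (λ x → Σ[ List.allFin k ] (λ θ → c̃ θ * μ θ x))
          ≈⟨ Σ-swap (elements S) (List.allFin k) _ ⟩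
        Σ[ List.allFin k ] (λ θ → Σ[ elements S ] (λ x → c̃ θ * μ θ x))
          ≈⟨ Σ-cong (List.allFin k) (λ θ → trans (Σ-*ˡ (elements S) (c̃ θ) (μ θ)) (trans (*-congˡ (mass θ)) (*-identityʳ _))) ⟩
        C ∎
        where
        open SetoidReasoning setoid
        mass : ∀ θ → Σ[ elements S ] (μ θ) ≈ 1#
        mass θ = trans (Σ-subset {X = S[ θ ]} {S} (λ x∈Sθ → Equivalence.from union (θ , x∈Sθ)) (P.supported θ)) (P.total θ)

      Lθ²≤ : ∀ θ → Lθ θ ^ 2 ≤ c̃ θ * r
      Lθ²≤ θ = begin
        Lθ θ ^ 2                                ≈⟨ trans (square≈^2 _) (√-square (√-nonneg 0≤E)) ⟩
        √ energy (elements S[ θ ]) a            ≤⟨ √-≤ 0≤E (*-nonneg (√-nonneg (0≤κ θ)) 0≤r) energy≤ ⟩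
        c̃ θ * r                                 ∎
        where
        open ≤-Reasoning
        0≤E : 0# ≤ energy (elements S[ θ ]) a
        0≤E = energy-nonneg (elements S[ θ ]) a
        cc : c̃ θ * c̃ θ ≈ κ θ
        cc = √-square (0≤κ θ)
        energy≤ : energy (elements S[ θ ]) a ≤ c̃ θ * r * (c̃ θ * r)
        energy≤ = begin
          energy (elements S[ θ ]) a
            ≈⟨ energy-cong (elements S[ θ ]) (a-on-part θ) ⟩
          energy (elements S[ θ ]) (λ x → c̃ θ * μ θ x)
            ≈⟨ energy-* (elements S[ θ ]) (c̃ θ) (μ θ) ⟩
          c̃ θ * c̃ θ * (c̃ θ * c̃ θ) * energy (elements S[ θ ]) (μ θ)
            ≈⟨ *-cong (*-cong cc cc) (energy≈E₂ S[ θ ] (prob θ)) ⟩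
          κ θ * κ θ * E₂ S[ θ ] (μ θ)
            ≈⟨ *-assoc _ _ _ ⟩
          κ θ * (κ θ * E₂ S[ θ ] (μ θ))
            ≤⟨ *-monoʳ-≤ (0≤κ θ) (near θ) ⟩
          κ θ * (r * r)
            ≈⟨ *-congʳ cc ⟨
          c̃ θ * c̃ θ * (r * r)
            ≈⟨ solve 2 (λ c r → c :* c :* (r :* r) := c :* r :* (c :* r)) refl (c̃ θ) r ⟩
          c̃ θ * r * (c̃ θ * r) ∎

      √energy≤ : √ energy (elements S) a ≤ K * K * (C * r)
      √energy≤ = begin
        √ energy (elements S) a              ≈⟨ √-square (√-nonneg (energy-nonneg (elements S) a)) ⟨
        L * L                                ≤⟨ square-mono-≤ (√-nonneg (√-nonneg (energy-nonneg (elements S) a)))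
                                                  (decoupling (real ∘ a) (isL⁴Norm S a) (λ θ → isL⁴Norm S[ θ ] a)) ⟩
        K * √ T * (K * √ T)                  ≈⟨ solve 2 (λ k t → k :* t :* (k :* t) := k :* k :* (t :* t)) refl K (√ T) ⟩
        K * K * (√ T * √ T)                  ≈⟨ *-congˡ (√-square 0≤T) ⟩
        K * K * T                            ≤⟨ *-monoʳ-≤ (square-nonneg K) T≤ ⟩
        K * K * (C * r)                      ∎
        where
        open ≤-Reasoning
        T : ℝ
        T = sum (λ θ → Lθ θ ^ 2)
        0≤T : 0# ≤ T
        0≤T = ≤-trans (Σ-nonneg (List.allFin k) (λ θ → ≤-trans (square-nonneg (Lθ θ)) (≤-reflexive (sym (square≈^2 _))))) (≤-reflexive (Σ-allFin k _))
        T≤ : T ≤ C * r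
        T≤ = begin
          T                                           ≈⟨ Σ-allFin k _ ⟨
          Σ[ List.allFin k ] (λ θ → Lθ θ ^ 2)         ≤⟨ Σ-mono (List.allFin k) Lθ²≤ ⟩
          Σ[ List.allFin k ] (λ θ → c̃ θ * r)          ≈⟨ Σ-*ʳ (List.allFin k) r c̃ ⟩
          C * r                                       ∎

      C≤Mr : C ≤ M * r
      -- The assumption M r < C to be refuted also makes C positive, which is what allows a factor C
      -- to be cancelled from C² ≤ M r C.
      C≤Mr Mr<C = CC≤ (*-monoˡ-< (≤-<-trans 0≤Mr Mr<C) Mr<C)
        where
        open ≤-Reasoning
        0≤Mr : 0# ≤ M * r
        0≤Mr = *-nonneg 0≤M 0≤r
        E = energy (elements S) a
        s = √ (fromℕ (card A))
        ΣD≈C : ∑ D (a ∘ φ) ≈ C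
        ΣD≈C = trans (Σ-reindex iso a) Σa≈C
        E≤ : E ≤ K * K * (C * r) * (K * K * (C * r))
        E≤ = ≤-trans (≤-reflexive (sym (√-square (energy-nonneg (elements S) a)))) (square-mono-≤ (√-nonneg (energy-nonneg (elements S) a)) √energy≤)
        CC≤ : C * C ≤ M * r * C
        -- The root is extracted from C⁴ ≤ E |A| ‖A‖² ≤ (K² C r)² |A| ‖A‖² = (M r C)².
        CC≤ = square-cancel-≤ (*-nonneg 0≤Mr 0≤C) (begin
          C * C * (C * C)
            ≈⟨ *-cong (*-cong ΣD≈C ΣD≈C) (*-cong ΣD≈C ΣD≈C) ⟨
          ∑ D (a ∘ φ) * ∑ D (a ∘ φ) * (∑ D (a ∘ φ) * ∑ D (a ∘ φ))
            ≤⟨ duality-bound A D D⊆A (a ∘ φ) is‖A‖ ⟩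
          energy (elements D) (a ∘ φ) * fromℕ (card A) * (‖A‖ * ‖A‖)
            ≈⟨ *-congʳ (*-cong (energy-Freiman iso a) (sym (√-square (fromℕ-nonneg (card A))))) ⟩
          E * (s * s) * (‖A‖ * ‖A‖)
            ≤⟨ *-monoˡ-≤ (square-nonneg ‖A‖) (*-monoˡ-≤ (square-nonneg s) E≤) ⟩
          K * K * (C * r) * (K * K * (C * r)) * (s * s) * (‖A‖ * ‖A‖)
            ≈⟨ solve 5 (λ k c r s n → k :* k :* (c :* r) :* (k :* k :* (c :* r)) :* (s :* s) :* (n :* n) :=
                 k :* (k :* con (pos 1)) :* s :* n :* r :* c :* (k :* (k :* con (pos 1)) :* s :* n :* r :* c)) refl K C r s ‖A‖ ⟩
          M * r * C * (M * r * C) ∎)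

  Σ√Cap₂≤ : ∀ {m d k} (A D : FiniteSet (ℤ^ m)) (S : FiniteSet (ℤ^ d)) (S[_] : Fin k → FiniteSet (ℤ^ d)) (K : ℝ) →
    D ⊆ A → FreimanIsomorphism₂ D S → IsPartition S S[_] → IsDecouplingConstant S S[_] K →
    (‖A‖ : ℝ) → Is‖ A ‖ ‖A‖ → (κ : Fin k → ℝ) → (∀ θ → IsCap₂ S[ θ ] (κ θ)) →
    sum (λ θ → √ (κ θ)) ≤ K ^ 2 * √ (fromℕ (card A)) * ‖A‖
  Σ√Cap₂≤ {k = k} A D S S[_] K D⊆A iso isPartition decoupling ‖A‖ is‖A‖ κ isCap =
    ≤-trans (≤-reflexive (sym (Σ-allFin k _))) (≤-by-ε (λ ε 0<ε → small ε (eventually-small M ε 0<ε)))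
    where
    open ≤-Reasoning
    C M : ℝ
    C = Σ[ List.allFin k ] (λ θ → √ κ θ)
    M = K ^ 2 * √ (fromℕ (card A)) * ‖A‖
    0≤κ : ∀ θ → 0# ≤ κ θ
    0≤κ θ = Cap₂-nonneg {X = S[ θ ]} (isCap θ)
    bound : ∀ {r} → 1# < r → C ≤ M * r
    -- The goal is the negation of M r < C, so the doubly negated choice of measures suffices. They
    -- are taken with factor r², which the square root in the L⁴ norms reduces to r.
    bound {r} 1<r Mr<C = ¬¬-Π k (λ θ → near-minimizer {X = S[ θ ]} (isCap θ) 1<rr) (λ near →
      C≤Mr A D S S[_] K D⊆A iso isPartition decoupling is‖A‖ κ 0≤κ (<⇒≤ (<-trans 0<1 1<r))
        (proj₁ ∘ near) (proj₁ ∘ proj₂ ∘ near) (proj₂ ∘ proj₂ ∘ near) Mr<C)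
      where
      1<rr : 1# < r * r
      1<rr = begin-strict
        1#       <⟨ 1<r ⟩
        r        ≈⟨ *-identityʳ r ⟨
        r * 1#   <⟨ *-monoʳ-< (<-trans 0<1 1<r) 1<r ⟩
        r * r    ∎
    small : ∀ ε → Eventually (λ n → M * 1/ (suc n) ≤ ε) → C ≤ M + ε
    small ε (N , p) = begin
      -- Here r = 1 + 1/(N + 1), so that the loss M (r - 1) is at most ε.
      C                         ≤⟨ bound (<-by (1/ (suc N)) (0<1/ (suc N)) refl) ⟩
      M * (1# + 1/ (suc N))     ≈⟨ trans (distribˡ M 1# _) (+-congʳ (*-identityʳ M)) ⟩
      M + M * 1/ (suc N)        ≤⟨ +-monoʳ-≤ M (p ℕ.≤-refl) ⟩
      M + ε                     ∎

theorem12 : ∀ {c ℓ₁ ℓ₂} (R : CompleteOrderedField c ℓ₁ ℓ₂) →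
    let open Reals R in (F : ElementaryFunctions) →
    let open ExponentialSums F in
    (m d k : ℕ)
    (A D : FiniteSet (ℤ^ m)) (S : FiniteSet (ℤ^ d))
    (S[_] : Fin k → FiniteSet (ℤ^ d)) (K : ℝ) →
    D ⊆ A →
    FreimanIsomorphism₂ D S →
    IsPartition S S[_] →
    IsDecouplingConstant S S[_] K →
    (‖A‖ : ℝ) → Is‖ A ‖ ‖A‖ →
    (Cap₂S : Fin k → ℝ) → (∀ θ → IsCap₂ S[ θ ] (Cap₂S θ)) →
    sum (λ θ → √ (Cap₂S θ)) ≤ K ^ 2 * √ (fromℕ (card A)) * ‖A‖
theorem12 R F m d k = DecouplingBound.Σ√Cap₂≤ R F
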